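{- Let $\mathcal{A}(1)$ be the family of all elliptic curves defined over number fields. For each $B \in \mathbb{Z}^+$, the set \[ \mathcal{S}(\mathcal{A}(1),B) = \{ d \in \mathbb{Z}^+ \mid \exists \text{ a number field } F \text{ with } [F:\mathbb{Q}]=d \text{ and an elliptic curve } E_{/F} \text{ with } \# E(F)[\mathrm{tors}] \geq B \} \] contains all but finitely many positive integers. Consequently torsion is not typically bounded on $\mathcal{A}(1)$, i.e. there is $\epsilon>0$ such that for no $B \in \mathbb{Z}^+$ does $\mathcal{S}(\mathcal{A}(1),B)$ have upper density at most $\epsilon$.
   Context: For $\mathcal{S} \subset \mathbb{Z}^+$, the upper density is $\overline{\delta}(\mathcal{S}) = \limsup_{x\to\infty} \#(\mathcal{S}\cap[1,x])/x$. Torsion is typically bounded on a family $\mathcal{F}$ of abelian varieties over number fields if for every $\epsilon>0$ there is $B_\epsilon$ such that the set of $d$ for which some $A_{/F}\in\mathcal{F}$ with $[F:\mathbb{Q}]=d$ has $\#A(F)[\mathrm{tors}]\ge B_\epsilon$ has upper density at most $\epsilon$. -}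

module Defs where

open import Algebra.Bundles using (CommutativeRing; RawMonoid; RawRing)
import Algebra.Definitions.RawMonoid as RawMonoidDefinitions
import Algebra.Definitions.RawSemiring as RawSemiringDefinitions
open import Algebra.Morphism.Structures using (module RingMorphisms)
open import Data.Fin.Base using (Fin)
open import Data.Fin.Properties using (all?)
open import Data.List.Base using (List)
open import Data.List.Membership.Propositional using (_∉_)
open import Data.Nat.Base as ℕ using (ℕ)
open import Data.Product.Base using (Σ-syntax; ∃-syntax; _×_; _,_; proj₁; proj₂)
open import Data.Rational.Base as ℚ using (ℚ; 0ℚ)
import Data.Rational.Properties as ℚ
open import Data.Unit.Polymorphic.Base using (⊤)
open import Data.Integer.Base using (+_)
open import Function.Bundles using (Injection)
open import Level using (0ℓ; _⊔_) renaming (suc to lsuc)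
open import Relation.Binary.Bundles using (Setoid)
import Relation.Binary.Construct.On as On
open import Relation.Binary.PropositionalEquality as ≡ using (_≡_)
open import Relation.Nullary using (¬_; Dec; yes; no)
open import Relation.Unary using (Pred)

------------------------------------------------------------------------
-- Cardinality and density

AtLeast : ∀ {a ℓ} → ℕ → Setoid a ℓ → Set (a ⊔ ℓ)
AtLeast n A = Injection (≡.setoid (Fin n)) A

_∩[1,_] : ∀ {a} → Pred ℕ a → ℕ → Setoid a 0ℓ
S ∩[1, x ] = On.setoid {B = Σ[ k ∈ ℕ ] S k × 1 ℕ.≤ k × k ℕ.≤ x} (≡.setoid ℕ) proj₁

ContainsAllButFinitelyMany⁺ : ∀ {a} → Pred ℕ a → Set a
ContainsAllButFinitelyMany⁺ S =
  Σ[ exceptions ∈ List ℕ ] (∀ d → 1 ℕ.≤ d → d ∉ exceptions → S d)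

-- limsup_{x → ∞} #(S ∩ [1,x]) / x ≤ ε.  As S need not be decidable, the bound
-- on #(S ∩ [1,x]) / x is expressed as a bound on n / x for every n such that
-- S ∩ [1,x] has at least n elements.
UpperDensityAtMost : ∀ {a} → ℚ → Pred ℕ a → Set a
UpperDensityAtMost ε S =
  ∀ η → 0ℚ ℚ.< η →
  ∃[ X ] ∀ x .{{_ : ℕ.NonZero x}} → X ℕ.≤ x →
  ∀ n → AtLeast n (S ∩[1, x ]) → + n ℚ./ x ℚ.≤ ε ℚ.+ η

------------------------------------------------------------------------
-- Number fields

private module ℚR = CommutativeRing ℚ.+-*-commutativeRing

-- A field with a finite basis over ℚ; ι is the inclusion of ℚ, and degree is
-- [F : ℚ].  Equality is decidable because it is so in coordinates.
record NumberField : Set₁ where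
  field
    commutativeRing : CommutativeRing 0ℓ 0ℓ

  open CommutativeRing commutativeRing public
  open RawMonoidDefinitions +-rawMonoid public using (sum) renaming (_×′_ to _·_)
  open RawSemiringDefinitions (RawRing.rawSemiring rawRing) public using (_^_)

  field
    1≉0     : ¬ 1# ≈ 0#
    inverse : ∀ x → ¬ x ≈ 0# → ∃[ y ] x * y ≈ 1#

    ι     : ℚ → Carrier
    ι-hom : RingMorphisms.IsRingHomomorphism ℚR.rawRing rawRing ι

    degree      : ℕ
    basis       : Fin degree → Carrier
    spanning    : ∀ x → Σ[ q ∈ (Fin degree → ℚ) ] x ≈ sum (λ i → ι (q i) * basis i)
    independent : ∀ (q : Fin degree → ℚ) → sum (λ i → ι (q i) * basis i) ≈ 0# →
                  ∀ i → q i ≡ 0ℚ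

  open RingMorphisms.IsRingHomomorphism ι-hom using (0#-homo)
  open import Algebra.Properties.Monoid.Sum +-monoid using (sum-cong-≋; sum-replicate-zero)

  ≈0? : ∀ x → Dec (x ≈ 0#)
  ≈0? x with spanning x
  ... | q , x≈ with all? (λ i → q i ℚ.≟ 0ℚ)
  ... | yes q≡0 = yes (trans x≈ (trans
          (sum-cong-≋ (λ i → trans (*-congʳ (trans (reflexive (≡.cong ι (q≡0 i))) 0#-homo))
                                   (zeroˡ (basis i))))
          (sum-replicate-zero degree)))
  ... | no  q≢0 = no (λ x≈0 → q≢0 (independent q (trans (sym x≈) x≈0)))

  _/_ : (x y : Carrier) → ¬ y ≈ 0# → Carrier
  (x / y) y≉0 = x * proj₁ (inverse y y≉0)

------------------------------------------------------------------------
-- Elliptic curves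

module _ (F : NumberField) where
  open NumberField F

  -- y² + a₁xy + a₃y = x³ + a₂x² + a₄x + a₆
  record WeierstrassEquation : Set where
    field a₁ a₂ a₃ a₄ a₆ : Carrier

    b₂ b₄ b₆ b₈ Δ : Carrier
    b₂ = a₁ ^ 2 + 4 · a₂
    b₄ = 2 · a₄ + a₁ * a₃
    b₆ = a₃ ^ 2 + 4 · a₆
    b₈ = a₁ ^ 2 * a₆ + 4 · (a₂ * a₆) - a₁ * a₃ * a₄ + a₂ * a₃ ^ 2 - a₄ ^ 2
    Δ  = - (b₂ ^ 2 * b₈) - 8 · (b₄ ^ 3) - 27 · (b₆ ^ 2) + 9 · (b₂ * b₄ * b₆)

  -- An elliptic curve over F, presented by a general Weierstrass equation.
  record EllipticCurve : Set where
    field weierstrassEquation : WeierstrassEquation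
    open WeierstrassEquation weierstrassEquation public
    field nonsingular : ¬ Δ ≈ 0#

module _ {F : NumberField} (E : EllipticCurve F) where
  open NumberField F
  open EllipticCurve E
  open import Algebra.Properties.Semiring.Exp semiring using (^-congˡ)
  open import Relation.Binary.Reasoning.Setoid setoid
  open import Algebra.Properties.Group +-group using (x∙y⁻¹≈ε⇒x≈y; x≈y⇒x∙y⁻¹≈ε)
  open import Algebra.Properties.AbelianGroup +-abelianGroup using (xyx⁻¹≈y)

  OnCurve : Carrier → Carrier → Set
  OnCurve x y = y ^ 2 + a₁ * x * y + a₃ * y ≈ x ^ 3 + a₂ * x ^ 2 + a₄ * x + a₆

  data Point : Set where
    ∞      : Point
    affine : ∀ x y → OnCurve x y → Point

  data _≈ₚ_ : Point → Point → Set where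
    ∞      : ∞ ≈ₚ ∞
    affine : ∀ {x y p x′ y′ p′} → x ≈ x′ → y ≈ y′ → affine x y p ≈ₚ affine x′ y′ p′

  pointSetoid : Setoid 0ℓ 0ℓ
  pointSetoid = record
    { Carrier = Point
    ; _≈_ = _≈ₚ_
    ; isEquivalence = record { refl = r ; sym = s ; trans = t }
    }
    where
    r : ∀ {P} → P ≈ₚ P
    r {∞}            = ∞
    r {affine _ _ _} = affine refl refl
    s : ∀ {P Q} → P ≈ₚ Q → Q ≈ₚ P
    s ∞            = ∞
    s (affine p q) = affine (sym p) (sym q)
    t : ∀ {P Q R} → P ≈ₚ Q → Q ≈ₚ R → P ≈ₚ R
    t ∞            ∞              = ∞
    t (affine p q) (affine p′ q′) = affine (trans p p′) (trans q q′)

  -- The inverse of the third intersection point of the curve with the line of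
  -- slope m through (x₁ , y₁), when it meets the curve again at abscissa x₂.
  x₃ : (m x₁ x₂ : Carrier) → Carrier
  x₃ m x₁ x₂ = m ^ 2 + a₁ * m - a₂ - x₁ - x₂

  y₃ : (m x₁ y₁ x₂ : Carrier) → Carrier
  y₃ m x₁ y₁ x₂ = - (m + a₁) * x₃ m x₁ x₂ - (y₁ - m * x₁) - a₃

  tangentNumerator : (x y : Carrier) → Carrier
  tangentNumerator x y = 3 · (x ^ 2) + 2 · (a₂ * x) + a₄ - a₁ * y

  private
    open import Algebra.Solver.Ring.AlmostCommutativeRing
      using (fromCommutativeRing; _-Raw-AlmostCommutative⟶_)
    open import Data.Maybe.Base using (Maybe; just; nothing)
    module ιH = RingMorphisms.IsRingHomomorphism ι-hom

    coefficients : ℚR.rawRing -Raw-AlmostCommutative⟶ fromCommutativeRing commutativeRing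
    coefficients = record
      { ⟦_⟧ = ι ; +-homo = ιH.+-homo ; *-homo = ιH.*-homo ; -‿homo = ιH.-‿homo
      ; 0-homo = ιH.0#-homo ; 1-homo = ιH.1#-homo }

    _coeff≟_ : ∀ p q → Maybe (ι p ≈ ι q)
    p coeff≟ q with p ℚ.≟ q
    ... | yes p≡q = just (reflexive (≡.cong ι p≡q))
    ... | no  _   = nothing

    open import Algebra.Solver.Ring ℚR.rawRing (fromCommutativeRing commutativeRing)
      coefficients _coeff≟_ using (solve; _:+_; _:*_; _:-_; :-_; _:^_; _:=_; Polynomial)

    -- The difference of the two sides of the Weierstrass equation.
    W : Carrier → Carrier → Carrier
    W x y = (y ^ 2 + a₁ * x * y + a₃ * y) - (x ^ 3 + a₂ * x ^ 2 + a₄ * x + a₆)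

    :W : ∀ {n} (a₁ a₂ a₃ a₄ a₆ x y : Polynomial n) → Polynomial n
    :W a₁ a₂ a₃ a₄ a₆ x y =
      (y :^ 2 :+ a₁ :* x :* y :+ a₃ :* y) :- (x :^ 3 :+ a₂ :* x :^ 2 :+ a₄ :* x :+ a₆)

    :x₃ : ∀ {n} (a₁ a₂ m x₁ x₂ : Polynomial n) → Polynomial n
    :x₃ a₁ a₂ m x₁ x₂ = m :^ 2 :+ a₁ :* m :- a₂ :- x₁ :- x₂

    :y₃ : ∀ {n} (a₁ a₂ a₃ m x₁ y₁ x₂ : Polynomial n) → Polynomial n
    :y₃ a₁ a₂ a₃ m x₁ y₁ x₂ =
      :- (m :+ a₁) :* :x₃ a₁ a₂ m x₁ x₂ :- (y₁ :- m :* x₁) :- a₃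

    on⇒W : ∀ {x y} → OnCurve x y → W x y ≈ 0#
    on⇒W p = x≈y⇒x∙y⁻¹≈ε p

    W⇒on : ∀ {x y} → W x y ≈ 0# → OnCurve x y
    W⇒on p = x∙y⁻¹≈ε⇒x≈y _ _ p

    W-cong : ∀ {x x′ y y′} → x ≈ x′ → y ≈ y′ → W x y ≈ W x′ y′
    W-cong p q =
      +-cong (+-cong (+-cong (^-congˡ 2 q) (*-cong (*-congˡ p) q)) (*-congˡ q))
        (-‿cong (+-congʳ (+-cong (+-cong (^-congˡ 3 p) (*-congˡ (^-congˡ 2 p))) (*-congˡ p))))

    cancel : ∀ {u v} → ¬ u ≈ 0# → u * v ≈ 0# → v ≈ 0#
    cancel {u} {v} u≉0 uv≈0 with inverse u u≉0
    ... | u⁻¹ , uu⁻¹≈1 = begin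
      v              ≈⟨ *-identityˡ v ⟨
      1# * v         ≈⟨ *-congʳ (trans (*-comm u⁻¹ u) uu⁻¹≈1) ⟨
      u⁻¹ * u * v    ≈⟨ *-assoc u⁻¹ u v ⟩
      u⁻¹ * (u * v)  ≈⟨ *-congˡ uv≈0 ⟩
      u⁻¹ * 0#       ≈⟨ zeroʳ u⁻¹ ⟩
      0#             ∎

    *-vanishes : ∀ {u v} → v ≈ 0# → u * v ≈ 0#
    *-vanishes {u} v≈0 = trans (*-congˡ v≈0) (zeroʳ u)

    +-vanishes : ∀ {u v} → u ≈ 0# → v ≈ 0# → u + v ≈ 0#
    +-vanishes u≈0 v≈0 = trans (+-cong u≈0 v≈0) (+-identityˡ 0#)

    chord-identity : ∀ m x₁ y₁ x₂ →
      (x₂ - x₁) * W (x₃ m x₁ x₂) (y₃ m x₁ y₁ x₂) ≈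
      (x₃ m x₁ x₂ - x₁) * W x₂ (y₁ + m * (x₂ - x₁)) + (x₂ - x₃ m x₁ x₂) * W x₁ y₁
    chord-identity m x₁ y₁ x₂ = solve 9 (λ a₁ a₂ a₃ a₄ a₆ m x₁ y₁ x₂ →
      (x₂ :- x₁) :* :W a₁ a₂ a₃ a₄ a₆ (:x₃ a₁ a₂ m x₁ x₂) (:y₃ a₁ a₂ a₃ m x₁ y₁ x₂) :=
      (:x₃ a₁ a₂ m x₁ x₂ :- x₁) :* :W a₁ a₂ a₃ a₄ a₆ x₂ (y₁ :+ m :* (x₂ :- x₁))
        :+ (x₂ :- :x₃ a₁ a₂ m x₁ x₂) :* :W a₁ a₂ a₃ a₄ a₆ x₁ y₁)
      refl a₁ a₂ a₃ a₄ a₆ m x₁ y₁ x₂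

    tangent-identity : ∀ m x₁ y₁ →
      W (x₃ m x₁ x₁) (y₃ m x₁ y₁ x₁) ≈
      W x₁ y₁ + (x₃ m x₁ x₁ - x₁) * (m * (y₁ + y₁ + a₁ * x₁ + a₃) - tangentNumerator x₁ y₁)
    tangent-identity m x₁ y₁ = solve 8 (λ a₁ a₂ a₃ a₄ a₆ m x₁ y₁ →
      :W a₁ a₂ a₃ a₄ a₆ (:x₃ a₁ a₂ m x₁ x₁) (:y₃ a₁ a₂ a₃ m x₁ y₁ x₁) :=
      :W a₁ a₂ a₃ a₄ a₆ x₁ y₁ :+ (:x₃ a₁ a₂ m x₁ x₁ :- x₁) :*
        (m :* (y₁ :+ y₁ :+ a₁ :* x₁ :+ a₃) :-
          (x₁ :^ 2 :+ x₁ :^ 2 :+ x₁ :^ 2 :+ (a₂ :* x₁ :+ a₂ :* x₁) :+ a₄ :- a₁ :* y₁)))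
      refl a₁ a₂ a₃ a₄ a₆ m x₁ y₁

    fibre-identity : ∀ x y₁ y₂ →
      (y₁ + y₂ + a₁ * x + a₃) * (y₁ - y₂) ≈ W x y₁ - W x y₂
    fibre-identity = solve 8 (λ a₁ a₂ a₃ a₄ a₆ x y₁ y₂ →
      (y₁ :+ y₂ :+ a₁ :* x :+ a₃) :* (y₁ :- y₂) :=
      :W a₁ a₂ a₃ a₄ a₆ x y₁ :- :W a₁ a₂ a₃ a₄ a₆ x y₂)
      refl a₁ a₂ a₃ a₄ a₆

    quotient-* : ∀ n d (d≉0 : ¬ d ≈ 0#) → (n / d) d≉0 * d ≈ n
    quotient-* n d d≉0 = trans (*-assoc n _ d)
      (trans (*-congˡ (trans (*-comm _ d) (proj₂ (inverse d d≉0)))) (*-identityʳ n))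

  chord-closed : ∀ {x₁ y₁ x₂ y₂} → OnCurve x₁ y₁ → OnCurve x₂ y₂ →
    (x₁≉x₂ : ¬ x₂ - x₁ ≈ 0#) → let m = ((y₂ - y₁) / (x₂ - x₁)) x₁≉x₂ in
    OnCurve (x₃ m x₁ x₂) (y₃ m x₁ y₁ x₂)
  chord-closed {x₁} {y₁} {x₂} {y₂} p q x₁≉x₂ =
    W⇒on (cancel x₁≉x₂ (trans (chord-identity m x₁ y₁ x₂)
      (+-vanishes (*-vanishes (trans (W-cong refl y₁+m≈y₂) (on⇒W q)))
                  (*-vanishes (on⇒W p)))))
    where
    m = ((y₂ - y₁) / (x₂ - x₁)) x₁≉x₂
    y₁+m≈y₂ : y₁ + m * (x₂ - x₁) ≈ y₂
    y₁+m≈y₂ = trans (+-congˡ (quotient-* _ _ x₁≉x₂))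
                    (trans (sym (+-assoc y₁ y₂ (- y₁))) (xyx⁻¹≈y y₁ y₂))

  tangent-closed : ∀ {x₁ y₁ x₂ y₂} → OnCurve x₁ y₁ → OnCurve x₂ y₂ → x₁ ≈ x₂ →
    (d≉0 : ¬ y₁ + y₂ + a₁ * x₂ + a₃ ≈ 0#) →
    let m = (tangentNumerator x₁ y₁ / (y₁ + y₂ + a₁ * x₂ + a₃)) d≉0 in
    OnCurve (x₃ m x₁ x₁) (y₃ m x₁ y₁ x₁)
  tangent-closed {x₁} {y₁} {x₂} {y₂} p q x₁≈x₂ d≉0 =
    W⇒on (trans (tangent-identity m x₁ y₁)
      (+-vanishes (on⇒W p) (*-vanishes (x≈y⇒x∙y⁻¹≈ε
        (trans (*-congˡ (+-congʳ (+-cong (+-congˡ y₁≈y₂) (*-congˡ x₁≈x₂))))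
               (quotient-* _ _ d≉0))))))
    where
    m = (tangentNumerator x₁ y₁ / (y₁ + y₂ + a₁ * x₂ + a₃)) d≉0
    y₁≈y₂ : y₁ ≈ y₂
    y₁≈y₂ = x∙y⁻¹≈ε⇒x≈y y₁ y₂ (cancel d≉0 (trans (fibre-identity x₂ y₁ y₂)
      (x≈y⇒x∙y⁻¹≈ε (trans (W-cong (sym x₁≈x₂) refl) (trans (on⇒W p) (sym (on⇒W q)))))))

  -- The chord-tangent law.  When x₁ ≈ x₂ and the points are not opposite they
  -- coincide, so that y₁ + y₂ + a₁x₂ + a₃ is the usual denominator
  -- 2y₁ + a₁x₁ + a₃ of the tangent slope.
  infixl 6 _⊕_
  _⊕_ : Point → Point → Point
  ∞ ⊕ Q = Q
  P@(affine _ _ _) ⊕ ∞ = P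
  affine x₁ y₁ p ⊕ affine x₂ y₂ q with ≈0? (x₂ - x₁) | ≈0? (y₁ + y₂ + a₁ * x₂ + a₃)
  ... | no x₁≉x₂  | _       = affine _ _ (chord-closed p q x₁≉x₂)
  ... | yes x₁≈x₂ | yes _   = ∞
  ... | yes x₁≈x₂ | no d≉0  =
    affine _ _ (tangent-closed p q (sym (x∙y⁻¹≈ε⇒x≈y x₂ x₁ x₁≈x₂)) d≉0)

  pointRawMonoid : RawMonoid 0ℓ 0ℓ
  pointRawMonoid = record { Carrier = Point ; _≈_ = _≈ₚ_ ; _∙_ = _⊕_ ; ε = ∞ }

  private module P = RawMonoidDefinitions pointRawMonoid

  IsTorsion : Point → Set
  IsTorsion P = ∃[ n ] 1 ℕ.≤ n × (n P.× P) ≈ₚ ∞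

  torsionPoints : Setoid 0ℓ 0ℓ
  torsionPoints = On.setoid {B = Σ[ P ∈ Point ] IsTorsion P} pointSetoid proj₁

------------------------------------------------------------------------
-- Torsion in families of elliptic curves over number fields

EllipticCurveFamily : Set₂
EllipticCurveFamily = (F : NumberField) → EllipticCurve F → Set₁

𝒜⟨1⟩ : EllipticCurveFamily
𝒜⟨1⟩ F E = ⊤

𝒮 : EllipticCurveFamily → ℕ → Pred ℕ (lsuc 0ℓ)
𝒮 𝓕 B d =
  Σ[ F ∈ NumberField ] NumberField.degree F ≡ d ×
  Σ[ E ∈ EllipticCurve F ] 𝓕 F E × AtLeast B (torsionPoints E)

-- Rational ε suffice: having upper density at most ε is monotone in ε.
TypicallyBounded : EllipticCurveFamily → Set₁
TypicallyBounded 𝓕 =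
  ∀ ε → 0ℚ ℚ.< ε → ∃[ B ] 1 ℕ.≤ B × UpperDensityAtMost ε (𝒮 𝓕 B)

{-# OPTIONS --safe #-}
module Submission where

-- The curve E_Θ : y² + (2 + Θ) x y + Θ y = x³ has a point T of order 2 of abscissa -1.
-- A point of abscissa x becomes, after K doublings, a point whose double is T exactly
-- when F(x , Θ) = 0, for an explicit integral polynomial F of bidegree (M , c).
-- Substituting x = sⁱ / 2ᵃ and Θ = 2ᵇ / sʲ turns F into a monic polynomial f in s of
-- degree d = M i + c j.  Where M v₂(x) = c v₂(Θ) and 0 ≤ v₂(Θ) ≤ 2, no term of F has
-- smaller valuation than x^M and Θ^c, which stand at opposite corners of its Newton
-- polygon; so the 2-adic Newton polygon of f is a single segment.  M and c being
-- coprime, every large d occurs, and the exponents can be chosen so that the height h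
-- of the segment is prime to d.  Then f is irreducible (Dumas), and over ℚ[s]/(f), of
-- degree exactly d, a quadratic twist of E_Θ has a rational point of order 2^(K+2).
--
-- Of the group law only P ⊕ (P ⊕ Q) = (P ⊕ P) ⊕ Q is needed: it shows that P is torsion
-- as soon as P ⊕ P is.

open import Defs
open import Data.Nat.Base using (ℕ; _≤_)
open import Data.Product.Base using (∃-syntax; _×_)
open import Data.Rational.Base using (0ℚ; _<_)
open import Relation.Nullary using (¬_)

-- On `E_Θ` the point (0 , 0) has order 3, so doubling preserves the abscissa 0: the numerator `N′`
-- is a multiple of `N`, and F(0 , Θ) is the pure power Θ^c, whence a Newton polygon with a known
-- corner. The exponents satisfy 2 M = 3 c + 1. Hence the solutions of j c + i M = d are i = 2 d - c
-- n, j = M n - 3 d, and those of b c + a M = h are a = 2 h - c m, b = M m - 3 h. Give s the weight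
-- h and 2 the weight d. Then x has weight c (d m - n h) and Θ has weight M (d m - n h), so all
-- conditions on valuations reduce to one equation d m - n h = g. Bézout solves it with g = gcd(n ,
-- d), which is at most M because it divides j; for large d this keeps v₂(Θ) ≤ 2. The equation
-- determines h only modulo d / g, and that freedom is what makes h prime to d even when g > 1. The
-- root s provides an abscissa only; the twist is chosen so that the ordinate is rational too,
-- without enlarging the field.

module AlgebraSolver where

  open import Algebra.Bundles using (CommutativeRing)
  open import Algebra.Morphism.Structures using (module RingMorphisms)
  open import Data.Maybe.Base using (Maybe; just; nothing)
  open import Data.Rational.Base using (ℚ)
  import Data.Rational.Properties as ℚ
  open import Level using (0ℓ)
  open import Relation.Binary.PropositionalEquality as ≡ using ()
  open import Relation.Nullary using (yes; no)

  private module ℚR = CommutativeRing ℚ.+-*-commutativeRing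

  module ℚAlgebraSolver (R : CommutativeRing 0ℓ 0ℓ) (ι : ℚ → CommutativeRing.Carrier R)
    (ι-hom : RingMorphisms.IsRingHomomorphism ℚR.rawRing (CommutativeRing.rawRing R) ι) where
    open CommutativeRing R using (_≈_; reflexive)
    open import Algebra.Solver.Ring.AlmostCommutativeRing
      using (fromCommutativeRing; _-Raw-AlmostCommutative⟶_)
    private module H = RingMorphisms.IsRingHomomorphism ι-hom

    coefficients : ℚR.rawRing -Raw-AlmostCommutative⟶ fromCommutativeRing R
    coefficients = record
      { ⟦_⟧ = ι ; +-homo = H.+-homo ; *-homo = H.*-homo ; -‿homo = H.-‿homo
      ; 0-homo = H.0#-homo ; 1-homo = H.1#-homo }

    _coeff≟_ : ∀ p q → Maybe (ι p ≈ ι q)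
    p coeff≟ q with p ℚ.≟ q
    ... | yes p≡q = just (reflexive (≡.cong ι p≡q))
    ... | no  _   = nothing

    open import Algebra.Solver.Ring ℚR.rawRing (fromCommutativeRing R) coefficients _coeff≟_ public
      using (solve; _:+_; _:*_; _:-_; :-_; _:^_; _:=_; con; Polynomial)

-- The chord-tangent law: the left alternative law, and torsion from repeated doubling.

module GroupLaw where

  open AlgebraSolver
  open import Data.Nat.Base as ℕ using (ℕ; zero; suc)
  import Data.Nat.Properties as ℕ
  open import Data.Fin.Base using (Fin; toℕ)
  open import Data.Fin.Properties using (toℕ<n; toℕ-injective)
  open import Relation.Binary.Definitions using (tri<; tri≈; tri>)
  open import Data.Product.Base using (Σ-syntax; ∃-syntax; _×_; _,_; proj₂)
  open import Data.Rational.Base as ℚ using (ℚ; 0ℚ)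
  open import Relation.Nullary using (¬_; Dec; yes; no; contradiction)
  open import Relation.Binary.PropositionalEquality as ≡ using (_≡_)
  open import Relation.Binary.Bundles using (Setoid)
  open import Algebra.Morphism.Structures using (module RingMorphisms)

  module NumberFieldProperties (F : NumberField) where
    open NumberField F
    open import Algebra.Properties.Group +-group public using (x∙y⁻¹≈ε⇒x≈y; x≈y⇒x∙y⁻¹≈ε; ε⁻¹≈ε)
    open ℚAlgebraSolver commutativeRing ι ι-hom public

    open RingMorphisms.IsRingHomomorphism ι-hom public using () renaming (0#-homo to ι0≈0)

    x*y≈0⇒y≈0 : ∀ {x y} → ¬ x ≈ 0# → x * y ≈ 0# → y ≈ 0#
    x*y≈0⇒y≈0 {x} {y} x≉0 xy≈0 with inverse x x≉0
    ... | x⁻¹ , xx⁻¹≈1 = trans (sym (*-identityˡ y)) (trans (*-congʳ (trans (sym xx⁻¹≈1) (*-comm x x⁻¹)))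
            (trans (*-assoc x⁻¹ x y) (trans (*-congˡ xy≈0) (zeroʳ x⁻¹))))

    *-cancelˡ-≉0 : ∀ {x y z} → ¬ x ≈ 0# → x * y ≈ x * z → y ≈ z
    *-cancelˡ-≉0 {x} {y} {z} x≉0 xy≈xz = x∙y⁻¹≈ε⇒x≈y y z (x*y≈0⇒y≈0 x≉0
      (trans (solve 3 (λ x y z → x :* (y :- z) := x :* y :- x :* z) refl x y z) (x≈y⇒x∙y⁻¹≈ε xy≈xz)))

    x≉0∧y≉0⇒x*y≉0 : ∀ {x y} → ¬ x ≈ 0# → ¬ y ≈ 0# → ¬ x * y ≈ 0#
    x≉0∧y≉0⇒x*y≉0 x≉0 y≉0 xy≈0 = y≉0 (x*y≈0⇒y≈0 x≉0 xy≈0)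

    quotient : ∀ x y → ¬ y ≈ 0# → ∃[ z ] z * y ≈ x
    quotient x y y≉0 with inverse y y≉0
    ... | y⁻¹ , yy⁻¹≈1 = x * y⁻¹ , trans (*-assoc x y⁻¹ y)
            (trans (*-congˡ (trans (*-comm y⁻¹ y) yy⁻¹≈1)) (*-identityʳ x))

    x+0*y≈x : ∀ {x y z} → z ≈ 0# → x + y * z ≈ x
    x+0*y≈x {x} {y} z≈0 = trans (+-congˡ (trans (*-congˡ z≈0) (zeroʳ y))) (+-identityʳ x)

    x-0≈x : ∀ {x y} → y ≈ 0# → x - y ≈ x
    x-0≈x {x} y≈0 = trans (+-congˡ (trans (-‿cong y≈0) ε⁻¹≈ε)) (+-identityʳ x)

  module _ {F : NumberField} (E : EllipticCurve F) where
    open NumberField F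
    open NumberFieldProperties F
    open EllipticCurve E
    open import Algebra.Properties.Semiring.Exp semiring using (^-congˡ)

    private
      Pt = Point E
      _≋_ = _≈ₚ_ E
      module ≋ = Setoid (pointSetoid E)
      _∔_ = _⊕_ E
      x₃′ = x₃ E
      y₃′ = y₃ E
      infixl 6 _∔_
      infix 4 _≋_

    -- Coordinates up to `_≈_`, detached from the proof that the point lies on the curve. Sums can
    -- then be computed with any slope that satisfies its defining equation, free of division and of
    -- the case split in `_⊕_`.
    data At : Pt → Carrier → Carrier → Set where
      at : ∀ {x y p x′ y′} → x ≈ x′ → y ≈ y′ → At (affine x y p) x′ y′

    at-resp : ∀ {P x y x′ y′} → At P x y → x ≈ x′ → y ≈ y′ → At P x′ y′
    at-resp (at p q) r s = at (trans p r) (trans q s)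

    at⇒≈ : ∀ {P Q x y} → At P x y → At Q x y → P ≋ Q
    at⇒≈ (at p q) (at r s) = affine (trans p (sym r)) (trans q (sym s))

    ≈⇒at : ∀ {P Q x y} → P ≋ Q → At P x y → At Q x y
    ≈⇒at (affine p q) (at r s) = at (trans (sym p) r) (trans (sym q) s)

    at-self : ∀ {x y p} → At (affine x y p) x y
    at-self = at refl refl

    x₃-cong : ∀ {m m′ x₁ x₁′ x₂ x₂′} → m ≈ m′ → x₁ ≈ x₁′ → x₂ ≈ x₂′ → x₃′ m x₁ x₂ ≈ x₃′ m′ x₁′ x₂′
    x₃-cong p q r = +-cong (+-cong (+-congʳ (+-cong (^-congˡ 2 p) (*-congˡ p))) (-‿cong q)) (-‿cong r)

    y₃-cong : ∀ {m m′ x₁ x₁′ y₁ y₁′ x₂ x₂′} → m ≈ m′ → x₁ ≈ x₁′ → y₁ ≈ y₁′ → x₂ ≈ x₂′ →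
              y₃′ m x₁ y₁ x₂ ≈ y₃′ m′ x₁′ y₁′ x₂′
    y₃-cong p q r s = +-congʳ (+-cong (*-cong (-‿cong (+-congʳ p)) (x₃-cong p q s))
                                      (-‿cong (+-cong r (-‿cong (*-cong p q)))))

    tangentNumerator-cong : ∀ {x x′ y y′} → x ≈ x′ → y ≈ y′ →
      tangentNumerator E x y ≈ tangentNumerator E x′ y′
    tangentNumerator-cong {x} {x′} p q = +-cong (+-congʳ (+-cong (+-cong (+-cong x²≈ x²≈) x²≈)
      (+-cong (*-congˡ p) (*-congˡ p)))) (-‿cong (*-congˡ q))
      where
      x²≈ : x ^ 2 ≈ x′ ^ 2
      x²≈ = ^-congˡ 2 p

    -cong₂ : ∀ {a a′ b b′} → a ≈ a′ → b ≈ b′ → a - b ≈ a′ - b′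
    -cong₂ p q = +-cong p (-‿cong q)

    quotient-unique : ∀ {n d m n′ d′ : Carrier} (d≉0 : ¬ d ≈ 0#) → n ≈ n′ → d ≈ d′ → m * d′ ≈ n′ → (n / d) d≉0 ≈ m
    quotient-unique {n} {d} {m} d≉0 n≈ d≈ e with inverse d d≉0
    ... | d⁻¹ , dd⁻¹≈1 = trans (*-congʳ (trans n≈ (trans (sym e) (*-congˡ (sym d≈)))))
          (trans (*-assoc m d d⁻¹) (trans (*-congˡ dd⁻¹≈1) (*-identityʳ m)))

    ⊕-chord : ∀ {P Q x₁ y₁ x₂ y₂ m} → At P x₁ y₁ → At Q x₂ y₂ → ¬ x₂ - x₁ ≈ 0# →
              m * (x₂ - x₁) ≈ y₂ - y₁ → At (P ∔ Q) (x₃′ m x₁ x₂) (y₃′ m x₁ y₁ x₂)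
    ⊕-chord {affine x y _} {affine x′ y′ _} (at p q) (at r s) ne e
      with ≈0? (x′ - x) | ≈0? (y + y′ + a₁ * x′ + a₃)
    ... | yes eq | _ = contradiction (trans (sym (-cong₂ r p)) eq) ne
    ... | no  nz | _ = at (x₃-cong m≈ p r) (y₃-cong m≈ p q r)
      where m≈ = quotient-unique nz (-cong₂ s q) (-cong₂ r p) e

    ⊕-tangent : ∀ {P Q x y₁ y₂ m} → At P x y₁ → At Q x y₂ → ¬ y₁ + y₂ + a₁ * x + a₃ ≈ 0# →
                m * (y₁ + y₂ + a₁ * x + a₃) ≈ tangentNumerator E x y₁ →
                At (P ∔ Q) (x₃′ m x x) (y₃′ m x y₁ x)
    ⊕-tangent {affine x y _} {affine x′ y′ _} (at p q) (at r s) ne e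
      with ≈0? (x′ - x) | ≈0? (y + y′ + a₁ * x′ + a₃)
    ... | no nz  | _      = contradiction (x≈y⇒x∙y⁻¹≈ε (trans r (sym p))) nz
    ... | yes eq | yes eq′ = contradiction (trans (sym (+-congʳ (+-cong (+-cong q s) (*-congˡ r)))) eq′) ne
    ... | yes eq | no nz  = at (x₃-cong m≈ p p) (y₃-cong m≈ p q p)
      where m≈ = quotient-unique nz (tangentNumerator-cong p q)
                   (+-congʳ (+-cong (+-cong q s) (*-congˡ r))) e

    ⊕-vertical : ∀ {P Q x y₁ y₂} → At P x y₁ → At Q x y₂ → y₁ + y₂ + a₁ * x + a₃ ≈ 0# → P ∔ Q ≡ ∞
    ⊕-vertical {affine x y _} {affine x′ y′ _} (at p q) (at r s) e
      with ≈0? (x′ - x) | ≈0? (y + y′ + a₁ * x′ + a₃)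
    ... | no nz  | _      = contradiction (x≈y⇒x∙y⁻¹≈ε (trans r (sym p))) nz
    ... | yes eq | no nz  = contradiction (trans (+-congʳ (+-cong (+-cong q s) (*-congˡ r))) e) nz
    ... | yes eq | yes eq′ = ≡.refl

    ⊕-cong : ∀ {P P′ Q Q′} → P ≋ P′ → Q ≋ Q′ → P ∔ Q ≋ P′ ∔ Q′
    ⊕-cong ∞ Q≈ = Q≈
    ⊕-cong (affine p q) ∞ = affine p q
    ⊕-cong {P@(affine x y _)} {P′} {Q@(affine x′ y′ _)} {Q′} (affine p q) (affine r s) =
      helper (≈0? (x′ - x)) (≈0? (y + y′ + a₁ * x′ + a₃))
      where
      at₁ : At P′ x y
      at₁ = at (sym p) (sym q)
      at₂ : At Q′ x′ y′
      at₂ = at (sym r) (sym s)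
      helper : Dec (x′ - x ≈ 0#) → Dec (y + y′ + a₁ * x′ + a₃ ≈ 0#) → P ∔ Q ≋ P′ ∔ Q′
      helper (no nz) _ with quotient (y′ - y) (x′ - x) nz
      ... | m , e = at⇒≈ (⊕-chord at-self at-self nz e) (⊕-chord at₁ at₂ nz e)
      helper (yes eq) (yes eq′) = ≋.reflexive (≡.trans (⊕-vertical (at x≈ refl) at-self eq′)
                                    (≡.sym (⊕-vertical (at-resp at₁ x≈ refl) at₂ eq′)))
        where
        x≈ : x ≈ x′
        x≈ = sym (x∙y⁻¹≈ε⇒x≈y x′ x eq)
      helper (yes eq) (no nz) with quotient (tangentNumerator E x′ y) (y + y′ + a₁ * x′ + a₃) nz
      ... | m , e = at⇒≈ (⊕-tangent (at x≈ refl) at-self nz e)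
                         (⊕-tangent (at-resp at₁ x≈ refl) at₂ nz e)
        where
        x≈ : x ≈ x′
        x≈ = sym (x∙y⁻¹≈ε⇒x≈y x′ x eq)

    ⊕-congˡ : ∀ P {Q Q′} → Q ≋ Q′ → P ∔ Q ≋ P ∔ Q′
    ⊕-congˡ P = ⊕-cong {P} ≋.refl

    ⊕-identityʳ : ∀ P → P ∔ ∞ ≋ P
    ⊕-identityʳ ∞ = ∞
    ⊕-identityʳ (affine _ _ _) = affine refl refl

    private
      W : Carrier → Carrier → Carrier
      W x y = (y ^ 2 + a₁ * x * y + a₃ * y) - (x ^ 3 + a₂ * x ^ 2 + a₄ * x + a₆)

      :W : ∀ {n} (a₁ a₂ a₃ a₄ a₆ x y : Polynomial n) → Polynomial n
      :W a₁ a₂ a₃ a₄ a₆ x y =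
        (y :^ 2 :+ a₁ :* x :* y :+ a₃ :* y) :- (x :^ 3 :+ a₂ :* x :^ 2 :+ a₄ :* x :+ a₆)

      :x₃ : ∀ {n} (a₁ a₂ m x₁ x₂ : Polynomial n) → Polynomial n
      :x₃ a₁ a₂ m x₁ x₂ = m :^ 2 :+ a₁ :* m :- a₂ :- x₁ :- x₂

      :y₃ : ∀ {n} (a₁ a₂ a₃ m x₁ y₁ x₂ : Polynomial n) → Polynomial n
      :y₃ a₁ a₂ a₃ m x₁ y₁ x₂ =
        :- (m :+ a₁) :* :x₃ a₁ a₂ m x₁ x₂ :- (y₁ :- m :* x₁) :- a₃

      :tn : ∀ {n} (a₁ a₂ a₄ x y : Polynomial n) → Polynomial n
      :tn a₁ a₂ a₄ x y =
        x :^ 2 :+ x :^ 2 :+ x :^ 2 :+ (a₂ :* x :+ a₂ :* x) :+ a₄ :- a₁ :* y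

    at⇒W≈0 : ∀ {P x y} → At P x y → W x y ≈ 0#
    at⇒W≈0 {affine x y p} {x′} {y′} (at q r) = trans (sym (-cong₂
      (+-cong (+-cong (^-congˡ 2 r) (*-cong (*-congˡ q) r)) (*-congˡ r))
      (+-congʳ (+-cong (+-cong (^-congˡ 3 q) (*-congˡ (^-congˡ 2 q))) (*-congˡ q)))))
      (x≈y⇒x∙y⁻¹≈ε p)

    ⊕-comm-chord : ∀ {P Q x₁ y₁ x₂ y₂} → At P x₁ y₁ → At Q x₂ y₂ → ¬ x₂ - x₁ ≈ 0# → P ∔ Q ≋ Q ∔ P
    ⊕-comm-chord {P} {Q} {x₁} {y₁} {x₂} {y₂} p q ne with quotient (y₂ - y₁) (x₂ - x₁) ne
    ... | m , e = at⇒≈ (⊕-chord p q ne e)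
      (at-resp (⊕-chord q p ne′ e′)
        (solve 5 (λ a₁ a₂ m x₁ x₂ → :x₃ a₁ a₂ m x₂ x₁ := :x₃ a₁ a₂ m x₁ x₂) refl a₁ a₂ m x₁ x₂)
        (trans (solve 8 (λ a₁ a₂ a₃ m x₁ y₁ x₂ y₂ → :y₃ a₁ a₂ a₃ m x₂ y₂ x₁ :=
                  :y₃ a₁ a₂ a₃ m x₁ y₁ x₂ :+ (m :* (x₂ :- x₁) :- (y₂ :- y₁))) refl
                  a₁ a₂ a₃ m x₁ y₁ x₂ y₂)
               (trans (+-congˡ (x≈y⇒x∙y⁻¹≈ε e)) (+-identityʳ _))))
      where
      negate : ∀ x y → x - y ≈ - (y - x)
      negate = solve 2 (λ x y → x :- y := :- (y :- x)) refl
      ne′ : ¬ x₁ - x₂ ≈ 0#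
      ne′ eq = ne (x≈y⇒x∙y⁻¹≈ε (sym (x∙y⁻¹≈ε⇒x≈y _ _ eq)))
      e′ : m * (x₁ - x₂) ≈ y₁ - y₂
      e′ = trans (trans (*-congˡ (negate x₁ x₂)) (solve 2 (λ m d → m :* (:- d) := :- (m :* d)) refl m _))
                 (trans (-‿cong e) (sym (negate y₁ y₂)))

    -- In the coordinates (u , v) = (x - x₀ , y - y₀ - m (x - x₀)) centred at a point
    -- P with tangent slope m, the curve is v² + α u v + w v = u³ + e u².
    module _ {P : Pt} {x₀ y₀ m : Carrier} (P-at : At P x₀ y₀) where
      private
        α w e : Carrier
        α = m + m + a₁
        w = y₀ + y₀ + a₁ * x₀ + a₃
        e = x₀ + x₀ + x₀ + a₂ - m * m - a₁ * m

        :α : ∀ {n} (a₁ m : Polynomial n) → Polynomial n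
        :α a₁ m = m :+ m :+ a₁
        :w : ∀ {n} (a₁ a₃ x₀ y₀ : Polynomial n) → Polynomial n
        :w a₁ a₃ x₀ y₀ = y₀ :+ y₀ :+ a₁ :* x₀ :+ a₃
        :e : ∀ {n} (a₁ a₂ m x₀ : Polynomial n) → Polynomial n
        :e a₁ a₂ m x₀ = x₀ :+ x₀ :+ x₀ :+ a₂ :- m :* m :- a₁ :* m

      module _ (w≉0 : ¬ w ≈ 0#) (mw≈ : m * w ≈ tangentNumerator E x₀ y₀) where

        S-at : At (P ∔ P) (x₃′ m x₀ x₀) (y₃′ m x₀ y₀ x₀)
        S-at = ⊕-tangent P-at P-at w≉0 mw≈

        -- There is no linear term in u because its coefficient is the tangent condition on m;
        -- adding that vanishing multiple of u turns the claim into a polynomial identity.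
        shifted-equation : ∀ {Q u v} → At Q (x₀ + u) (y₀ + m * u + v) →
          (v * v + α * u * v + w * v) - u * u * (u + e) ≈ 0#
        shifted-equation {Q} {u} {v} q = trans (sym (+-identityʳ _)) (trans (+-cong refl (sym
            (trans (*-congˡ (x≈y⇒x∙y⁻¹≈ε mw≈)) (zeroʳ u))))
          (trans (solve 10 (λ a₁ a₂ a₃ a₄ a₆ m x₀ y₀ u v →
              (v :* v :+ :α a₁ m :* u :* v :+ :w a₁ a₃ x₀ y₀ :* v) :- u :* u :* (u :+ :e a₁ a₂ m x₀)
                :+ u :* (m :* :w a₁ a₃ x₀ y₀ :- :tn a₁ a₂ a₄ x₀ y₀)
              := :W a₁ a₂ a₃ a₄ a₆ (x₀ :+ u) (y₀ :+ m :* u :+ v) :- :W a₁ a₂ a₃ a₄ a₆ x₀ y₀)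
              refl a₁ a₂ a₃ a₄ a₆ m x₀ y₀ u v)
            (trans (-cong₂ (at⇒W≈0 q) (at⇒W≈0 P-at)) (-‿inverseʳ 0#))))

        -- u = ρ l and v = ρ l², where l is the slope of P Q in these coordinates.
        module _ {Q : Pt} {ρ l : Carrier} (q : At Q (x₀ + ρ * l) (y₀ + m * (ρ * l) + ρ * l * l))
                 (ρ≉0 : ¬ ρ ≈ 0#) (l≉0 : ¬ l ≈ 0#) where
          private
            κ : Carrier
            κ = l * l + α * l - e - ρ * l
            :κ : ∀ {n} (a₁ a₂ m x₀ ρ l : Polynomial n) → Polynomial n
            :κ a₁ a₂ m x₀ ρ l = l :* l :+ :α a₁ m :* l :- :e a₁ a₂ m x₀ :- ρ :* l

          -- Substituting u = ρ l and v = ρ l² turns the shifted equation into ρ l² (w + ρ κ) = 0.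
          -- Here κ is the abscissa of P ⊕ Q relative to that of P, so w ≠ 0 shows that P ⊕ Q
          -- differs from both P and -P.
          w+ρκ≈0 : w + ρ * κ ≈ 0#
          w+ρκ≈0 = x*y≈0⇒y≈0 (x≉0∧y≉0⇒x*y≉0 ρ≉0 (x≉0∧y≉0⇒x*y≉0 l≉0 l≉0)) (trans
            (solve 8 (λ a₁ a₂ a₃ m x₀ y₀ ρ l →
              ρ :* (l :* l) :* (:w a₁ a₃ x₀ y₀ :+ ρ :* :κ a₁ a₂ m x₀ ρ l) :=
              (ρ :* l :* l :* (ρ :* l :* l) :+ :α a₁ m :* (ρ :* l) :* (ρ :* l :* l) :+ :w a₁ a₃ x₀ y₀ :* (ρ :* l :* l))
                :- ρ :* l :* (ρ :* l) :* (ρ :* l :+ :e a₁ a₂ m x₀)) refl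
              a₁ a₂ a₃ m x₀ y₀ ρ l)
            (shifted-equation q))

          κ≉0 : ¬ κ ≈ 0#
          κ≉0 κ≈0 = w≉0 (trans (sym (x+0*y≈x κ≈0)) w+ρκ≈0)

          private
            -- the slopes of the lines P Q, P (P ⊕ Q), S Q
            m₁ m₂ m₃ xₛ yₛ xᵤ yᵤ : Carrier
            m₁ = m + l
            m₂ = ρ - l - m - a₁
            m₃ = ρ - m - a₁
            xₛ = x₃′ m x₀ x₀
            yₛ = y₃′ m x₀ y₀ x₀
            xᵤ = x₃′ m₁ x₀ (x₀ + ρ * l)
            yᵤ = y₃′ m₁ x₀ y₀ (x₀ + ρ * l)

          U-at : At (P ∔ Q) xᵤ yᵤ
          U-at = ⊕-chord P-at q
            (λ eq → x≉0∧y≉0⇒x*y≉0 ρ≉0 l≉0 (trans (solve 2 (λ x u → u := x :+ u :- x) refl x₀ (ρ * l)) eq))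
            (solve 5 (λ m x₀ y₀ ρ l → (m :+ l) :* (x₀ :+ ρ :* l :- x₀) :=
               y₀ :+ m :* (ρ :* l) :+ ρ :* l :* l :- y₀) refl m x₀ y₀ ρ l)

          P+U-at : At (P ∔ (P ∔ Q)) (x₃′ m₂ x₀ xᵤ) (y₃′ m₂ x₀ y₀ xᵤ)
          P+U-at = ⊕-chord P-at U-at
            (λ eq → κ≉0 (trans (solve 6 (λ a₁ a₂ m x₀ ρ l → :κ a₁ a₂ m x₀ ρ l :=
               :x₃ a₁ a₂ (m :+ l) x₀ (x₀ :+ ρ :* l) :- x₀) refl a₁ a₂ m x₀ ρ l) eq))
            (trans (solve 8 (λ a₁ a₂ a₃ m x₀ y₀ ρ l →
                 (ρ :- l :- m :- a₁) :* (:x₃ a₁ a₂ (m :+ l) x₀ (x₀ :+ ρ :* l) :- x₀) :=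
                 (:y₃ a₁ a₂ a₃ (m :+ l) x₀ y₀ (x₀ :+ ρ :* l) :- y₀)
                   :+ (:w a₁ a₃ x₀ y₀ :+ ρ :* :κ a₁ a₂ m x₀ ρ l)) refl a₁ a₂ a₃ m x₀ y₀ ρ l)
               (trans (+-congˡ w+ρκ≈0) (+-identityʳ _)))

          S+Q-at : At ((P ∔ P) ∔ Q) (x₃′ m₃ xₛ (x₀ + ρ * l)) (y₃′ m₃ xₛ yₛ (x₀ + ρ * l))
          y-difference : y₀ + m * (ρ * l) + ρ * l * l - yₛ ≈ m₃ * (x₀ + ρ * l - xₛ)
          y-difference = sym (trans (solve 8 (λ a₁ a₂ a₃ m x₀ y₀ ρ l →
                 (ρ :- m :- a₁) :* (x₀ :+ ρ :* l :- :x₃ a₁ a₂ m x₀ x₀) :=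
                 (y₀ :+ m :* (ρ :* l) :+ ρ :* l :* l :- :y₃ a₁ a₂ a₃ m x₀ y₀ x₀)
                   :- (:w a₁ a₃ x₀ y₀ :+ ρ :* :κ a₁ a₂ m x₀ ρ l)) refl a₁ a₂ a₃ m x₀ y₀ ρ l)
               (x-0≈x w+ρκ≈0))

          S+Q-at with ≈0? (x₀ + ρ * l - xₛ)
          ... | no nz = ⊕-chord S-at q nz (sym y-difference)
          -- When S and Q share their abscissa, `y-difference` makes the ordinates agree as well, so
          -- S ⊕ Q is a doubling. Its tangent denominator is ρ l², which is non-zero, and the
          -- tangent slope is again m₃, so the formulas of the chord case persist.
          ... | yes δ≈0 = at-resp (⊕-tangent S-at′ q den≉0 slope)
                  (x₃-cong refl (x∙y⁻¹≈ε⇒x≈y _ _ δ≈0) refl)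
                  (y₃-cong refl (x∙y⁻¹≈ε⇒x≈y _ _ δ≈0) y≈ refl)
            where
            y≈ : y₀ + m * (ρ * l) + ρ * l * l ≈ yₛ
            y≈ = x∙y⁻¹≈ε⇒x≈y _ _ (trans y-difference (trans (*-congˡ δ≈0) (zeroʳ m₃)))
            S-at′ : At (P ∔ P) (x₀ + ρ * l) (y₀ + m * (ρ * l) + ρ * l * l)
            S-at′ = at-resp S-at (sym (x∙y⁻¹≈ε⇒x≈y _ _ δ≈0)) (sym y≈)
            δ den : Carrier
            δ = x₀ + ρ * l - xₛ
            den = (y₀ + m * (ρ * l) + ρ * l * l) + (y₀ + m * (ρ * l) + ρ * l * l) + a₁ * (x₀ + ρ * l) + a₃
            den≈ : den ≈ ρ * (l * l)
            den≈ = trans (solve 8 (λ a₁ a₂ a₃ m x₀ y₀ ρ l →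
                (y₀ :+ m :* (ρ :* l) :+ ρ :* l :* l) :+ (y₀ :+ m :* (ρ :* l) :+ ρ :* l :* l)
                  :+ a₁ :* (x₀ :+ ρ :* l) :+ a₃ :=
                ρ :* (l :* l) :+ (:w a₁ a₃ x₀ y₀ :+ ρ :* :κ a₁ a₂ m x₀ ρ l)
                  :+ ρ :* (x₀ :+ ρ :* l :- :x₃ a₁ a₂ m x₀ x₀)) refl a₁ a₂ a₃ m x₀ y₀ ρ l)
              (trans (x+0*y≈x δ≈0) (trans (+-congˡ w+ρκ≈0) (+-identityʳ _)))
            den≉0 : ¬ den ≈ 0#
            den≉0 eq = x≉0∧y≉0⇒x*y≉0 ρ≉0 (x≉0∧y≉0⇒x*y≉0 l≉0 l≉0) (trans (sym den≈) eq)
            slope : m₃ * den ≈ tangentNumerator E (x₀ + ρ * l) (y₀ + m * (ρ * l) + ρ * l * l)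
            slope = trans (solve 9 (λ a₁ a₂ a₃ a₄ m x₀ y₀ ρ l →
                (ρ :- m :- a₁) :* ((y₀ :+ m :* (ρ :* l) :+ ρ :* l :* l) :+ (y₀ :+ m :* (ρ :* l) :+ ρ :* l :* l)
                  :+ a₁ :* (x₀ :+ ρ :* l) :+ a₃) :=
                :tn a₁ a₂ a₄ (x₀ :+ ρ :* l) (y₀ :+ m :* (ρ :* l) :+ ρ :* l :* l)
                  :+ (m :* :w a₁ a₃ x₀ y₀ :- :tn a₁ a₂ a₄ x₀ y₀)
                  :+ (ρ :- :α a₁ m) :* (:w a₁ a₃ x₀ y₀ :+ ρ :* :κ a₁ a₂ m x₀ ρ l)
                  :+ ((ρ :- :α a₁ m) :* ρ :- (ρ :* l :+ ρ :* l)) :* (x₀ :+ ρ :* l :- :x₃ a₁ a₂ m x₀ x₀))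
                refl a₁ a₂ a₃ a₄ m x₀ y₀ ρ l)
              (trans (x+0*y≈x δ≈0) (trans (x+0*y≈x w+ρκ≈0)
                (trans (+-congˡ (x≈y⇒x∙y⁻¹≈ε mw≈)) (+-identityʳ _))))

          -- Both sides are explicit in m, ρ and l. The abscissas agree identically, the ordinates
          -- modulo w + ρ κ = 0.
          ⊕-alternative-generic : (P ∔ P) ∔ Q ≋ P ∔ (P ∔ Q)
          ⊕-alternative-generic = at⇒≈ S+Q-at (at-resp P+U-at
            (solve 6 (λ a₁ a₂ m x₀ ρ l →
               :x₃ a₁ a₂ (ρ :- l :- m :- a₁) x₀ (:x₃ a₁ a₂ (m :+ l) x₀ (x₀ :+ ρ :* l)) :=
               :x₃ a₁ a₂ (ρ :- m :- a₁) (:x₃ a₁ a₂ m x₀ x₀) (x₀ :+ ρ :* l)) refl a₁ a₂ m x₀ ρ l)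
            (trans (solve 8 (λ a₁ a₂ a₃ m x₀ y₀ ρ l →
               :y₃ a₁ a₂ a₃ (ρ :- l :- m :- a₁) x₀ y₀ (:x₃ a₁ a₂ (m :+ l) x₀ (x₀ :+ ρ :* l)) :=
               :y₃ a₁ a₂ a₃ (ρ :- m :- a₁) (:x₃ a₁ a₂ m x₀ x₀) (:y₃ a₁ a₂ a₃ m x₀ y₀ x₀) (x₀ :+ ρ :* l)
                 :- (:w a₁ a₃ x₀ y₀ :+ ρ :* :κ a₁ a₂ m x₀ ρ l)) refl a₁ a₂ a₃ m x₀ y₀ ρ l)
              (x-0≈x w+ρκ≈0)))

        -- For Q = P the claim is that P commutes with S = P ⊕ P. This is symmetry of the chord,
        -- unless S and P share their abscissa; then the tangent meets the curve at P alone, S = -P,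
        -- and both sums are ∞.
        ⊕-alternative-same : ∀ {Q} → At Q x₀ y₀ → (P ∔ P) ∔ Q ≋ P ∔ (P ∔ Q)
        ⊕-alternative-same {Q} q = ≋.trans (⊕-congˡ (P ∔ P) Q≈P)
          (≋.trans (commute (≈0? (x₀ - x₃′ m x₀ x₀))) (⊕-congˡ P (⊕-congˡ P (≋.sym Q≈P))))
          where
          Q≈P : Q ≋ P
          Q≈P = at⇒≈ q P-at
          commute : Dec (x₀ - x₃′ m x₀ x₀ ≈ 0#) → (P ∔ P) ∔ P ≋ P ∔ (P ∔ P)
          commute (no nz) = ⊕-comm-chord S-at P-at nz
          commute (yes eq) = ≋.reflexive (≡.trans (⊕-vertical S-at (at-resp P-at x≈ refl) (opposite _ _ refl))
              (≡.sym (⊕-vertical (at-resp P-at x≈ refl) S-at (opposite _ _ (+-comm _ _)))))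
            where
            x≈ : x₀ ≈ x₃′ m x₀ x₀
            x≈ = x∙y⁻¹≈ε⇒x≈y _ _ eq
            opposite : ∀ y y′ → y + y′ ≈ y₃′ m x₀ y₀ x₀ + y₀ → y + y′ + a₁ * x₃′ m x₀ x₀ + a₃ ≈ 0#
            opposite y y′ y≈ = trans (+-congʳ (+-congʳ y≈)) (trans
              (solve 6 (λ a₁ a₂ a₃ m x₀ y₀ → :y₃ a₁ a₂ a₃ m x₀ y₀ x₀ :+ y₀ :+ a₁ :* :x₃ a₁ a₂ m x₀ x₀ :+ a₃
                 := m :* (x₀ :- :x₃ a₁ a₂ m x₀ x₀)) refl a₁ a₂ a₃ m x₀ y₀)
              (trans (*-congˡ eq) (zeroʳ m)))

        ⊕-alternative-inverse : ∀ {Q} → At Q x₀ (- y₀ - a₁ * x₀ - a₃) → (P ∔ P) ∔ Q ≋ P ∔ (P ∔ Q)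
        ⊕-alternative-inverse {Q} q = ≋.trans (at⇒≈ (S-P (≈0? (x₀ - x₃′ m x₀ x₀))) P-at)
            (≋.trans (≋.sym (⊕-identityʳ P)) (⊕-congˡ P (≋.sym (≋.reflexive
              (⊕-vertical P-at q (trans (solve 4 (λ a₁ a₃ x₀ y₀ →
                y₀ :+ (:- y₀ :- a₁ :* x₀ :- a₃) :+ a₁ :* x₀ :+ a₃ := con 0ℚ) refl a₁ a₃ x₀ y₀) ι0≈0))))))
          where
          S-P : Dec (x₀ - x₃′ m x₀ x₀ ≈ 0#) → At ((P ∔ P) ∔ Q) x₀ y₀
          S-P (no nz) = at-resp (⊕-chord {m = - m - a₁} S-at q nz
              (solve 6 (λ a₁ a₂ a₃ m x₀ y₀ → (:- m :- a₁) :* (x₀ :- :x₃ a₁ a₂ m x₀ x₀) :=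
                 (:- y₀ :- a₁ :* x₀ :- a₃) :- :y₃ a₁ a₂ a₃ m x₀ y₀ x₀) refl a₁ a₂ a₃ m x₀ y₀))
            (solve 4 (λ a₁ a₂ m x₀ → :x₃ a₁ a₂ (:- m :- a₁) (:x₃ a₁ a₂ m x₀ x₀) x₀ := x₀) refl a₁ a₂ m x₀)
            (solve 6 (λ a₁ a₂ a₃ m x₀ y₀ →
              :y₃ a₁ a₂ a₃ (:- m :- a₁) (:x₃ a₁ a₂ m x₀ x₀) (:y₃ a₁ a₂ a₃ m x₀ y₀ x₀) x₀ := y₀) refl
              a₁ a₂ a₃ m x₀ y₀)
          -- Here S = Q = -P, and the tangent at -P has slope - m - a₁, the same as the chord of the
          -- other case.
          S-P (yes eq) = at-resp (⊕-tangent {m = - m - a₁} S-at′ q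
              (λ z → w≉0 (trans (solve 4 (λ a₁ a₃ x₀ y₀ → :w a₁ a₃ x₀ y₀ :=
                 :- ((:- y₀ :- a₁ :* x₀ :- a₃) :+ (:- y₀ :- a₁ :* x₀ :- a₃) :+ a₁ :* x₀ :+ a₃)) refl a₁ a₃ x₀ y₀)
                 (trans (-‿cong z) ε⁻¹≈ε)))
              (trans (solve 7 (λ a₁ a₂ a₃ a₄ m x₀ y₀ →
                 (:- m :- a₁) :* ((:- y₀ :- a₁ :* x₀ :- a₃) :+ (:- y₀ :- a₁ :* x₀ :- a₃) :+ a₁ :* x₀ :+ a₃) :=
                 :tn a₁ a₂ a₄ x₀ (:- y₀ :- a₁ :* x₀ :- a₃) :+ (m :* :w a₁ a₃ x₀ y₀ :- :tn a₁ a₂ a₄ x₀ y₀))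
                 refl a₁ a₂ a₃ a₄ m x₀ y₀)
                (trans (+-congˡ (x≈y⇒x∙y⁻¹≈ε mw≈)) (+-identityʳ _))))
            (trans (solve 4 (λ a₁ a₂ m x₀ → :x₃ a₁ a₂ (:- m :- a₁) x₀ x₀ :=
               x₀ :- (x₀ :- :x₃ a₁ a₂ m x₀ x₀)) refl a₁ a₂ m x₀) (x-0≈x eq))
            (trans (solve 6 (λ a₁ a₂ a₃ m x₀ y₀ →
               :y₃ a₁ a₂ a₃ (:- m :- a₁) x₀ (:- y₀ :- a₁ :* x₀ :- a₃) x₀ :=
               y₀ :- m :* (x₀ :- :x₃ a₁ a₂ m x₀ x₀)) refl a₁ a₂ a₃ m x₀ y₀)
              (x-0≈x (trans (*-congˡ eq) (zeroʳ m))))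
            where
            S-at′ : At (P ∔ P) x₀ (- y₀ - a₁ * x₀ - a₃)
            S-at′ = at-resp S-at (sym (x∙y⁻¹≈ε⇒x≈y _ _ eq))
              (trans (solve 6 (λ a₁ a₂ a₃ m x₀ y₀ → :y₃ a₁ a₂ a₃ m x₀ y₀ x₀ :=
                  (:- y₀ :- a₁ :* x₀ :- a₃) :+ (m :+ a₁) :* (x₀ :- :x₃ a₁ a₂ m x₀ x₀)) refl a₁ a₂ a₃ m x₀ y₀)
                (x+0*y≈x eq))

        -- Q = - (P ⊕ P), the residual intersection of the tangent at P
        ⊕-alternative-tangent : ∀ {Q} → At Q (x₃′ m x₀ x₀) (y₀ + m * (x₃′ m x₀ x₀ - x₀)) →
          ¬ x₃′ m x₀ x₀ - x₀ ≈ 0# → (P ∔ P) ∔ Q ≋ P ∔ (P ∔ Q)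
        ⊕-alternative-tangent {Q} q ne = ≋.reflexive (≡.trans
            (⊕-vertical S-at q (trans (solve 6 (λ a₁ a₂ a₃ m x₀ y₀ → :y₃ a₁ a₂ a₃ m x₀ y₀ x₀
               :+ (y₀ :+ m :* (:x₃ a₁ a₂ m x₀ x₀ :- x₀)) :+ a₁ :* :x₃ a₁ a₂ m x₀ x₀ :+ a₃ := con 0ℚ) refl
               a₁ a₂ a₃ m x₀ y₀) ι0≈0))
            (≡.sym (⊕-vertical P-at U-at′ (trans (solve 4 (λ a₁ a₃ x₀ y₀ →
                y₀ :+ (:- y₀ :- a₁ :* x₀ :- a₃) :+ a₁ :* x₀ :+ a₃ := con 0ℚ) refl a₁ a₃ x₀ y₀) ι0≈0))))
          where
          U-at′ : At (P ∔ Q) x₀ (- y₀ - a₁ * x₀ - a₃)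
          U-at′ = at-resp (⊕-chord {m = m} P-at q ne
              (solve 3 (λ m u y₀ → m :* u := y₀ :+ m :* u :- y₀) refl m _ y₀))
            (solve 4 (λ a₁ a₂ m x₀ → :x₃ a₁ a₂ m x₀ (:x₃ a₁ a₂ m x₀ x₀) := x₀) refl a₁ a₂ m x₀)
            (solve 6 (λ a₁ a₂ a₃ m x₀ y₀ → :y₃ a₁ a₂ a₃ m x₀ y₀ (:x₃ a₁ a₂ m x₀ x₀) :=
               :- y₀ :- a₁ :* x₀ :- a₃) refl a₁ a₂ a₃ m x₀ y₀)

        -- The excluded values of ρ and l are special positions of Q. If u = v = 0 then Q = P; if
        -- only u = 0 then Q = -P; if only v = 0 then Q lies on the tangent at P, so Q = -(P ⊕ P).
        -- Otherwise l = v / u and ρ = u / l.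
        ⊕-alternative-at : ∀ {Q u v} → At Q (x₀ + u) (y₀ + m * u + v) → (P ∔ P) ∔ Q ≋ P ∔ (P ∔ Q)
        ⊕-alternative-at {Q} {u} {v} q = cases (≈0? u) (≈0? v)
          where
          cases : Dec (u ≈ 0#) → Dec (v ≈ 0#) → (P ∔ P) ∔ Q ≋ P ∔ (P ∔ Q)
          cases (yes u≈0) (yes v≈0) = ⊕-alternative-same (at-resp q
            (trans (+-congˡ u≈0) (+-identityʳ x₀)) (trans (+-congˡ v≈0) (trans (+-identityʳ _) (x+0*y≈x u≈0))))
          cases (yes u≈0) (no v≉0) = ⊕-alternative-inverse (at-resp q
            (trans (+-congˡ u≈0) (+-identityʳ x₀))
            (trans (solve 6 (λ a₁ a₃ x₀ y₀ u v → y₀ :+ u :+ v :=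
                (:- y₀ :- a₁ :* x₀ :- a₃) :+ u :+ (v :+ :w a₁ a₃ x₀ y₀)) refl a₁ a₃ x₀ y₀ (m * u) v)
              (trans (+-congˡ v+w≈0) (trans (+-identityʳ _) (x+0*y≈x u≈0)))))
            where
            v+w≈0 : v + w ≈ 0#
            v+w≈0 = x*y≈0⇒y≈0 v≉0 (trans (solve 5 (λ u v α w e → v :* (v :+ w) :=
               (v :* v :+ α :* u :* v :+ w :* v) :- u :* u :* (u :+ e) :+ (u :* (u :+ e) :- α :* v) :* u)
               refl u v α w e) (trans (x+0*y≈x u≈0) (shifted-equation q)))
          cases (no u≉0) (yes v≈0) = ⊕-alternative-tangent (at-resp q x≈
              (trans (+-congˡ v≈0) (trans (+-identityʳ _) (+-congˡ (*-congˡ (trans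
                (solve 2 (λ x u → u := x :+ u :- x) refl x₀ u) (+-congʳ x≈)))))))
              (λ eq → u≉0 (trans (solve 2 (λ x u → u := x :+ u :- x) refl x₀ u) (trans (+-congʳ x≈) eq)))
            where
            u+e≈0 : u + e ≈ 0#
            u+e≈0 = x*y≈0⇒y≈0 (x≉0∧y≉0⇒x*y≉0 u≉0 u≉0) (trans (solve 5 (λ u v α w e → u :* u :* (u :+ e) :=
               :- ((v :* v :+ α :* u :* v :+ w :* v) :- u :* u :* (u :+ e)) :+ (v :+ α :* u :+ w) :* v) refl u v α w e)
               (trans (x+0*y≈x v≈0) (trans (-‿cong (shifted-equation q)) ε⁻¹≈ε)))
            x≈ : x₀ + u ≈ x₃′ m x₀ x₀
            x≈ = trans (solve 5 (λ a₁ a₂ m x₀ u → x₀ :+ u := :x₃ a₁ a₂ m x₀ x₀ :+ (u :+ :e a₁ a₂ m x₀)) refl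
                   a₁ a₂ m x₀ u) (trans (+-congˡ u+e≈0) (+-identityʳ _))
          cases (no u≉0) (no v≉0) with quotient v u u≉0
          ... | l , lu≈v = generic
            where
            l≉0 : ¬ l ≈ 0#
            l≉0 l≈0 = v≉0 (trans (sym lu≈v) (trans (*-congʳ l≈0) (zeroˡ u)))
            generic : (P ∔ P) ∔ Q ≋ P ∔ (P ∔ Q)
            generic with quotient u l l≉0
            ... | ρ , ρl≈u = ⊕-alternative-generic (at-resp q (+-congˡ (sym ρl≈u))
                (+-cong (+-congˡ (*-congˡ (sym ρl≈u))) (trans (sym lu≈v) (trans (*-comm l u) (*-congʳ (sym ρl≈u))))))
                (λ ρ≈0 → u≉0 (trans (sym ρl≈u) (trans (*-congʳ ρ≈0) (zeroˡ l)))) l≉0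

        ⊕-alternative : ∀ Q → (P ∔ P) ∔ Q ≋ P ∔ (P ∔ Q)
        ⊕-alternative ∞ = ≋.trans (⊕-identityʳ (P ∔ P)) (⊕-congˡ P (≋.sym (⊕-identityʳ P)))
        ⊕-alternative (affine x y _) = ⊕-alternative-at {u = x - x₀} {v = y - y₀ - m * (x - x₀)} (at
          (solve 2 (λ x x₀ → x := x₀ :+ (x :- x₀)) refl x x₀)
          (solve 5 (λ x y x₀ y₀ m → y := y₀ :+ m :* (x :- x₀) :+ (y :- y₀ :- m :* (x :- x₀))) refl x y x₀ y₀ m))

    module _ where
      open import Algebra.Definitions.RawMonoid (pointRawMonoid E) using () renaming (_×_ to _×ₚ_)

      -- Multiples nest to the right, so each summand P ⊕ P is split by one instance of the
      -- alternative law.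
      ×ₚ-double : ∀ P → (∀ Q → (P ∔ P) ∔ Q ≋ P ∔ (P ∔ Q)) → ∀ n → n ×ₚ (P ∔ P) ≋ (n ℕ.* 2) ×ₚ P
      ×ₚ-double P alt zero = ≋.refl
      ×ₚ-double P alt (suc n) = ≋.trans (⊕-congˡ (P ∔ P) (×ₚ-double P alt n)) (alt ((n ℕ.* 2) ×ₚ P))

      -- A multiple of P ⊕ P is an even multiple of P by the alternative law, which is available
      -- when the tangent at P is not vertical; when it is vertical, 2 P is already ∞.
      torsion-half : ∀ P → IsTorsion E (P ∔ P) → IsTorsion E P
      torsion-half ∞ _ = 1 , ℕ.s≤s ℕ.z≤n , ∞
      torsion-half P@(affine x y _) (n , 1≤n , n×2P≈∞) = by-cases P at-self n×2P≈∞ (≈0? (y + y + a₁ * x + a₃))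
        where
        by-cases : ∀ P → At P x y → n ×ₚ (P ∔ P) ≋ ∞ → Dec (y + y + a₁ * x + a₃ ≈ 0#) → IsTorsion E P
        by-cases P p n×2P≈∞ (yes w≈0) = 2 , ℕ.s≤s ℕ.z≤n , ≋.trans (⊕-congˡ P (⊕-identityʳ P))
                                          (≋.reflexive (⊕-vertical p p w≈0))
        by-cases P p n×2P≈∞ (no w≉0) with quotient (tangentNumerator E x y) _ w≉0
        ... | m , mw≈ = n ℕ.* 2 , ℕ.*-mono-≤ 1≤n (ℕ.s≤s {n = 1} ℕ.z≤n) ,
                ≋.trans (≋.sym (×ₚ-double P (⊕-alternative p w≉0 mw≈) n)) n×2P≈∞

    2^_•_ : ℕ → Pt → Pt
    2^ zero  • P = P
    2^ suc n • P = 2^ n • (P ∔ P)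

    2^•-cong : ∀ n {P Q} → P ≋ Q → 2^ n • P ≋ 2^ n • Q
    2^•-cong zero    P≈Q = P≈Q
    2^•-cong (suc n) P≈Q = 2^•-cong n (⊕-cong P≈Q P≈Q)

    2^•-∞ : ∀ n → 2^ n • ∞ ≡ ∞
    2^•-∞ zero    = ≡.refl
    2^•-∞ (suc n) = 2^•-∞ n

    2^•-+ : ∀ m n P → 2^ (m ℕ.+ n) • P ≡ 2^ n • (2^ m • P)
    2^•-+ zero    n P = ≡.refl
    2^•-+ (suc m) n P = 2^•-+ m n (P ∔ P)

    2^•-mono-∞ : ∀ {m n P} → m ℕ.≤ n → 2^ m • P ≋ ∞ → 2^ n • P ≋ ∞
    2^•-mono-∞ {m} {n} {P} m≤n e = ≡.subst (λ k → 2^ k • P ≋ ∞) (ℕ.m+[n∸m]≡n m≤n)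
      (≋.trans (≋.reflexive (2^•-+ m (n ℕ.∸ m) P))
        (≋.trans (2^•-cong (n ℕ.∸ m) e) (≋.reflexive (2^•-∞ (n ℕ.∸ m)))))

    2^•≈∞⇒torsion : ∀ n {P} → 2^ n • P ≋ ∞ → IsTorsion E P
    2^•≈∞⇒torsion zero    {P} e = 1 , ℕ.s≤s ℕ.z≤n , ≋.trans (⊕-identityʳ P) e
    2^•≈∞⇒torsion (suc n) {P} e = torsion-half P (2^•≈∞⇒torsion n e)

    module _ {n : ℕ} {P : Pt} (2^1+nP≈∞ : 2^ suc n • P ≋ ∞) (2^nP≉∞ : ¬ 2^ n • P ≋ ∞) where

      -- Doubling such an equality n + 1 - j more times gives ∞ on the right, hence ∞ after i + (n +
      -- 1 - j) ≤ n doublings of P, which is too early.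
      2^•-distinct : ∀ {i j} → i ℕ.< j → j ℕ.≤ n → ¬ 2^ i • P ≋ 2^ j • P
      2^•-distinct {i} {j} i<j j≤n e = 2^nP≉∞ (2^•-mono-∞ i+r≤n
        (≋.trans (≋.reflexive (2^•-+ i r P)) (≋.trans (2^•-cong r e)
          (≋.trans (≋.reflexive (≡.sym (2^•-+ j r P)))
            (≡.subst (λ k → 2^ k • P ≋ ∞) (≡.sym j+r≡1+n) 2^1+nP≈∞)))))
        where
        r : ℕ
        r = suc n ℕ.∸ j
        j+r≡1+n : j ℕ.+ r ≡ suc n
        j+r≡1+n = ℕ.m+[n∸m]≡n (ℕ.m≤n⇒m≤1+n j≤n)
        i+r≤n : i ℕ.+ r ℕ.≤ n
        i+r≤n = ℕ.s≤s⁻¹ (≡.subst (i ℕ.+ r ℕ.<_) j+r≡1+n (ℕ.+-monoˡ-< r i<j))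

      2^•-torsion : ∀ {i} → i ℕ.≤ n → IsTorsion E (2^ i • P)
      2^•-torsion {i} i≤n = 2^•≈∞⇒torsion (suc n ℕ.∸ i)
        (≋.trans (≋.reflexive (≡.sym (2^•-+ i (suc n ℕ.∸ i) P)))
          (≡.subst (λ k → 2^ k • P ≋ ∞) (≡.sym (ℕ.m+[n∸m]≡n (ℕ.m≤n⇒m≤1+n i≤n))) 2^1+nP≈∞))

      -- The points counted are P, 2 P, 4 P, ..., 2ⁿ P. They are far fewer than the multiples of P,
      -- but their number grows with n, and they arise by doubling alone.
      atLeast-torsionPoints : ∀ {k} → k ℕ.≤ suc n → AtLeast k (torsionPoints E)
      atLeast-torsionPoints {k} k≤1+n = record
        { to = λ i → 2^ toℕ i • P , 2^•-torsion (toℕ≤n i)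
        ; cong = λ where ≡.refl → ≋.refl
        ; injective = λ {i} {j} → injective i j
        }
        where
        toℕ≤n : ∀ (i : Fin k) → toℕ i ℕ.≤ n
        toℕ≤n i = ℕ.s≤s⁻¹ (ℕ.≤-trans (toℕ<n i) k≤1+n)
        injective : ∀ (i j : Fin k) → 2^ toℕ i • P ≋ 2^ toℕ j • P → i ≡ j
        injective i j e with ℕ.<-cmp (toℕ i) (toℕ j)
        ... | tri< i<j _ _ = contradiction e (2^•-distinct i<j (toℕ≤n j))
        ... | tri≈ _ i≡j _ = toℕ-injective i≡j
        ... | tri> _ _ j<i = contradiction (≋.sym e) (2^•-distinct j<i (toℕ≤n i))

  -- Curves y² = x³ + A x² + B x: duplication and quadratic twists.

  module TwoTorsionCurves (F : NumberField) where
    open NumberField F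
    open NumberFieldProperties F

    -- Vanishing Weierstrass coefficients are written as ι 0ℚ, not `0#`, so that they match the
    -- solver constant `con 0ℚ`.
    0̂ : Carrier
    0̂ = ι 0ℚ

    x+x≉0 : ∀ {x} → ¬ x ≈ 0# → ¬ x + x ≈ 0#
    x+x≉0 {x} x≉0 x+x≈0 = x≉0 (trans (solve 1 (λ x → x := con ℚ.½ :* (x :+ x)) refl x)
      (trans (*-congˡ x+x≈0) (zeroʳ _)))

    x*x≈0⇒x≈0 : ∀ {x} → x * x ≈ 0# → x ≈ 0#
    x*x≈0⇒x≈0 {x} xx≈0 with ≈0? x
    ... | yes x≈0 = x≈0
    ... | no  x≉0 = x*y≈0⇒y≈0 x≉0 xx≈0

    cubic : (A B x : Carrier) → Carrier
    cubic A B x = x * x * x + A * (x * x) + B * x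

    :cubic : ∀ {n} (A B x : Polynomial n) → Polynomial n
    :cubic A B x = x :* x :* x :+ A :* (x :* x) :+ B :* x

    -- On y² = x³ + A x² + B x, n successive doublings, each by the abscissa
    -- formula x(2P) = (x² - B)² / 4(x³ + A x² + B x), lead from abscissa x to the
    -- point (0 , 0) of order 2.
    data DoublingChain (A B : Carrier) : ℕ → Carrier → Set where
      stop : ∀ {x} → x ≈ 0# → DoublingChain A B 0 x
      step : ∀ {n x x′} → ¬ cubic A B x ≈ 0# →
             let c = cubic A B x in (c + c + (c + c)) * x′ ≈ (x * x - B) * (x * x - B) →
             DoublingChain A B n x′ → DoublingChain A B (suc n) x

    twist : ∀ {A B n x} D → ¬ D ≈ 0# → DoublingChain A B n x →
            DoublingChain (D * A) (D * D * B) n (D * x)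
    twist D D≉0 (stop x≈0) = stop (trans (*-congˡ x≈0) (zeroʳ D))
    twist {A} {B} D D≉0 (step {x = x} {x′} c≉0 e chain) = step
      (λ z → x≉0∧y≉0⇒x*y≉0 (x≉0∧y≉0⇒x*y≉0 D≉0 (x≉0∧y≉0⇒x*y≉0 D≉0 D≉0)) c≉0
        (trans (solve 4 (λ A B D x → D :* (D :* D) :* :cubic A B x :=
           :cubic (D :* A) (D :* D :* B) (D :* x)) refl A B D x) z))
      (trans (solve 5 (λ A B D x x′ → let c = :cubic (D :* A) (D :* D :* B) (D :* x) ; c′ = :cubic A B x in
           (c :+ c :+ (c :+ c)) :* (D :* x′) := D :* D :* (D :* D) :* ((c′ :+ c′ :+ (c′ :+ c′)) :* x′))
           refl A B D x x′)
        (trans (*-congˡ e) (solve 4 (λ B D x x′ → D :* D :* (D :* D) :* ((x :* x :- B) :* (x :* x :- B)) :=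
           (D :* x :* (D :* x) :- D :* D :* B) :* (D :* x :* (D :* x) :- D :* D :* B)) refl B D x x′)))
      (twist D D≉0 chain)

    module _ (A B : Carrier) (B≉0 : ¬ B ≈ 0#) (disc≉0 : ¬ A * A - (B + B + (B + B)) ≈ 0#) where

      curve : EllipticCurve F
      curve = record
        { weierstrassEquation = w
        -- The discriminant is 16 B² (A² - 4 B); four successive doublings account for the 16.
        ; nonsingular = λ Δ≈0 → x+x≉0 (x+x≉0 (x+x≉0 (x+x≉0 (x≉0∧y≉0⇒x*y≉0 (x≉0∧y≉0⇒x*y≉0 B≉0 B≉0) disc≉0))))
            (trans (solve 2 (λ A B → let
                0′ = con 0ℚ ; d = B :* B :* (A :* A :- (B :+ B :+ (B :+ B)))
                b₂ = 0′ :^ 2 :+ (A :+ A :+ A :+ A)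
                b₄ = (B :+ B) :+ 0′ :* 0′
                b₆ = 0′ :^ 2 :+ (0′ :+ 0′ :+ 0′ :+ 0′)
                A0 = A :* 0′
                b₈ = 0′ :^ 2 :* 0′ :+ (A0 :+ A0 :+ A0 :+ A0) :- 0′ :* 0′ :* B :+ A :* 0′ :^ 2 :- B :^ 2
                2d = d :+ d ; 4d = 2d :+ 2d ; 8d = 4d :+ 4d
                in 8d :+ 8d := :- (b₂ :^ 2 :* b₈) :- times8 (b₄ :^ 3) :- times27 (b₆ :^ 2) :+ times9 (b₂ :* b₄ :* b₆))
                refl A B) Δ≈0)
        }
        where
        w : WeierstrassEquation F
        w = record { a₁ = 0̂ ; a₂ = A ; a₃ = 0̂ ; a₄ = B ; a₆ = 0̂ }
        times8 times9 times27 : ∀ {n} → Polynomial n → Polynomial n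
        times8 x = x :+ x :+ x :+ x :+ x :+ x :+ x :+ x
        times9 x = times8 x :+ x
        times27 x = times9 x :+ x :+ x :+ x :+ x :+ x :+ x :+ x :+ x :+ x :+ x :+ x :+ x :+ x :+ x :+ x :+ x :+ x :+ x

      at⇒y²≈cubic : ∀ {P x y} → At curve P x y → y * y ≈ cubic A B x
      at⇒y²≈cubic {x = x} {y} p = x∙y⁻¹≈ε⇒x≈y _ _ (trans (solve 4 (λ A B x y → y :* y :- :cubic A B x :=
          (y :^ 2 :+ con 0ℚ :* x :* y :+ con 0ℚ :* y) :- (x :^ 3 :+ A :* x :^ 2 :+ B :* x :+ con 0ℚ)) refl A B x y)
        (at⇒W≈0 curve p))

      -- The tangent slope satisfies 2 y m = 3 x² + 2 A x + B, and y² = c. So 4 c (m² - A - 2 x) =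
      -- (3 x² + 2 A x + B)² - 4 c (A + 2 x), which equals (x² - B)².
      double-at : ∀ {P x y x′} → At curve P x y → ¬ cubic A B x ≈ 0# →
        let c = cubic A B x in (c + c + (c + c)) * x′ ≈ (x * x - B) * (x * x - B) →
        ∃[ y′ ] At curve (_⊕_ curve P P) x′ y′
      double-at {P} {x} {y} {x′} p c≉0 e = via (quotient (tangentNumerator curve x y) w w≉0)
        where
        c w h : Carrier
        c = cubic A B x
        w = y + y + 0̂ * x + 0̂
        h = y + y
        y≉0 : ¬ y ≈ 0#
        y≉0 y≈0 = c≉0 (trans (sym (at⇒y²≈cubic p)) (trans (*-congʳ y≈0) (zeroˡ y)))
        w≉0 : ¬ w ≈ 0#
        w≉0 z = x+x≉0 y≉0 (trans (solve 2 (λ x y → y :+ y := y :+ y :+ con 0ℚ :* x :+ con 0ℚ) refl x y) z)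
        via : (∃[ m ] m * w ≈ tangentNumerator curve x y) → ∃[ y′ ] At curve (_⊕_ curve P P) x′ y′
        via (m , mw≈) = _ , at-resp curve (⊕-tangent curve p p w≉0 mw≈) x₃≈x′ refl
          where
          t : Carrier
          t = x * x + x * x + x * x + (A * x + A * x) + B
          mh≈t : m * h ≈ t
          mh≈t = trans (solve 3 (λ m x y → m :* (y :+ y) := m :* (y :+ y :+ con 0ℚ :* x :+ con 0ℚ)) refl m x y)
            (trans mw≈ (solve 4 (λ A B x y → x :^ 2 :+ x :^ 2 :+ x :^ 2 :+ (A :* x :+ A :* x) :+ B :- con 0ℚ :* y :=
               x :* x :+ x :* x :+ x :* x :+ (A :* x :+ A :* x) :+ B) refl A B x y))
          x₃≈x′ : x₃ curve m x x ≈ x′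
          x₃≈x′ = *-cancelˡ-≉0 (x+x≉0 (x+x≉0 c≉0)) (trans
            (trans (solve 5 (λ A m c x y → (c :+ c :+ (c :+ c)) :* (m :^ 2 :+ con 0ℚ :* m :- A :- x :- x) :=
                 m :* (y :+ y) :* (m :* (y :+ y)) :- (c :+ c :+ (c :+ c)) :* (A :+ x :+ x)
                   :- (m :* m :+ m :* m :+ (m :* m :+ m :* m)) :* (y :* y :- c)) refl A m c x y)
              (trans (x-0≈x (trans (*-congˡ (x≈y⇒x∙y⁻¹≈ε (at⇒y²≈cubic p))) (zeroʳ _)))
                (trans (+-congʳ (*-cong mh≈t mh≈t))
                  (solve 3 (λ A B x → let c = :cubic A B x ; t = x :* x :+ x :* x :+ x :* x :+ (A :* x :+ A :* x) :+ B in
                     t :* t :- (c :+ c :+ (c :+ c)) :* (A :+ x :+ x) := (x :* x :- B) :* (x :* x :- B))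
                     refl A B x)))) (sym e))

      chain-at : ∀ {n P x y} → At curve P x y → DoublingChain A B n x →
                 ∃[ y′ ] At curve (2^_•_ curve n P) 0# y′
      chain-at p (stop x≈0) = _ , at-resp curve p x≈0 refl
      chain-at p (step c≉0 e chain) = chain-at (proj₂ (double-at p c≉0 e)) chain

      chain⇒atLeast : ∀ {n P x y} → At curve P x y → DoublingChain A B n x →
                      ∀ {k} → k ℕ.≤ suc n → AtLeast k (torsionPoints curve)
      chain⇒atLeast {n} {P} p chain with chain-at p chain
      ... | y , T-at = atLeast-torsionPoints curve {n} {P}
        (≋.trans (≋.reflexive (≡.trans (≡.cong (λ k → 2^_•_ curve k P) (ℕ.+-comm 1 n)) (2^•-+ curve n 1 P)))
          (≋.reflexive (⊕-vertical curve T-at T-at (trans (solve 2 (λ y z → y :+ y :+ con 0ℚ :* z :+ con 0ℚ := y :+ y)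
            refl y 0#) (trans (+-cong y≈0 y≈0) (+-identityˡ 0#))))))
        (λ e → not-∞ (≈⇒at curve e T-at))
        where
        module ≋ = Setoid (pointSetoid curve)
        y≈0 : y ≈ 0#
        y≈0 = x*x≈0⇒x≈0 (trans (at⇒y²≈cubic T-at) (trans (solve 3 (λ A B z → :cubic A B z :=
                (z :* z :+ A :* z :+ B) :* z) refl A B 0#) (zeroʳ _)))
        not-∞ : ∀ {x y} → ¬ At curve ∞ x y
        not-∞ ()

    -- The abscissa x need not belong to a rational point. The twist by D = `cubic A B x`, non-zero
    -- because the chain has a first step, carries the point (D x , D²), since its cubic takes the
    -- value D³ D = (D²)² at D x.
    chain⇒torsion : ∀ {A B n x} → ¬ B ≈ 0# → ¬ A * A - (B + B + (B + B)) ≈ 0# →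
      DoublingChain A B (suc n) x → ∀ {k} → k ℕ.≤ suc (suc n) →
      Σ[ E ∈ EllipticCurve F ] AtLeast k (torsionPoints E)
    chain⇒torsion {A} {B} {n} {x} B≉0 disc≉0 chain@(step c≉0 _ _) k≤ =
      E , chain⇒atLeast (D * A) (D * D * B) B′≉0 disc′≉0 {P = affine (D * x) (D * D) on} (at refl refl)
            (twist D c≉0 chain) k≤
      where
      D : Carrier
      D = cubic A B x
      DD≉0 : ¬ D * D ≈ 0#
      DD≉0 = x≉0∧y≉0⇒x*y≉0 c≉0 c≉0
      B′≉0 : ¬ D * D * B ≈ 0#
      B′≉0 = x≉0∧y≉0⇒x*y≉0 DD≉0 B≉0
      disc′≉0 : ¬ D * A * (D * A) - (D * D * B + D * D * B + (D * D * B + D * D * B)) ≈ 0#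
      disc′≉0 z = x≉0∧y≉0⇒x*y≉0 DD≉0 disc≉0 (trans (solve 3 (λ A B D →
        D :* D :* (A :* A :- (B :+ B :+ (B :+ B))) :=
        D :* A :* (D :* A) :- (D :* D :* B :+ D :* D :* B :+ (D :* D :* B :+ D :* D :* B))) refl A B D) z)
      E : EllipticCurve F
      E = curve (D * A) (D * D * B) B′≉0 disc′≉0
      on : OnCurve E (D * x) (D * D)
      on = trans (solve 2 (λ D x → (D :* D) :^ 2 :+ con 0ℚ :* (D :* x) :* (D :* D) :+ con 0ℚ :* (D :* D) :=
                   D :* D :* D :* D) refl D x)
             (solve 3 (λ A B x → let D = :cubic A B x in D :* D :* D :* D :=
                 (D :* x) :^ 3 :+ D :* A :* (D :* x) :^ 2 :+ D :* D :* B :* (D :* x) :+ con 0ℚ) refl A B x)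

-- Polynomials over ℚ as operators on functions; division by monic polynomials.

module PolynomialRings where

  open AlgebraSolver
  open import Algebra.Bundles using (CommutativeRing)
  open import Algebra.Morphism.Structures using (module RingMorphisms)
  open import Data.Fin.Base as Fin using (Fin; toℕ; fromℕ; inject₁) renaming (zero to fzero; suc to fsuc)
  import Data.Fin.Properties as Fin
  open import Data.Fin.Relation.Unary.Top using (View; view; ‵fromℕ; ‵inject₁)
  open import Data.List.Base using (List; []; _∷_; map; length)
  open import Data.Nat.Base as ℕ using (ℕ; zero; suc)
  import Data.Nat.Properties as ℕ
  open import Data.Product.Base using (Σ-syntax; ∃-syntax; _×_; _,_)
  open import Data.Rational.Base as ℚ using (ℚ; 0ℚ; 1ℚ)
  import Data.Rational.Properties as ℚ
  open import Data.Rational.Solver using (module +-*-Solver)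
  open import Data.Sum.Base using (_⊎_; inj₁; inj₂)
  open import Function.Base using (_∘_)
  open import Relation.Nullary using (¬_; yes; no; contradiction)
  open import Relation.Binary.PropositionalEquality using (_≡_; _≗_; refl; cong; cong₂; sym; trans)
  open import Level using (0ℓ)

  private module ℚR = CommutativeRing ℚ.+-*-commutativeRing

  Poly : Set
  Poly = List ℚ

  infixl 6 _⊞_
  infixl 7 _⊠_

  _⊞_ : Poly → Poly → Poly
  []      ⊞ q       = q
  (a ∷ p) ⊞ []      = a ∷ p
  (a ∷ p) ⊞ (b ∷ q) = a ℚ.+ b ∷ p ⊞ q

  scale : ℚ → Poly → Poly
  scale c = map (c ℚ.*_)

  _⊠_ : Poly → Poly → Poly
  []      ⊠ q = []
  (a ∷ p) ⊠ q = scale a q ⊞ (0ℚ ∷ p ⊠ q)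

  ⊟_ : Poly → Poly
  ⊟_ = map (λ a → ℚ.- a)

  constant : ℚ → Poly
  constant q = q ∷ []

  coefficient : Poly → ℕ → ℚ
  coefficient []      _       = 0ℚ
  coefficient (a ∷ p) zero    = a
  coefficient (a ∷ p) (suc e) = coefficient p e

  -- Polynomials acting on functions I → ℚ through a linear operator C in place
  -- of the variable; identifying polynomials with the same action gives the ring
  -- ℚ[C].  For the shift of sequences it is the polynomial ring, for a companion
  -- matrix it is ℚ[s]/(f).
  record Operator (I : Set) : Set where
    field
      C     : (I → ℚ) → (I → ℚ)
      C-cong : ∀ {v w} → v ≗ w → C v ≗ C w
      C-+    : ∀ v w → C (λ i → v i ℚ.+ w i) ≗ λ i → C v i ℚ.+ C w i
      C-·    : ∀ c v → C (λ i → c ℚ.* v i) ≗ λ i → c ℚ.* C v i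

  module Action {I : Set} (operator : Operator I) where
    open Operator operator

    C-0 : C (λ _ → 0ℚ) ≗ λ _ → 0ℚ
    C-0 i = trans (C-cong (λ _ → sym (ℚ.*-zeroˡ 0ℚ)) i) (trans (C-· 0ℚ (λ _ → 0ℚ) i) (ℚ.*-zeroˡ (C (λ _ → 0ℚ) i)))

    act : Poly → (I → ℚ) → (I → ℚ)
    act []      v = λ _ → 0ℚ
    act (a ∷ p) v = λ i → a ℚ.* v i ℚ.+ C (act p v) i

    open +-*-Solver

    act-cong : ∀ p {v w} → v ≗ w → act p v ≗ act p w
    act-cong []      v≗w i = refl
    act-cong (a ∷ p) v≗w i = cong₂ ℚ._+_ (cong (a ℚ.*_) (v≗w i)) (C-cong (act-cong p v≗w) i)

    act-+ : ∀ p v w → act p (λ i → v i ℚ.+ w i) ≗ λ i → act p v i ℚ.+ act p w i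
    act-+ []      v w i = refl
    act-+ (a ∷ p) v w i = trans (cong (a ℚ.* (v i ℚ.+ w i) ℚ.+_) (trans (C-cong (act-+ p v w) i) (C-+ _ _ i)))
      (solve 5 (λ a x y z t → a :* (x :+ y) :+ (z :+ t) := a :* x :+ z :+ (a :* y :+ t)) refl
        a (v i) (w i) (C (act p v) i) (C (act p w) i))

    act-· : ∀ p c v → act p (λ i → c ℚ.* v i) ≗ λ i → c ℚ.* act p v i
    act-· []      c v i = sym (ℚ.*-zeroʳ c)
    act-· (a ∷ p) c v i = trans (cong (a ℚ.* (c ℚ.* v i) ℚ.+_) (trans (C-cong (act-· p c v) i) (C-· c _ i)))
      (solve 4 (λ a c x y → a :* (c :* x) :+ c :* y := c :* (a :* x :+ y)) refl a c (v i) (C (act p v) i))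

    act-C : ∀ p v → act p (C v) ≗ C (act p v)
    act-C []      v i = sym (C-0 i)
    act-C (a ∷ p) v i = trans (cong₂ ℚ._+_ (sym (C-· a v i)) (C-cong (act-C p v) i)) (sym (C-+ _ _ i))

    act-⊞ : ∀ p q v → act (p ⊞ q) v ≗ λ i → act p v i ℚ.+ act q v i
    act-⊞ []      q       v i = sym (ℚ.+-identityˡ _)
    act-⊞ (a ∷ p) []      v i = sym (ℚ.+-identityʳ _)
    act-⊞ (a ∷ p) (b ∷ q) v i = trans (cong ((a ℚ.+ b) ℚ.* v i ℚ.+_) (trans (C-cong (act-⊞ p q v) i) (C-+ _ _ i)))
      (solve 5 (λ a b x z t → (a :+ b) :* x :+ (z :+ t) := a :* x :+ z :+ (b :* x :+ t)) refl
        a b (v i) (C (act p v) i) (C (act q v) i))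

    act-scale : ∀ c p v → act (scale c p) v ≗ λ i → c ℚ.* act p v i
    act-scale c []      v i = sym (ℚ.*-zeroʳ c)
    act-scale c (a ∷ p) v i = trans (cong (c ℚ.* a ℚ.* v i ℚ.+_) (trans (C-cong (act-scale c p v) i) (C-· c _ i)))
      (solve 4 (λ a c x y → c :* a :* x :+ c :* y := c :* (a :* x :+ y)) refl a c (v i) (C (act p v) i))

    act-⊟ : ∀ p v → act (⊟ p) v ≗ λ i → ℚ.- act p v i
    act-⊟ []      v i = refl
    act-⊟ (a ∷ p) v i = trans (cong ((ℚ.- a) ℚ.* v i ℚ.+_) (trans (C-cong (λ j → trans (act-⊟ p v j)
        (solve 1 (λ x → :- x := con (ℚ.- 1ℚ) :* x) refl (act p v j))) i) (C-· (ℚ.- 1ℚ) _ i)))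
      (solve 3 (λ a x y → (:- a) :* x :+ con (ℚ.- 1ℚ) :* y := :- (a :* x :+ y)) refl a (v i) (C (act p v) i))

    act-⊠ : ∀ p q v → act (p ⊠ q) v ≗ act p (act q v)
    act-⊠ []      q v i = refl
    act-⊠ (a ∷ p) q v i = trans (act-⊞ (scale a q) (0ℚ ∷ p ⊠ q) v i) (cong₂ ℚ._+_ (act-scale a q v i)
      (trans (cong₂ ℚ._+_ (ℚ.*-zeroˡ (v i)) (C-cong (act-⊠ p q v) i)) (ℚ.+-identityˡ _)))

    act-comm : ∀ p q v → act p (act q v) ≗ act q (act p v)
    act-comm []      q v i = sym (trans (act-cong q (λ _ → sym (ℚ.*-zeroˡ 0ℚ)) i)
      (trans (act-· q 0ℚ (λ _ → 0ℚ) i) (ℚ.*-zeroˡ (act q (λ _ → 0ℚ) i))))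
    act-comm (a ∷ p) q v i = sym (trans (act-+ q (λ j → a ℚ.* v j) (C (act p v)) i)
      (cong₂ ℚ._+_ (act-· q a v i) (trans (act-C q (act p v) i) (C-cong (λ j → sym (act-comm p q v j)) i))))

    infix 4 _≈_
    record _≈_ (p q : Poly) : Set where
      constructor ≈-intro
      field act-≡ : ∀ v → act p v ≗ act q v
    open _≈_ public

    commutativeRing : CommutativeRing 0ℓ 0ℓ
    commutativeRing = record
      { Carrier = Poly ; _≈_ = _≈_ ; _+_ = _⊞_ ; _*_ = _⊠_ ; -_ = ⊟_ ; 0# = [] ; 1# = 1ℚ ∷ []
      ; isCommutativeRing = record
        { isRing = record
          { +-isAbelianGroup = record
            { isGroup = record
              { isMonoid = record
                { isSemigroup = record
                  { isMagma = record
                    { isEquivalence = record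
                      { refl = ≈-intro λ v i → refl
                      ; sym = λ e → ≈-intro λ v i → sym (act-≡ e v i)
                      ; trans = λ e e′ → ≈-intro λ v i → trans (act-≡ e v i) (act-≡ e′ v i) }
                    ; ∙-cong = λ {p} {p′} {q} {q′} e e′ → ≈-intro λ v i → trans (act-⊞ p q v i)
                        (trans (cong₂ ℚ._+_ (act-≡ e v i) (act-≡ e′ v i)) (sym (act-⊞ p′ q′ v i))) }
                  ; assoc = λ p q r → ≈-intro λ v i → trans (act-⊞ (p ⊞ q) r v i)
                      (trans (cong (ℚ._+ act r v i) (act-⊞ p q v i))
                      (trans (ℚ.+-assoc (act p v i) (act q v i) (act r v i))
                      (sym (trans (act-⊞ p (q ⊞ r) v i) (cong (act p v i ℚ.+_) (act-⊞ q r v i)))))) }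
                ; identity = (λ p → ≈-intro λ v i → refl)
                           , λ p → ≈-intro λ v i → trans (act-⊞ p [] v i) (ℚ.+-identityʳ _) }
              ; inverse = (λ p → ≈-intro λ v i → trans (act-⊞ (⊟ p) p v i)
                            (trans (cong (ℚ._+ act p v i) (act-⊟ p v i)) (ℚ.+-inverseˡ (act p v i))))
                        , λ p → ≈-intro λ v i → trans (act-⊞ p (⊟ p) v i)
                            (trans (cong (act p v i ℚ.+_) (act-⊟ p v i)) (ℚ.+-inverseʳ (act p v i)))
              ; ⁻¹-cong = λ {p} {q} e → ≈-intro λ v i → trans (act-⊟ p v i)
                            (trans (cong (λ x → ℚ.- x) (act-≡ e v i)) (sym (act-⊟ q v i))) }
            ; comm = λ p q → ≈-intro λ v i → trans (act-⊞ p q v i)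
                       (trans (ℚ.+-comm (act p v i) (act q v i)) (sym (act-⊞ q p v i))) }
          ; *-cong = λ {p} {p′} {q} {q′} e e′ → ≈-intro λ v i → trans (act-⊠ p q v i)
              (trans (act-≡ e (act q v) i) (trans (act-cong p′ (act-≡ e′ v) i) (sym (act-⊠ p′ q′ v i))))
          ; *-assoc = λ p q r → ≈-intro λ v i → trans (act-⊠ (p ⊠ q) r v i)
              (trans (act-⊠ p q (act r v) i)
              (sym (trans (act-⊠ p (q ⊠ r) v i) (act-cong p (act-⊠ q r v) i))))
          ; *-identity = (λ p → ≈-intro λ v i → trans (act-⊠ (1ℚ ∷ []) p v i) (act-1 (act p v) i))
                       , λ p → ≈-intro λ v i → trans (act-⊠ p (1ℚ ∷ []) v i) (act-cong p (act-1 v) i)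
          ; distrib = (λ p q r → ≈-intro λ v i → trans (act-⊠ p (q ⊞ r) v i)
                        (trans (act-cong p (act-⊞ q r v) i)
                        (trans (act-+ p (act q v) (act r v) i)
                        (sym (trans (act-⊞ (p ⊠ q) (p ⊠ r) v i) (cong₂ ℚ._+_ (act-⊠ p q v i) (act-⊠ p r v i)))))))
                    , λ p q r → ≈-intro λ v i → trans (act-⊠ (q ⊞ r) p v i)
                        (trans (act-⊞ q r (act p v) i)
                        (sym (trans (act-⊞ (q ⊠ p) (r ⊠ p) v i) (cong₂ ℚ._+_ (act-⊠ q p v i) (act-⊠ r p v i))))) }
        ; *-comm = λ p q → ≈-intro λ v i → trans (act-⊠ p q v i)
                     (trans (act-comm p q v i) (sym (act-⊠ q p v i))) } }
      where
      act-1 : ∀ v → act (1ℚ ∷ []) v ≗ v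
      act-1 v i = trans (cong₂ ℚ._+_ (ℚ.*-identityˡ (v i)) (C-0 i)) (ℚ.+-identityʳ (v i))

    constant-hom : RingMorphisms.IsRingHomomorphism ℚR.rawRing (CommutativeRing.rawRing commutativeRing) constant
    constant-hom = record
      { isSemiringHomomorphism = record
        { isNearSemiringHomomorphism = record
          { +-isMonoidHomomorphism = record
            { isMagmaHomomorphism = record
              { isRelHomomorphism = record { cong = λ { refl → R.refl } }
              ; homo = λ p q → R.refl }
            ; ε-homo = ≈-intro λ v i → trans (cong₂ ℚ._+_ (ℚ.*-zeroˡ (v i)) (C-0 i)) (ℚ.+-identityˡ 0ℚ) }
          ; *-homo = λ p q → ≈-intro λ v i → cong (λ x → x ℚ.* v i ℚ.+ C (λ _ → 0ℚ) i) (sym (ℚ.+-identityʳ (p ℚ.* q))) }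
        ; 1#-homo = R.refl }
      ; -‿homo = λ p → R.refl }
      where module R = CommutativeRing commutativeRing

    coefficients⇒≈0 : ∀ p → (∀ e → coefficient p e ≡ 0ℚ) → ∀ v → act p v ≗ λ _ → 0ℚ
    coefficients⇒≈0 []      h v i = refl
    coefficients⇒≈0 (a ∷ p) h v i = trans (cong₂ ℚ._+_ (trans (cong (ℚ._* v i) (h 0)) (ℚ.*-zeroˡ (v i)))
      (trans (C-cong (coefficients⇒≈0 p (h ∘ suc) v) i) (C-0 i))) (ℚ.+-identityˡ 0ℚ)

    coefficients⇒≈ : ∀ p q → coefficient p ≗ coefficient q → ∀ v → act p v ≗ act q v
    coefficients⇒≈ []      q       h v i = sym (coefficients⇒≈0 q (λ e → sym (h e)) v i)
    coefficients⇒≈ (a ∷ p) []      h v i = coefficients⇒≈0 (a ∷ p) h v i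
    coefficients⇒≈ (a ∷ p) (b ∷ q) h v i = cong₂ ℚ._+_ (cong (ℚ._* v i) (h 0))
      (C-cong (coefficients⇒≈ p q (h ∘ suc) v) i)

  shift : (ℕ → ℚ) → (ℕ → ℚ)
  shift v zero    = 0ℚ
  shift v (suc n) = v n

  shiftOperator : Operator ℕ
  shiftOperator = record
    { C = shift
    ; C-cong = λ { e zero → refl ; e (suc n) → e n }
    ; C-+ = λ { v w zero → refl ; v w (suc n) → refl }
    ; C-· = λ { c v zero → sym (ℚ.*-zeroʳ c) ; c v (suc n) → refl } }

  coefficient-beyond : ∀ p {e} → length p ℕ.≤ e → coefficient p e ≡ 0ℚ
  coefficient-beyond []      _         = refl
  coefficient-beyond (a ∷ p) (ℕ.s≤s h) = coefficient-beyond p h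

  monomial : ℕ → Poly
  monomial zero    = 1ℚ ∷ []
  monomial (suc n) = 0ℚ ∷ monomial n

  length-monomial : ∀ n → length (monomial n) ≡ suc n
  length-monomial zero    = refl
  length-monomial (suc n) = cong suc (length-monomial n)

  coefficient-monomial : ∀ n → coefficient (monomial n) n ≡ 1ℚ
  coefficient-monomial zero    = refl
  coefficient-monomial (suc n) = coefficient-monomial n

  coefficient-monomial-< : ∀ {n e} → e ℕ.< n → coefficient (monomial n) e ≡ 0ℚ
  coefficient-monomial-< {suc n} {zero}  _         = refl
  coefficient-monomial-< {suc n} {suc e} (ℕ.s≤s h) = coefficient-monomial-< h

  polynomial : ∀ {n} → (Fin n → ℚ) → Poly
  polynomial {zero}  q = []
  polynomial {suc n} q = q fzero ∷ polynomial (q ∘ fsuc)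

  length-polynomial : ∀ {n} (q : Fin n → ℚ) → length (polynomial q) ≡ n
  length-polynomial {zero}  q = refl
  length-polynomial {suc n} q = cong suc (length-polynomial (q ∘ fsuc))

  coefficient-polynomial : ∀ {n} (q : Fin n → ℚ) i → coefficient (polynomial q) (toℕ i) ≡ q i
  coefficient-polynomial q fzero    = refl
  coefficient-polynomial q (fsuc i) = coefficient-polynomial (q ∘ fsuc) i

  X : Poly
  X = monomial 1

  module ActionProperties {I : Set} (operator : Operator I) where
    open Action operator public
    open Operator operator
    open CommutativeRing commutativeRing using (+-rawMonoid; semiring; +-monoid; +-cong; *-congˡ; +-congˡ; +-congʳ)
      renaming (refl to ≈-refl; sym to ≈-sym; trans to ≈-trans)
    open import Algebra.Definitions.RawMonoid +-rawMonoid using (sum)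
    open import Algebra.Properties.Monoid.Sum +-monoid using (sum-cong-≋)
    open import Algebra.Properties.Semiring.Sum semiring using (*-distribˡ-sum)
    open ℚAlgebraSolver commutativeRing constant constant-hom public
    open RingMorphisms.IsRingHomomorphism constant-hom public using () renaming (0#-homo to constant-0; *-homo to constant-*)

    constant-cong : ∀ {a b} → a ≡ b → constant a ≈ constant b
    constant-cong refl = ≈-refl

    0∷-≈ : ∀ p → 0ℚ ∷ p ≈ X ⊠ p
    0∷-≈ p = ≈-intro λ v i → trans (cong (0ℚ ℚ.* v i ℚ.+_) (C-cong (λ j → sym (1-act (act p v) j)) i))
        (trans (cong₂ ℚ._+_ (trans (ℚ.*-zeroˡ (v i)) (sym (ℚ.*-zeroˡ (act p v i)))) refl) (sym (act-⊠ X p v i)))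
      where
      1-act : ∀ v → act (1ℚ ∷ []) v ≗ v
      1-act v i = trans (cong₂ ℚ._+_ (ℚ.*-identityˡ (v i)) (C-0 i)) (ℚ.+-identityʳ (v i))

    ∷-≈ : ∀ a p → a ∷ p ≈ constant a ⊞ X ⊠ p
    ∷-≈ a p = ≈-trans (≈-intro λ v i → trans (cong (λ x → x ℚ.* v i ℚ.+ C (act p v) i) (sym (ℚ.+-identityʳ a)))
      (act-≡ (≈-refl {constant a ⊞ (0ℚ ∷ p)}) v i)) (+-congˡ {constant a} (0∷-≈ p))

    scale-≈ : ∀ c p → scale c p ≈ constant c ⊠ p
    scale-≈ c p = ≈-sym (≈-trans (+-congˡ {scale c p} constant-0) (≈-intro λ v i →
      trans (act-⊞ (scale c p) [] v i) (ℚ.+-identityʳ _)))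

    sum-monomials : ∀ {n} (q : Fin n → ℚ) → sum (λ i → constant (q i) ⊠ monomial (toℕ i)) ≈ polynomial q
    sum-monomials {zero}  q = ≈-refl
    sum-monomials {suc n} q = ≈-trans (+-cong
        (solve 1 (λ c → c :* con 1ℚ := c) ≈-refl (constant (q fzero)))
        (≈-trans (sum-cong-≋ {n} λ i → ≈-trans (*-congˡ {constant (q (fsuc i))} (0∷-≈ (monomial (toℕ i))))
            (solve 3 (λ c x m → c :* (x :* m) := x :* (c :* m)) ≈-refl (constant (q (fsuc i))) X (monomial (toℕ i))))
          (≈-trans (≈-sym (*-distribˡ-sum X (λ i → constant (q (fsuc i)) ⊠ monomial (toℕ i))))
            (*-congˡ {X} (sum-monomials (q ∘ fsuc))))))
      (≈-sym (∷-≈ (q fzero) (polynomial (q ∘ fsuc))))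

    polynomial-cong : ∀ {n} {q r : Fin n → ℚ} → q ≗ r → polynomial q ≈ polynomial r
    polynomial-cong {zero}  h = ≈-refl
    polynomial-cong {suc n} {q} {r} h = ≈-intro λ v i → cong₂ ℚ._+_ (cong (ℚ._* v i) (h fzero))
      (C-cong (act-≡ (polynomial-cong (h ∘ fsuc)) v) i)

    polynomial-zero : ∀ n → polynomial {n} (λ _ → 0ℚ) ≈ []
    polynomial-zero zero    = ≈-refl
    polynomial-zero (suc n) = ≈-trans (0∷-≈ (polynomial {n} (λ _ → 0ℚ))) (≈-trans (*-congˡ {X} (polynomial-zero n))
      (CommutativeRing.zeroʳ commutativeRing X))

    polynomial-linear : ∀ {n} (q r : Fin n → ℚ) c →
      polynomial (λ i → q i ℚ.+ c ℚ.* r i) ≈ polynomial q ⊞ constant c ⊠ polynomial r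
    polynomial-linear q r c = ≈-trans (equal q r) (+-congˡ {polynomial q} (scale-≈ c (polynomial r)))
      where
      equal : ∀ {n} (q r : Fin n → ℚ) →
        polynomial (λ i → q i ℚ.+ c ℚ.* r i) ≈ polynomial q ⊞ scale c (polynomial r)
      equal {zero}  q r = ≈-refl
      equal {suc n} q r = ≈-intro λ v i → cong (λ x → (q fzero ℚ.+ c ℚ.* r fzero) ℚ.* v i ℚ.+ x)
        (C-cong (act-≡ (equal (q ∘ fsuc) (r ∘ fsuc)) v) i)

    polynomial-snoc : ∀ {n} (q : Fin (suc n) → ℚ) →
      polynomial q ≈ polynomial (q ∘ inject₁) ⊞ constant (q (fromℕ n)) ⊠ monomial n
    polynomial-snoc {zero}  q = solve 1 (λ c → c := c :* con 1ℚ) ≈-refl (constant (q fzero))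
    polynomial-snoc {suc n} q = ≈-trans (∷-≈ (q fzero) (polynomial (q ∘ fsuc)))
      (≈-trans (+-congˡ {constant (q fzero)} (*-congˡ {X} (polynomial-snoc (q ∘ fsuc))))
      (≈-trans (solve 5 (λ a x p c m → a :+ x :* (p :+ c :* m) := (a :+ x :* p) :+ c :* (x :* m)) ≈-refl
         (constant (q fzero)) X (polynomial (q ∘ fsuc ∘ inject₁)) (constant (q (fromℕ (suc n)))) (monomial n))
      (+-cong (≈-sym (∷-≈ (q fzero) (polynomial (q ∘ fsuc ∘ inject₁))))
              (*-congˡ {constant (q (fromℕ (suc n)))} (≈-sym (0∷-≈ (monomial n)))))))

    monic : ∀ {n} → (Fin n → ℚ) → Poly
    monic {n} q = polynomial q ⊞ monomial n

    leading-term : ∀ {n} (q : Fin n → ℚ) → (∀ i → q i ≡ 0ℚ) ⊎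
      (∃[ m ] m ℕ.< n × Σ[ r ∈ (Fin m → ℚ) ] Σ[ c ∈ ℚ ] ¬ c ≡ 0ℚ × polynomial q ≈ constant c ⊠ monic r)
    leading-term {zero}  q = inj₁ λ ()
    leading-term {suc n} q with q (fromℕ n) ℚ.≟ 0ℚ
    ... | no c≢0 = inj₂ (n , ℕ.≤-refl , (λ i → c⁻¹ ℚ.* q (inject₁ i)) , c , c≢0 , ≈-trans (polynomial-snoc q)
        (≈-trans (+-congʳ {constant c ⊠ monomial n} (≈-trans (polynomial-cong (λ i → trans
            (trans (sym (ℚ.*-identityˡ (q (inject₁ i)))) (trans (cong (ℚ._* q (inject₁ i)) (sym (ℚ.*-inverseʳ c)))
              (ℚ.*-assoc c c⁻¹ (q (inject₁ i)))))
            (sym (ℚ.+-identityˡ _)))) (≈-trans (polynomial-linear (λ _ → 0ℚ) (λ i → c⁻¹ ℚ.* q (inject₁ i)) c)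
              (+-congʳ {constant c ⊠ polynomial (λ i → c⁻¹ ℚ.* q (inject₁ i))} (polynomial-zero n)))))
          (solve 3 (λ c p m → c :* p :+ c :* m := c :* (p :+ m)) ≈-refl (constant c)
            (polynomial (λ i → c⁻¹ ℚ.* q (inject₁ i))) (monomial n))))
      where
      c : ℚ
      c = q (fromℕ n)
      instance
        c≠0 : ℚ.NonZero c
        c≠0 = ℚ.≢-nonZero c≢0
      c⁻¹ : ℚ
      c⁻¹ = ℚ.1/ c
    ... | yes c≡0 with leading-term (q ∘ inject₁)
    ...   | inj₁ q≡0 = inj₁ (λ i → all-zero i (view i))
      where
      all-zero : ∀ i → View i → q i ≡ 0ℚ
      all-zero _ ‵fromℕ       = c≡0
      all-zero _ (‵inject₁ i) = q≡0 i
    ...   | inj₂ (m , m<n , r , c , c≢0 , e) = inj₂ (m , ℕ.m<n⇒m<1+n m<n , r , c , c≢0 , ≈-trans (polynomial-snoc q)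
      (≈-trans (+-cong e (CommutativeRing.*-congʳ commutativeRing {monomial n} {constant (q (fromℕ n))} {[]}
          (≈-trans (constant-cong c≡0) constant-0)))
        (≈-intro λ v i → trans (act-⊞ (constant c ⊠ monic r) [] v i) (ℚ.+-identityʳ _))))

    -- Horner's scheme. If b ∷ g = P t + r, then a + s (b ∷ g) = P (s t) + (a + s r), where a + s r
    -- has degree at most that of P and is reduced by subtracting c P, with c its top coefficient.
    -- The length of the quotient is recorded because the irreducibility hypothesis bounds the
    -- lengths of both factors.
    division : ∀ {n} (p : Fin (suc n) → ℚ) (a : ℚ) (g : Poly) →
      Σ[ t ∈ Poly ] length t ≡ length g × Σ[ r ∈ (Fin (suc n) → ℚ) ] a ∷ g ≈ monic p ⊠ t ⊞ polynomial r
    division {n} p a [] = [] , refl , (λ { fzero → a ; (fsuc _) → 0ℚ }) , ≈-trans (≈-trans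
        (≈-intro λ v i → cong (a ℚ.* v i ℚ.+_) (C-cong (λ j → sym (act-≡ (polynomial-zero n) v j)) i)) ≈-refl)
        (+-congʳ {polynomial {suc _} (λ { fzero → a ; (fsuc _) → 0ℚ })} (≈-sym (CommutativeRing.zeroʳ commutativeRing (monic p))))
    division {n} p a (b ∷ g) with division p b g
    ... | t , len , r , e = c ∷ t , cong suc len , (λ i → w (inject₁ i) ℚ.+ (ℚ.- c) ℚ.* p i) ,
        ≈-trans (∷-≈ a (b ∷ g)) (≈-trans (+-congˡ {constant a} (*-congˡ {X} e))
        (≈-trans (solve 5 (λ a x P t r → a :+ x :* (P :* t :+ r) := P :* (x :* t) :+ (a :+ x :* r)) ≈-refl
           (constant a) X (monic p) t (polynomial r))
        (≈-trans (+-congˡ {monic p ⊠ (X ⊠ t)} (≈-trans (≈-sym (∷-≈ a (polynomial r))) (polynomial-snoc w)))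
        (≈-trans (solve 6 (λ P′ m x t q c → (P′ :+ m) :* (x :* t) :+ (q :+ c :* m) :=
             (P′ :+ m) :* (c :+ x :* t) :+ (q :+ (:- c) :* P′)) ≈-refl
           (polynomial p) (monomial (suc n)) X t (polynomial (w ∘ inject₁)) (constant c))
        (+-cong (*-congˡ {monic p} (≈-sym (∷-≈ c t))) (≈-sym (polynomial-linear (w ∘ inject₁) p (ℚ.- c))))))))
      where
      w : Fin (suc (suc n)) → ℚ
      w fzero    = a
      w (fsuc i) = r i
      c : ℚ
      c = w (fromℕ (suc n))

  module ℚ[s] where
    open ActionProperties shiftOperator public
    open CommutativeRing commutativeRing public
      using (+-cong; *-cong; +-congˡ; *-congˡ; +-congʳ; *-congʳ; -‿cong; zeroʳ)
      renaming (refl to ≈-refl; sym to ≈-sym; trans to ≈-trans)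

    -- The coefficient sequence of the polynomial 1. Acting on it reads off all coefficients, so
    -- here `_≈_` is equality of coefficients.
    δ₀ : ℕ → ℚ
    δ₀ zero    = 1ℚ
    δ₀ (suc _) = 0ℚ

    act-δ₀ : ∀ p → act p δ₀ ≗ coefficient p
    act-δ₀ []      e       = refl
    act-δ₀ (a ∷ p) zero    = trans (ℚ.+-identityʳ _) (ℚ.*-identityʳ a)
    act-δ₀ (a ∷ p) (suc e) = trans (cong₂ ℚ._+_ (ℚ.*-zeroʳ a) (act-δ₀ p e)) (ℚ.+-identityˡ _)

    ≈⇒coefficients : ∀ {p q} → p ≈ q → coefficient p ≗ coefficient q
    ≈⇒coefficients {p} {q} e k = trans (sym (act-δ₀ p k)) (trans (act-≡ e δ₀ k) (act-δ₀ q k))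

    coefficients⇒ : ∀ {p q} → coefficient p ≗ coefficient q → p ≈ q
    coefficients⇒ {p} {q} h = ≈-intro (coefficients⇒≈ p q h)

  monomial-⊠ : ∀ a b → monomial a ⊠ monomial b ℚ[s].≈ monomial (a ℕ.+ b)
  monomial-⊠ zero    b = solve 1 (λ m → con 1ℚ :* m := m) ≈-refl (monomial b)
    where open ℚ[s]
  monomial-⊠ (suc a) b = ≈-trans (*-congʳ {monomial b} (0∷-≈ (monomial a))) (≈-trans
    (solve 3 (λ x m n → (x :* m) :* n := x :* (m :* n)) ≈-refl X (monomial a) (monomial b))
    (≈-trans (*-congˡ {X} (monomial-⊠ a b)) (≈-sym (0∷-≈ (monomial (a ℕ.+ b))))))
    where open ℚ[s]

  -- The field ℚ[s]/(f) for irreducible f, through the companion matrix.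

  module Companion {n : ℕ} (f : Fin (suc n) → ℚ) where
    private
      d : ℕ
      d = suc n
      V : Set
      V = Fin d → ℚ
      last : Fin d
      last = fromℕ n

      down : V → V
      down v fzero    = 0ℚ
      down v (fsuc i) = v (inject₁ i)

      open +-*-Solver using () renaming (solve to solveℚ; _:+_ to _✚_; _:*_ to _⊛_; _:-_ to _⊖_; _:=_ to _⊜_; con to conℚ)

    -- Multiplication by s on coordinates in 1, s, ..., s^(d-1), with s^d replaced by the negative
    -- of the lower part of f.
    companion : Operator (Fin d)
    companion = record
      { C = λ v i → down v i ℚ.- v last ℚ.* f i
      ; C-cong = λ h i → cong₂ ℚ._-_ (down-cong h i) (cong (ℚ._* f i) (h last))
      ; C-+ = λ v w i → trans (cong (ℚ._- (v last ℚ.+ w last) ℚ.* f i) (down-+ v w i))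
          (solveℚ 5 (λ a b x y f → a ✚ b ⊖ (x ✚ y) ⊛ f ⊜ a ⊖ x ⊛ f ✚ (b ⊖ y ⊛ f)) refl
            (down v i) (down w i) (v last) (w last) (f i))
      ; C-· = λ c v i → trans (cong (ℚ._- c ℚ.* v last ℚ.* f i) (down-· c v i))
          (solveℚ 4 (λ c a x f → c ⊛ a ⊖ c ⊛ x ⊛ f ⊜ c ⊛ (a ⊖ x ⊛ f)) refl c (down v i) (v last) (f i))
      }
      where
      down-cong : ∀ {v w} → v ≗ w → down v ≗ down w
      down-cong h fzero    = refl
      down-cong h (fsuc i) = h (inject₁ i)
      down-+ : ∀ v w → down (λ i → v i ℚ.+ w i) ≗ λ i → down v i ℚ.+ down w i
      down-+ v w fzero    = refl
      down-+ v w (fsuc i) = refl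
      down-· : ∀ c v → down (λ i → c ℚ.* v i) ≗ λ i → c ℚ.* down v i
      down-· c v fzero    = sym (ℚ.*-zeroʳ c)
      down-· c v (fsuc i) = refl

    open ActionProperties companion public
    open CommutativeRing commutativeRing using (+-cong; *-cong; +-congˡ; *-congˡ; +-congʳ; *-congʳ; -‿cong; +-rawMonoid)
      renaming (refl to ≈-refl; sym to ≈-sym; trans to ≈-trans)
    open import Algebra.Definitions.RawMonoid +-rawMonoid using (sum)

    e₀ : V
    e₀ fzero    = 1ℚ
    e₀ (fsuc _) = 0ℚ

    -- Below degree d nothing overflows: whenever s is applied in the recursion the last coordinate
    -- is still 0, so f does not enter.
    act-e₀ : ∀ p → length p ℕ.≤ d → ∀ i → act p e₀ i ≡ coefficient p (toℕ i)
    act-e₀ []      _         i = refl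
    act-e₀ (a ∷ p) (ℕ.s≤s h) i = trans (cong (λ x → a ℚ.* e₀ i ℚ.+ (down (act p e₀) i ℚ.- x ℚ.* f i)) top) (entry i)
      where
      h′ : length p ℕ.≤ d
      h′ = ℕ.m≤n⇒m≤1+n h
      top : act p e₀ last ≡ 0ℚ
      top = trans (act-e₀ p h′ last) (coefficient-beyond p (ℕ.≤-trans h (ℕ.≤-reflexive (sym (Fin.toℕ-fromℕ n)))))
      entry : ∀ i → a ℚ.* e₀ i ℚ.+ (down (act p e₀) i ℚ.- 0ℚ ℚ.* f i) ≡ coefficient (a ∷ p) (toℕ i)
      entry fzero    = solveℚ 2 (λ a f → a ⊛ conℚ 1ℚ ✚ (conℚ 0ℚ ⊖ conℚ 0ℚ ⊛ f) ⊜ a) refl a (f fzero)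
      entry (fsuc i) = trans (solveℚ 3 (λ a x f → a ⊛ conℚ 0ℚ ✚ (x ⊖ conℚ 0ℚ ⊛ f) ⊜ x) refl a (act p e₀ (inject₁ i)) (f (fsuc i)))
        (trans (act-e₀ p h′ (inject₁ i)) (cong (coefficient p) (Fin.toℕ-inject₁ i)))

    act-polynomial : ∀ (q : V) → act (polynomial q) e₀ ≗ q
    act-polynomial q i = trans (act-e₀ (polynomial q) (ℕ.≤-reflexive (length-polynomial q)) i) (coefficient-polynomial q i)

    -- e₀ generates the module, on which the ring is commutative.
    ≈-from-e₀ : ∀ {p q} → act p e₀ ≗ act q e₀ → p ≈ q
    ≈-from-e₀ {p} {q} h = ≈-intro λ v i → trans (via p v i)
      (trans (act-cong (polynomial v) h i) (sym (via q v i)))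
      where
      via : ∀ p v → act p v ≗ act (polynomial v) (act p e₀)
      via p v i = trans (act-cong p (λ j → sym (act-polynomial v j)) i) (act-comm p (polynomial v) e₀ i)

    ℚ[s]-≈⇒≈ : ∀ {p q} → p ℚ[s].≈ q → p ≈ q
    ℚ[s]-≈⇒≈ {p} {q} e = ≈-intro (coefficients⇒≈ p q (ℚ[s].≈⇒coefficients e))

    -- Cayley-Hamilton, verified on the cyclic vector only: s^(d-1) takes `e₀` to the last basis
    -- vector, and one more application of s gives -f.
    f≈0 : monic f ≈ []
    f≈0 = ≈-from-e₀ λ i → trans (act-⊞ (polynomial f) (monomial d) e₀ i) (trans
      (cong₂ ℚ._+_ (act-polynomial f i) (cong₂ (λ x y → 0ℚ ℚ.* e₀ i ℚ.+ (x ℚ.- y ℚ.* f i)) (lower i)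
        (trans (act-monomial last) (trans (cong (coefficient (monomial n)) (Fin.toℕ-fromℕ n)) (coefficient-monomial n)))))
      (solveℚ 2 (λ f e → f ✚ (conℚ 0ℚ ⊛ e ✚ (conℚ 0ℚ ⊖ conℚ 1ℚ ⊛ f)) ⊜ conℚ 0ℚ) refl (f i) (e₀ i)))
      where
      act-monomial : ∀ i → act (monomial n) e₀ i ≡ coefficient (monomial n) (toℕ i)
      act-monomial = act-e₀ (monomial n) (ℕ.≤-reflexive (length-monomial n))
      lower : ∀ i → down (act (monomial n) e₀) i ≡ 0ℚ
      lower fzero    = refl
      lower (fsuc i) = trans (act-monomial (inject₁ i)) (coefficient-monomial-<
        (ℕ.≤-trans (ℕ.≤-reflexive (cong suc (Fin.toℕ-inject₁ i))) (Fin.toℕ<n i)))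

    ≈-polynomial : ∀ p → p ≈ polynomial (act p e₀)
    ≈-polynomial p = ≈-from-e₀ λ i → sym (act-polynomial (act p e₀) i)

    polynomial≈0⇒≡0 : ∀ (q : V) → polynomial q ≈ [] → ∀ i → q i ≡ 0ℚ
    polynomial≈0⇒≡0 q e i = trans (sym (act-polynomial q i)) (act-≡ e e₀ i)

    length-⊞ : ∀ p q {k} → length p ℕ.≤ k → length q ℕ.≤ k → length (p ⊞ q) ℕ.≤ k
    length-⊞ []      q       _         h′        = h′
    length-⊞ (a ∷ p) []      h         _         = h
    length-⊞ (a ∷ p) (b ∷ q) (ℕ.s≤s h) (ℕ.s≤s h′) = ℕ.s≤s (length-⊞ p q h h′)

    length-monic : ∀ {m} (q : Fin m → ℚ) → length (monic q) ℕ.≤ suc m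
    length-monic q = length-⊞ (polynomial q) _ (ℕ.≤-trans (ℕ.≤-reflexive (length-polynomial q)) (ℕ.n≤1+n _))
      (ℕ.≤-reflexive (length-monomial _))

    module _ (irreducible : ∀ (p t : Poly) → length p ℕ.≤ d → length t ℕ.≤ d → ¬ p ⊠ t ℚ[s].≈ monic f) where

      -- Dividing f by a monic p of smaller degree leaves a non-zero remainder of
      -- still smaller degree, which is invertible by induction.
      monic-inverse : ∀ k {m} → m ℕ.≤ k → m ℕ.< d → (p : Fin m → ℚ) → ∃[ q ] monic p ⊠ q ≈ constant 1ℚ
      monic-inverse k {zero} _ _ p = constant 1ℚ , solve 0 (con 1ℚ :* con 1ℚ := con 1ℚ) ≈-refl
      monic-inverse (suc k) {suc m} (ℕ.s≤s m≤k) m<d p = by (ℚ[s].division p (f fzero) f′)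
        where
        f′ : Poly
        f′ = polynomial (f ∘ fsuc) ⊞ monomial n
        f≈f₀∷f′ : monic f ℚ[s].≈ f fzero ∷ f′
        f≈f₀∷f′ = ℚ[s].≈-intro λ v i → cong (λ x → x ℚ.* v i ℚ.+ shift (ℚ[s].act f′ v) i) (ℚ.+-identityʳ (f fzero))
        by : (Σ[ t ∈ Poly ] length t ≡ length f′ × Σ[ r ∈ (Fin (suc m) → ℚ) ] f fzero ∷ f′ ℚ[s].≈ monic p ⊠ t ⊞ polynomial r) →
             ∃[ q ] monic p ⊠ q ≈ constant 1ℚ
        by (t , len , r , e) with ℚ[s].leading-term r
        ... | inj₁ r≡0 = contradiction (ℚ[s].≈-sym (ℚ[s].≈-trans f≈f₀∷f′ (ℚ[s].≈-trans e
                (ℚ[s].≈-trans (ℚ[s].+-congˡ {monic p ⊠ t} (ℚ[s].≈-trans (ℚ[s].polynomial-cong r≡0) (ℚ[s].polynomial-zero (suc m))))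
                  (ℚ[s].≈-intro λ v i → trans (ℚ[s].act-⊞ (monic p ⊠ t) [] v i) (ℚ.+-identityʳ _))))))
                (irreducible (monic p) t (ℕ.≤-trans (length-monic p) m<d)
                  (ℕ.≤-trans (ℕ.≤-reflexive len) (length-⊞ (polynomial (f ∘ fsuc)) (monomial n)
                    (ℕ.≤-trans (ℕ.≤-reflexive (length-polynomial (f ∘ fsuc))) (ℕ.n≤1+n n)) (ℕ.≤-reflexive (length-monomial n)))))
        ... | inj₂ (m′ , m′<m , r′ , c , c≢0 , r≈)
                with monic-inverse k (ℕ.≤-trans (ℕ.s≤s⁻¹ m′<m) m≤k) (ℕ.<-trans m′<m m<d) r′
        ...   | q , r′q≈1 = (⊟ t) ⊠ (constant c⁻¹ ⊠ q) , ≈-trans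
                  (solve 5 (λ P t R c q → P :* ((:- t) :* (c :* q)) := (:- (P :* t :+ R)) :* (c :* q) :+ R :* (c :* q)) ≈-refl
                    (monic p) t (polynomial r) (constant c⁻¹) q)
                  (≈-trans (+-cong (*-congʳ {constant c⁻¹ ⊠ q} (-‿cong (≈-trans (≈-sym (ℚ[s]-≈⇒≈ (ℚ[s].≈-trans f≈f₀∷f′ e))) f≈0)))
                                   (*-congʳ {constant c⁻¹ ⊠ q} (ℚ[s]-≈⇒≈ r≈)))
                  (≈-trans (solve 4 (λ c c′ R q → (c :* R) :* (c′ :* q) := (c :* c′) :* (R :* q)) ≈-refl
                      (constant c) (constant c⁻¹) (monic r′) q)
                  (≈-trans (*-cong (≈-trans (≈-sym (constant-* c c⁻¹)) (constant-cong (ℚ.*-inverseʳ c))) r′q≈1)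
                    (solve 0 (con 1ℚ :* con 1ℚ := con 1ℚ) ≈-refl))))
          where
          instance
            c≠0 : ℚ.NonZero c
            c≠0 = ℚ.≢-nonZero c≢0
          c⁻¹ : ℚ
          c⁻¹ = ℚ.1/ c

      inverse : ∀ p → ¬ p ≈ [] → ∃[ q ] p ⊠ q ≈ constant 1ℚ
      inverse p p≉0 with leading-term (act p e₀)
      ... | inj₁ p≡0 = contradiction (≈-trans (≈-polynomial p) (≈-trans (polynomial-cong p≡0) (polynomial-zero d))) p≉0
      ... | inj₂ (m , m<d , r , c , c≢0 , p≈) with monic-inverse m ℕ.≤-refl m<d r
      ...   | q , rq≈1 = constant c⁻¹ ⊠ q , ≈-trans (*-congʳ {constant c⁻¹ ⊠ q} (≈-trans (≈-polynomial p) p≈))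
                (≈-trans (solve 4 (λ c c′ R q → (c :* R) :* (c′ :* q) := (c :* c′) :* (R :* q)) ≈-refl
                    (constant c) (constant c⁻¹) (monic r) q)
                (≈-trans (*-cong (≈-trans (≈-sym (constant-* c c⁻¹)) (constant-cong (ℚ.*-inverseʳ c))) rq≈1)
                  (solve 0 (con 1ℚ :* con 1ℚ := con 1ℚ) ≈-refl)))
        where
        instance
          c≠0 : ℚ.NonZero c
          c≠0 = ℚ.≢-nonZero c≢0
        c⁻¹ : ℚ
        c⁻¹ = ℚ.1/ c

      numberField : NumberField
      numberField = record
        { commutativeRing = commutativeRing
        ; 1≉0 = λ e → contradiction (trans (sym (act-e₀ (constant 1ℚ) (ℕ.s≤s ℕ.z≤n) fzero)) (act-≡ e e₀ fzero)) λ ()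
        ; inverse = inverse
        ; ι = constant
        ; ι-hom = constant-hom
        ; degree = d
        ; basis = λ i → monomial (toℕ i)
        ; spanning = λ p → act p e₀ , ≈-trans (≈-polynomial p) (≈-sym (sum-monomials (act p e₀)))
        ; independent = λ q e → polynomial≈0⇒≡0 q (≈-trans (≈-sym (sum-monomials q)) e)
        }

-- Weighted 2-adic valuations and irreducibility from a one-segment Newton polygon.

module DyadicWeights where

  open PolynomialRings
  open import Data.Empty using (⊥)
  open import Data.List.Base using (List; []; _∷_; length)
  open import Data.List.Properties using (length-map)
  open import Data.Nat.Base as ℕ using (ℕ; zero; suc; _^_)
  import Data.Nat.Properties as ℕ
  import Data.Nat.Divisibility as ℕ
  open import Data.Nat.Coprimality as Coprime using (Coprime)
  open import Data.Nat.DivMod using (_%_; m≡m%n+[m/n]*n; m%n<n; m/n<m)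
  open import Data.Nat.Induction using (<-rec)
  open import Data.Integer.Base as ℤ using (ℤ; +_; -[1+_])
  import Data.Integer.Properties as ℤ
  import Data.Integer.Solver as ℤ
  import Data.Nat.Solver as ℕ
  open import Data.Product.Base using (∃-syntax; _×_; _,_; proj₁; proj₂)
  open import Data.Rational.Base as ℚ using (ℚ; 0ℚ; 1ℚ)
  import Data.Rational.Properties as ℚ
  import Data.Rational.Unnormalised.Base as ℚᵘ
  import Data.Rational.Unnormalised.Properties as ℚᵘ
  open import Data.Sum.Base using (_⊎_; inj₁; inj₂)
  open import Function.Base using (_∘_)
  open import Relation.Nullary using (¬_; Dec; yes; no; contradiction)
  open import Relation.Binary.Definitions using (tri<; tri≈; tri>)
  open import Relation.Binary.PropositionalEquality using (_≡_; _≢_; refl; cong; sym; trans; subst)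

  coefficient-⊞ : ∀ p q e → coefficient (p ⊞ q) e ≡ coefficient p e ℚ.+ coefficient q e
  coefficient-⊞ []      q       e       = sym (ℚ.+-identityˡ _)
  coefficient-⊞ (a ∷ p) []      e       = sym (ℚ.+-identityʳ _)
  coefficient-⊞ (a ∷ p) (b ∷ q) zero    = refl
  coefficient-⊞ (a ∷ p) (b ∷ q) (suc e) = coefficient-⊞ p q e

  coefficient-scale : ∀ c p e → coefficient (scale c p) e ≡ c ℚ.* coefficient p e
  coefficient-scale c []      e       = sym (ℚ.*-zeroʳ c)
  coefficient-scale c (a ∷ p) zero    = refl
  coefficient-scale c (a ∷ p) (suc e) = coefficient-scale c p e

  coefficient-constant-⊠ : ∀ c p e → coefficient (constant c ⊠ p) e ≡ c ℚ.* coefficient p e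
  coefficient-constant-⊠ c p e = trans (ℚ[s].≈⇒coefficients (ℚ[s].≈-sym (ℚ[s].scale-≈ c p)) e) (coefficient-scale c p e)

  coefficient-⊟ : ∀ p e → coefficient (⊟ p) e ≡ ℚ.- coefficient p e
  coefficient-⊟ []      e       = refl
  coefficient-⊟ (a ∷ p) zero    = refl
  coefficient-⊟ (a ∷ p) (suc e) = coefficient-⊟ p e

  coefficient-monomial-≢ : ∀ {n e} → n ≢ e → coefficient (monomial n) e ≡ 0ℚ
  coefficient-monomial-≢ {zero}  {zero}  n≢e = contradiction refl n≢e
  coefficient-monomial-≢ {zero}  {suc e} n≢e = refl
  coefficient-monomial-≢ {suc n} {zero}  n≢e = refl
  coefficient-monomial-≢ {suc n} {suc e} n≢e = coefficient-monomial-≢ (n≢e ∘ cong suc)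

  -- The denominator is literally 1, so the numerator recovers z by computation.
  int : ℤ → ℚ
  int z = ℚ.mkℚ z 0 (Coprime.sym (Coprime.1-coprimeTo _))

  int-+ : ∀ x y → int (x ℤ.+ y) ≡ int x ℚ.+ int y
  int-+ x y = ℚ.toℚᵘ-injective (ℚᵘ.≃-trans (ℚᵘ.*≡* (solve 2 (λ x y → (x :+ y) :* con (+ 1) := (x :* con (+ 1) :+ y :* con (+ 1)) :* con (+ 1)) refl x y))
    (ℚᵘ.≃-sym (ℚ.toℚᵘ-homo-+ (int x) (int y))))
    where open ℤ.+-*-Solver using (solve; _:+_; _:*_; con; _:=_)

  int-* : ∀ x y → int (x ℤ.* y) ≡ int x ℚ.* int y
  int-* x y = ℚ.toℚᵘ-injective (ℚᵘ.≃-trans (ℚᵘ.*≡* refl) (ℚᵘ.≃-sym (ℚ.toℚᵘ-homo-* (int x) (int y))))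

  int-injective : ∀ {x y} → int x ≡ int y → x ≡ y
  int-injective e = cong ℚ.numerator e

  int-denominator : ∀ q → int (ℚ.denominator q) ℚ.* q ≡ int (ℚ.numerator q)
  int-denominator q@(ℚ.mkℚ _ _ _) = ℚ.toℚᵘ-injective (ℚᵘ.≃-trans (ℚ.toℚᵘ-homo-* (int (ℚ.denominator q)) q)
    (ℚᵘ.*≡* (trans (ℤ.*-identityʳ _) (trans (ℤ.*-comm (ℚ.denominator q) (ℚ.numerator q))
      (cong (ℚ.numerator q ℤ.*_) (cong (λ n → + suc n) (sym (ℕ.+-identityʳ _))))))))

  2^_×odd_ : ℕ → ℤ → ℤ
  2^ k ×odd t = + (2 ^ k) ℤ.* (+ 1 ℤ.+ + 2 ℤ.* t)

  odd-part-ℕ : ∀ n → 1 ℕ.≤ n → ∃[ k ] ∃[ t ] + n ≡ 2^ k ×odd t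
  odd-part-ℕ = <-rec _ go
    where
    go : ∀ n → (∀ {m} → m ℕ.< n → 1 ℕ.≤ m → ∃[ k ] ∃[ t ] + m ≡ 2^ k ×odd t) → 1 ℕ.≤ n → ∃[ k ] ∃[ t ] + n ≡ 2^ k ×odd t
    go n@(suc _) rec _ with n % 2 in r | n ℕ./ 2 in h | m≡m%n+[m/n]*n n 2 | m%n<n n 2
    ... | 0 | 0 | eq | _ = contradiction eq λ ()
    ... | 0 | suc m | eq | _ with rec {suc m} (subst (ℕ._< n) h (m/n<m n 2 (ℕ.s≤s (ℕ.s≤s ℕ.z≤n)))) (ℕ.s≤s ℕ.z≤n)
    ...   | k , t , e = suc k , t , trans (cong +_ eq) (trans (ℤ.pos-* (suc m) 2) (trans (cong (ℤ._* + 2) e)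
            (trans (trans (ℤ.*-comm _ (+ 2)) (sym (ℤ.*-assoc (+ 2) (+ (2 ^ k)) _)))
              (cong (ℤ._* (+ 1 ℤ.+ + 2 ℤ.* t)) (sym (ℤ.pos-* 2 (2 ^ k)))))))
    go n@(suc _) rec _ | 1 | m | eq | _ = 0 , + m , trans (cong +_ eq) (trans (cong (λ z → + 1 ℤ.+ z)
            (trans (ℤ.pos-* m 2) (ℤ.*-comm (+ m) (+ 2)))) (sym (ℤ.*-identityˡ _)))
    go n@(suc _) rec _ | suc (suc _) | _ | _ | ℕ.s≤s (ℕ.s≤s ())

  odd-part : ∀ z → z ≢ + 0 → ∃[ k ] ∃[ t ] z ≡ 2^ k ×odd t
  odd-part (+ zero)  z≢0 = contradiction refl z≢0
  odd-part (+ suc n) z≢0 = odd-part-ℕ (suc n) (ℕ.s≤s ℕ.z≤n)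
  odd-part -[1+ n ]  z≢0 with odd-part-ℕ (suc n) (ℕ.s≤s ℕ.z≤n)
  ... | k , t , e = k , ℤ.- (+ 1) ℤ.- t , trans (cong (λ x → ℤ.- x) e)
    (solve 2 (λ a t → :- (a :* (con (+ 1) :+ con (+ 2) :* t)) := a :* (con (+ 1) :+ con (+ 2) :* (con (ℤ.- (+ 1)) :- t)))
      refl (+ (2 ^ k)) t)
    where open ℤ.+-*-Solver using (solve; _:+_; _:*_; _:-_; :-_; con; _:=_)

  -- The 2-adic Gauss valuation for which s has weight h and 2 has weight d: a
  -- term q sᵉ with q = 2ᵏ u has weight k d + h e.
  module Weight (d h : ℕ) .{{_ : ℕ.NonZero d}} where

    -- The cofactor z may be even or 0, so k only bounds the 2-adic valuation from below, and 0 has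
    -- every weight.
    data Weight≥ (w e : ℕ) (q : ℚ) : Set where
      weight≥ : ∀ k z → q ≡ int (+ (2 ^ k) ℤ.* z) → w ℕ.≤ k ℕ.* d ℕ.+ h ℕ.* e → Weight≥ w e q

    data Weight≡ (w e : ℕ) (q : ℚ) : Set where
      weight≡ : ∀ k t → q ≡ int (2^ k ×odd t) → w ≡ k ℕ.* d ℕ.+ h ℕ.* e → Weight≡ w e q

    weight≥-0 : ∀ {w e} → Weight≥ w e 0ℚ
    weight≥-0 {w} = weight≥ w (+ 0) (cong int (sym (ℤ.*-zeroʳ (+ (2 ^ w))))) (ℕ.≤-trans (ℕ.m≤m*n w d) (ℕ.m≤m+n _ _))

    weight≥-mono : ∀ {w w′ e q} → w ℕ.≤ w′ → Weight≥ w′ e q → Weight≥ w e q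
    weight≥-mono w≤w′ (weight≥ k z eq le) = weight≥ k z eq (ℕ.≤-trans w≤w′ le)

    private
      2^-+ : ∀ m n → + (2 ^ (m ℕ.+ n)) ≡ + (2 ^ m) ℤ.* + (2 ^ n)
      2^-+ m n = trans (cong +_ (ℕ.^-distribˡ-+-* 2 m n)) (ℤ.pos-* (2 ^ m) (2 ^ n))

      2^-split : ∀ {k k′} z → k ℕ.≤ k′ → + (2 ^ k′) ℤ.* z ≡ + (2 ^ k) ℤ.* (+ (2 ^ (k′ ℕ.∸ k)) ℤ.* z)
      2^-split {k} {k′} z k≤k′ = trans (cong (λ m → + (2 ^ m) ℤ.* z) (sym (ℕ.m+[n∸m]≡n k≤k′)))
        (trans (cong (ℤ._* z) (2^-+ k (k′ ℕ.∸ k))) (ℤ.*-assoc (+ (2 ^ k)) (+ (2 ^ (k′ ℕ.∸ k))) z))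

      2^-split-even : ∀ {k k′} z → k ℕ.< k′ → ∃[ y ] + (2 ^ k′) ℤ.* z ≡ + (2 ^ k) ℤ.* (+ 2 ℤ.* y)
      2^-split-even {k} {k′} z k<k′ = + (2 ^ (k′ ℕ.∸ suc k)) ℤ.* z , trans (2^-split z k<k′)
        (trans (cong (ℤ._* (+ (2 ^ (k′ ℕ.∸ suc k)) ℤ.* z)) (trans (cong +_ (ℕ.*-comm 2 (2 ^ k))) (ℤ.pos-* (2 ^ k) 2)))
          (ℤ.*-assoc (+ (2 ^ k)) (+ 2) (+ (2 ^ (k′ ℕ.∸ suc k)) ℤ.* z)))

      weight≥-+′ : ∀ {w e k k′ z z′} → k ℕ.≤ k′ → w ℕ.≤ k ℕ.* d ℕ.+ h ℕ.* e →
        Weight≥ w e (int (+ (2 ^ k) ℤ.* z) ℚ.+ int (+ (2 ^ k′) ℤ.* z′))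
      weight≥-+′ {k = k} {k′} {z} {z′} k≤k′ le = weight≥ k (z ℤ.+ + (2 ^ (k′ ℕ.∸ k)) ℤ.* z′)
        (trans (sym (int-+ (+ (2 ^ k) ℤ.* z) (+ (2 ^ k′) ℤ.* z′))) (cong int (trans (cong (λ x → + (2 ^ k) ℤ.* z ℤ.+ x) (2^-split z′ k≤k′))
          (sym (ℤ.*-distribˡ-+ (+ (2 ^ k)) z (+ (2 ^ (k′ ℕ.∸ k)) ℤ.* z′)))))) le

    weight≥-+ : ∀ {w e q q′} → Weight≥ w e q → Weight≥ w e q′ → Weight≥ w e (q ℚ.+ q′)
    weight≥-+ (weight≥ k z refl le) (weight≥ k′ z′ refl le′) with ℕ.≤-total k k′
    ... | inj₁ k≤k′ = weight≥-+′ k≤k′ le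
    ... | inj₂ k′≤k = subst (Weight≥ _ _) (ℚ.+-comm (int (+ (2 ^ k′) ℤ.* z′)) (int (+ (2 ^ k) ℤ.* z))) (weight≥-+′ k′≤k le′)

    private
      weights-add : ∀ k k′ e e′ → k ℕ.* d ℕ.+ h ℕ.* e ℕ.+ (k′ ℕ.* d ℕ.+ h ℕ.* e′) ≡ (k ℕ.+ k′) ℕ.* d ℕ.+ h ℕ.* (e ℕ.+ e′)
      weights-add k k′ e e′ = solve 6 (λ k k′ e e′ d h → k :* d :+ h :* e :+ (k′ :* d :+ h :* e′) :=
        (k :+ k′) :* d :+ h :* (e :+ e′)) refl k k′ e e′ d h
        where open ℕ.+-*-Solver

    weight≥-* : ∀ {w w′ e e′ q q′} → Weight≥ w e q → Weight≥ w′ e′ q′ → Weight≥ (w ℕ.+ w′) (e ℕ.+ e′) (q ℚ.* q′)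
    weight≥-* {e = e} {e′} (weight≥ k z refl le) (weight≥ k′ z′ refl le′) = weight≥ (k ℕ.+ k′) (z ℤ.* z′)
      (trans (sym (int-* (+ (2 ^ k) ℤ.* z) (+ (2 ^ k′) ℤ.* z′))) (cong int (trans (solve 4 (λ a b x y → a :* x :* (b :* y) := a :* b :* (x :* y)) refl
        (+ (2 ^ k)) (+ (2 ^ k′)) z z′) (cong (ℤ._* (z ℤ.* z′)) (sym (2^-+ k k′))))))
      (ℕ.≤-trans (ℕ.+-mono-≤ le le′) (ℕ.≤-reflexive (weights-add k k′ e e′)))
      where open ℤ.+-*-Solver using (solve; _:+_; _:*_; _:=_)

    weight≡⇒≥ : ∀ {w e q} → Weight≡ w e q → Weight≥ w e q
    weight≡⇒≥ (weight≡ k t eq e) = weight≥ k (+ 1 ℤ.+ + 2 ℤ.* t) eq (ℕ.≤-reflexive e)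

    weight≡-* : ∀ {w w′ e e′ q q′} → Weight≡ w e q → Weight≡ w′ e′ q′ → Weight≡ (w ℕ.+ w′) (e ℕ.+ e′) (q ℚ.* q′)
    weight≡-* {e = e} {e′} (weight≡ k t refl refl) (weight≡ k′ t′ refl refl) = weight≡ (k ℕ.+ k′) (t ℤ.+ t′ ℤ.+ + 2 ℤ.* (t ℤ.* t′))
      (trans (sym (int-* (2^ k ×odd t) (2^ k′ ×odd t′))) (cong int (trans (solve 4 (λ a b t u →
          a :* (con (+ 1) :+ con (+ 2) :* t) :* (b :* (con (+ 1) :+ con (+ 2) :* u)) :=
          a :* b :* (con (+ 1) :+ con (+ 2) :* (t :+ u :+ con (+ 2) :* (t :* u)))) refl
        (+ (2 ^ k)) (+ (2 ^ k′)) t t′) (cong (ℤ._* (+ 1 ℤ.+ + 2 ℤ.* (t ℤ.+ t′ ℤ.+ + 2 ℤ.* (t ℤ.* t′)))) (sym (2^-+ k k′))))))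
      (weights-add k k′ e e′)
      where open ℤ.+-*-Solver using (solve; _:+_; _:*_; con; _:=_)

    -- At a fixed exponent e a larger weight means a higher power of 2, so q′ is an even multiple of
    -- 2ᵏ and leaves the cofactor of q odd.
    weight≡-+ : ∀ {w e q q′} → Weight≡ w e q → Weight≥ (suc w) e q′ → Weight≡ w e (q ℚ.+ q′)
    weight≡-+ {e = e} (weight≡ k t refl refl) (weight≥ k′ z refl le) with
      2^-split-even z (ℕ.*-cancelʳ-< d k k′ (ℕ.+-cancelʳ-< (h ℕ.* e) (k ℕ.* d) (k′ ℕ.* d) le))
    ... | y , eq = weight≡ k (t ℤ.+ y) (trans (sym (int-+ (2^ k ×odd t) (+ (2 ^ k′) ℤ.* z))) (cong int (trans (cong (λ x → 2^ k ×odd t ℤ.+ x) eq)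
      (solve 3 (λ a t y → a :* (con (+ 1) :+ con (+ 2) :* t) :+ a :* (con (+ 2) :* y) :=
         a :* (con (+ 1) :+ con (+ 2) :* (t :+ y))) refl (+ (2 ^ k)) t y)))) refl
      where open ℤ.+-*-Solver using (solve; _:+_; _:*_; con; _:=_)

    -- A higher power of 2 dividing q would make its odd cofactor even.
    weight≥⇒≤ : ∀ {w w′ e q} → Weight≡ w e q → Weight≥ w′ e q → w′ ℕ.≤ w
    weight≥⇒≤ {e = e} (weight≡ k t refl refl) (weight≥ k′ z eq le) with ℕ.≤-<-connex k′ k
    ... | inj₁ k′≤k = ℕ.≤-trans le (ℕ.+-monoˡ-≤ (h ℕ.* e) (ℕ.*-monoˡ-≤ d k′≤k))
    ... | inj₂ k<k′ with 2^-split-even z k<k′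
    ...   | y , eq′ = contradiction (ℤ.*-cancelˡ-≡ (+ (2 ^ k)) _ _ {{2^k≢0}} (trans (int-injective eq) eq′)) (odd≢even t y)
      where
      2^k≢0 : ℤ.NonZero (+ (2 ^ k))
      2^k≢0 = ℕ.m^n≢0 2 k
      odd≢even : ∀ t y → + 1 ℤ.+ + 2 ℤ.* t ≢ + 2 ℤ.* y
      odd≢even t y e = 1≢2z (y ℤ.- t) (trans (solve 1 (λ t → con (+ 1) := con (+ 1) :+ con (+ 2) :* t :- con (+ 2) :* t) refl t)
        (trans (cong (ℤ._- + 2 ℤ.* t) e) (solve 2 (λ y t → con (+ 2) :* y :- con (+ 2) :* t := con (+ 2) :* (y :- t)) refl y t)))
        where
        open ℤ.+-*-Solver using (solve; _:+_; _:*_; _:-_; con; _:=_)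
        1≢2z : ∀ z → + 1 ≢ + 2 ℤ.* z
        1≢2z (+ zero)  ()
        1≢2z (+ suc n) e = contradiction (ℤ.+-injective (trans e (sym (ℤ.pos-* 2 (suc n))))) (λ e → contradiction (trans e (cong suc (ℕ.+-suc n (n ℕ.+ 0)))) λ ())
        1≢2z -[1+ n ]  ()

    weight≡-exists : ∀ {e z} → z ≢ + 0 → ∃[ w ] Weight≡ w e (int z)
    weight≡-exists {e} {z} z≢0 with odd-part z z≢0
    ... | k , t , eq = k ℕ.* d ℕ.+ h ℕ.* e , weight≡ k t (cong int eq) refl

    -- The offset e₀ treats the list as s^e₀ p; it grows as the recursion strips leading list
    -- entries.
    PolyWeight≥ : ℕ → ℕ → Poly → Set
    PolyWeight≥ e₀ w p = ∀ e → Weight≥ w (e₀ ℕ.+ e) (coefficient p e)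

    polyWeight≥-≈ : ∀ {w p q} → p ℚ[s].≈ q → PolyWeight≥ 0 w p → PolyWeight≥ 0 w q
    polyWeight≥-≈ p≈q g e = subst (Weight≥ _ e) (ℚ[s].≈⇒coefficients p≈q e) (g e)

    polyWeight≥-mono : ∀ {e₀ w w′ p} → w ℕ.≤ w′ → PolyWeight≥ e₀ w′ p → PolyWeight≥ e₀ w p
    polyWeight≥-mono w≤w′ g e = weight≥-mono w≤w′ (g e)

    polyWeight≥-⊞ : ∀ {e₀ w} p q → PolyWeight≥ e₀ w p → PolyWeight≥ e₀ w q → PolyWeight≥ e₀ w (p ⊞ q)
    polyWeight≥-⊞ p q g g′ e = subst (Weight≥ _ _) (sym (coefficient-⊞ p q e)) (weight≥-+ (g e) (g′ e))

    polyWeight≥-⊠-offset : ∀ {e₀ e₁ w w′} p q → PolyWeight≥ e₀ w p → PolyWeight≥ e₁ w′ q →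
                           PolyWeight≥ (e₀ ℕ.+ e₁) (w ℕ.+ w′) (p ⊠ q)
    polyWeight≥-⊠-offset []      q g g′ e = weight≥-0
    polyWeight≥-⊠-offset {e₀} {e₁} {w} {w′} (a ∷ p) q g g′ = polyWeight≥-⊞ (scale a q) (0ℚ ∷ p ⊠ q) scaled shifted
      where
      open ℕ.+-*-Solver using (solve; _:+_; con; _:=_)
      scaled : PolyWeight≥ (e₀ ℕ.+ e₁) (w ℕ.+ w′) (scale a q)
      scaled e = subst (λ x → Weight≥ (w ℕ.+ w′) x (coefficient (scale a q) e)) (solve 3 (λ a b c → (a :+ con 0) :+ (b :+ c) := (a :+ b) :+ c) refl e₀ e₁ e)
        (subst (Weight≥ _ _) (sym (coefficient-scale a q e)) (weight≥-* (g 0) (g′ e)))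
      shifted : PolyWeight≥ (e₀ ℕ.+ e₁) (w ℕ.+ w′) (0ℚ ∷ p ⊠ q)
      shifted zero    = weight≥-0
      shifted (suc e) = subst (λ x → Weight≥ (w ℕ.+ w′) x (coefficient (p ⊠ q) e)) (sym (ℕ.+-suc (e₀ ℕ.+ e₁) e))
        (polyWeight≥-⊠-offset {suc e₀} {e₁} {w} {w′} p q
          (λ e → subst (λ x → Weight≥ w x (coefficient p e)) (ℕ.+-suc e₀ e) (g (suc e))) g′ e)

    polyWeight≥-⊠ : ∀ {w w′} p q → PolyWeight≥ 0 w p → PolyWeight≥ 0 w′ q → PolyWeight≥ 0 (w ℕ.+ w′) (p ⊠ q)
    polyWeight≥-⊠ = polyWeight≥-⊠-offset

    polyWeight≥-constant : ∀ {w q} → Weight≥ w 0 q → PolyWeight≥ 0 w (constant q)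
    polyWeight≥-constant g zero    = g
    polyWeight≥-constant g (suc e) = weight≥-0

    polyWeight≥-monomial : ∀ n → PolyWeight≥ 0 (h ℕ.* n) (monomial n)
    polyWeight≥-monomial n e with n ℕ.≟ e
    ... | yes refl = weight≥ 0 (+ 1) (coefficient-monomial n) ℕ.≤-refl
    ... | no n≢e   = subst (Weight≥ _ e) (sym (coefficient-monomial-≢ n≢e)) weight≥-0

    polyWeight≥-⊟ : ∀ {w} p → PolyWeight≥ 0 w p → PolyWeight≥ 0 w (⊟ p)
    polyWeight≥-⊟ p g e with g e
    ... | weight≥ k z eq le = weight≥ k (ℤ.- z) (trans (coefficient-⊟ p e) (trans (cong (λ x → ℚ.- x) eq)
      (trans (int-neg (+ (2 ^ k) ℤ.* z)) (cong int (ℤ.neg-distribʳ-* (+ (2 ^ k)) z))))) le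
      where
      int-neg : ∀ z → ℚ.- int z ≡ int (ℤ.- z)
      int-neg (+ zero)  = refl
      int-neg (+ suc n) = refl
      int-neg -[1+ n ]  = refl

    -- The initial form of s^e₀ p for the valuation is a single monomial, the one coming from
    -- exponent a of p.
    Initial : ℕ → ℕ → ℕ → Poly → Set
    Initial e₀ w a p = Weight≡ w (e₀ ℕ.+ a) (coefficient p a) ×
                       (∀ e → e ≢ a → Weight≥ (suc w) (e₀ ℕ.+ e) (coefficient p e))

    Integral : Poly → Set
    Integral p = ∀ e → ∃[ z ] coefficient p e ≡ int z

    -- As h is prime to d, terms of distinct exponents below d have distinct weights.
    initial-exists : Coprime h d → ∀ e₀ p → e₀ ℕ.+ length p ℕ.≤ d → Integral p →
      (∀ e → coefficient p e ≡ 0ℚ) ⊎ ∃[ w ] ∃[ a ] Initial e₀ w a p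
    initial-exists h⊥d e₀ []      _  _ = inj₁ λ e → refl
    initial-exists h⊥d e₀ (c ∷ p) le integral with
      initial-exists h⊥d (suc e₀) p (ℕ.≤-trans (ℕ.≤-reflexive (sym (ℕ.+-suc e₀ (length p)))) le) (integral ∘ suc)
      | integral 0
    ... | inj₁ p≡0 | z , c≡z = alone (z ℤ.≟ + 0)
      where
      alone : Dec (z ≡ + 0) → (∀ e → coefficient (c ∷ p) e ≡ 0ℚ) ⊎ ∃[ w ] ∃[ a ] Initial e₀ w a (c ∷ p)
      alone (yes refl) = inj₁ λ { zero → c≡z ; (suc e) → p≡0 e }
      alone (no z≢0) with weight≡-exists {e₀ ℕ.+ 0} z≢0
      ... | w , z-w = inj₂ (w , 0 , subst (Weight≡ w _) (sym c≡z) z-w ,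
        λ { zero 0≢0 → contradiction refl 0≢0 ; (suc e) _ → subst (Weight≥ _ _) (sym (p≡0 e)) weight≥-0 })
    ... | inj₂ (w , a , p-w , p-rest) | z , c≡z = inj₂ (compare (z ℤ.≟ + 0))
      where
      reindex : ∀ {w e q} → Weight≥ w (suc e₀ ℕ.+ e) q → Weight≥ w (e₀ ℕ.+ suc e) q
      reindex {w} {e} {q} = subst (λ x → Weight≥ w x q) (sym (ℕ.+-suc e₀ e))
      keep : Weight≥ (suc w) (e₀ ℕ.+ 0) c → ∃[ w ] ∃[ a ] Initial e₀ w a (c ∷ p)
      keep g = w , suc a , subst (λ x → Weight≡ w x (coefficient p a)) (sym (ℕ.+-suc e₀ a)) p-w ,
        λ { zero _ → g ; (suc e) e≢a → reindex {suc w} {e} (p-rest e (e≢a ∘ cong suc)) }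
      all-p : ∀ e → Weight≥ w (suc e₀ ℕ.+ e) (coefficient p e)
      all-p e with e ℕ.≟ a
      ... | yes refl = weight≡⇒≥ p-w
      ... | no e≢a   = weight≥-mono (ℕ.n≤1+n w) (p-rest e e≢a)
      a<length : a ℕ.< length p
      a<length with ℕ.≤-<-connex (length p) a
      ... | inj₂ a<l = a<l
      ... | inj₁ l≤a = contradiction (weight≥⇒≤ p-w (subst (Weight≥ (suc w) _) (sym (coefficient-beyond p l≤a)) weight≥-0)) (ℕ.<-irrefl refl)
      distinct : ∀ {q w′} → Weight≡ w′ (e₀ ℕ.+ 0) q → Weight≡ w (suc e₀ ℕ.+ a) (coefficient p a) → w′ ≢ w
      distinct (weight≡ k _ _ w′≡) (weight≡ l _ _ w≡) w′≡w = contradiction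
        (ℕ.∣⇒≤ (Coprime.coprime-divisor (Coprime.sym h⊥d) d∣))
        (ℕ.<⇒≱ (ℕ.≤-trans (ℕ.s≤s a<length) (ℕ.≤-trans (ℕ.m≤n+m (length (c ∷ p)) e₀) le)))
        where
        eq : k ℕ.* d ℕ.+ h ℕ.* e₀ ≡ l ℕ.* d ℕ.+ (h ℕ.* e₀ ℕ.+ h ℕ.* suc a)
        eq = trans (cong (λ e → k ℕ.* d ℕ.+ h ℕ.* e) (sym (ℕ.+-identityʳ e₀))) (trans (sym w′≡) (trans w′≡w
          (trans w≡ (cong (l ℕ.* d ℕ.+_) (trans (cong (h ℕ.*_) (sym (ℕ.+-suc e₀ a)))
            (ℕ.*-distribˡ-+ h e₀ (suc a)))))))
        d∣ : d ℕ.∣ h ℕ.* suc a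
        d∣ = ℕ.∣m+n∣m⇒∣n {n = h ℕ.* suc a} (subst (d ℕ.∣_) (ℕ.+-cancelˡ-≡ (h ℕ.* e₀) _ _ (trans (ℕ.+-comm (h ℕ.* e₀) (k ℕ.* d)) (trans eq
            (solve 3 (λ x y z → x :+ (y :+ z) := y :+ (x :+ z)) refl (l ℕ.* d) (h ℕ.* e₀) (h ℕ.* suc a))))) (ℕ.n∣m*n k)) (ℕ.n∣m*n l)
          where open ℕ.+-*-Solver
      compare : Dec (z ≡ + 0) → ∃[ w ] ∃[ a ] Initial e₀ w a (c ∷ p)
      compare (yes refl) = keep (subst (Weight≥ _ _) (sym c≡z) weight≥-0)
      compare (no z≢0) with weight≡-exists {e₀ ℕ.+ 0} z≢0
      ... | w′ , c-w′ with ℕ.<-cmp w w′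
      ...   | tri< w<w′ _ _ = keep (subst (Weight≥ _ _) (sym c≡z) (weight≥-mono w<w′ (weight≡⇒≥ c-w′)))
      ...   | tri≈ _ w≡w′ _ = contradiction (sym w≡w′) (distinct c-w′ p-w)
      ...   | tri> _ _ w′<w = w′ , 0 , subst (Weight≡ _ _) (sym c≡z) c-w′ ,
        λ { zero 0≢0 → contradiction refl 0≢0 ; (suc e) _ → reindex {suc w′} {e} (weight≥-mono w′<w (all-p e)) }

    private
      term : ℚ → ℕ → Poly
      term u a = constant u ⊠ monomial a

      coefficient-term : ∀ u a e → coefficient (term u a) e ≡ u ℚ.* coefficient (monomial a) e
      coefficient-term u a = coefficient-constant-⊠ u (monomial a)

      coefficient-term-≡ : ∀ u a → coefficient (term u a) a ≡ u
      coefficient-term-≡ u a = trans (coefficient-term u a a) (trans (cong (u ℚ.*_) (coefficient-monomial a)) (ℚ.*-identityʳ u))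

      coefficient-term-≢ : ∀ u {a e} → a ≢ e → coefficient (term u a) e ≡ 0ℚ
      coefficient-term-≢ u {a} {e} a≢e = trans (coefficient-term u a e) (trans (cong (u ℚ.*_) (coefficient-monomial-≢ a≢e)) (ℚ.*-zeroʳ u))

      polyWeight≥-term : ∀ {w u a} → Weight≥ w a u → PolyWeight≥ 0 w (term u a)
      polyWeight≥-term {u = u} {a} g e with a ℕ.≟ e
      ... | yes refl = subst (Weight≥ _ a) (sym (coefficient-term-≡ u a)) g
      ... | no a≢e   = subst (Weight≥ _ e) (sym (coefficient-term-≢ u a≢e)) weight≥-0

      rest : ℕ → Poly → Poly
      rest a p = p ⊞ ⊟ term (coefficient p a) a

      coefficient-rest : ∀ a p e → coefficient (rest a p) e ≡ coefficient p e ℚ.- coefficient (term (coefficient p a) a) e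
      coefficient-rest a p e = trans (coefficient-⊞ p _ e) (cong (coefficient p e ℚ.+_) (coefficient-⊟ (term (coefficient p a) a) e))

      polyWeight≥-rest : ∀ {w a p} → Initial 0 w a p → PolyWeight≥ 0 (suc w) (rest a p)
      polyWeight≥-rest {w} {a} {p} (_ , others) e with a ℕ.≟ e
      ... | yes refl = subst (Weight≥ _ e) (sym (trans (coefficient-rest a p a)
        (trans (cong (λ x → coefficient p a ℚ.- x) (coefficient-term-≡ (coefficient p a) a)) (ℚ.+-inverseʳ (coefficient p a))))) weight≥-0
      ... | no a≢e = subst (Weight≥ _ e) (sym (trans (coefficient-rest a p e)
        (trans (cong (λ x → coefficient p e ℚ.- x) (coefficient-term-≢ (coefficient p a) a≢e)) (ℚ.+-identityʳ _)))) (others e (a≢e ∘ sym))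

    -- Write p = u sᵃ + p′ and q = v sᵇ + q′ with p′ and q′ of strictly larger weight. Every product
    -- other than u v s^(a+b) then has weight above w + w′, and weights of odd cofactors add
    -- exactly.
    initial-⊠ : ∀ {w w′ a b} p q → Initial 0 w a p → Initial 0 w′ b q → Initial 0 (w ℕ.+ w′) (a ℕ.+ b) (p ⊠ q)
    initial-⊠ {w} {w′} {a} {b} p q p-in q-in =
      subst (Weight≡ _ _) (sym (trans (split (a ℕ.+ b)) (cong (ℚ._+ coefficient r (a ℕ.+ b)) (coefficient-term-≡ (u ℚ.* v) (a ℕ.+ b)))))
        (weight≡-+ (weight≡-* (proj₁ p-in) (proj₁ q-in)) (r-weight (a ℕ.+ b))) ,
      λ e e≢ → subst (Weight≥ _ e) (sym (trans (split e) (trans (cong (ℚ._+ coefficient r e) (coefficient-term-≢ (u ℚ.* v) (e≢ ∘ sym)))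
        (ℚ.+-identityˡ _)))) (r-weight e)
      where
      u v : ℚ
      u = coefficient p a
      v = coefficient q b
      p′ q′ r : Poly
      p′ = rest a p
      q′ = rest b q
      r = term u a ⊠ q′ ⊞ (p′ ⊠ term v b ⊞ p′ ⊠ q′)
      r-weight : PolyWeight≥ 0 (suc (w ℕ.+ w′)) r
      r-weight = polyWeight≥-⊞ (term u a ⊠ q′) (p′ ⊠ term v b ⊞ p′ ⊠ q′)
        (subst (λ x → PolyWeight≥ 0 x (term u a ⊠ q′)) (ℕ.+-suc w w′) (polyWeight≥-⊠ (term u a) q′ u-term (polyWeight≥-rest {p = q} q-in)))
        (polyWeight≥-⊞ (p′ ⊠ term v b) (p′ ⊠ q′)
          (polyWeight≥-⊠ p′ (term v b) p-rest v-term)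
          (polyWeight≥-mono {p = p′ ⊠ q′} (ℕ.s≤s (ℕ.+-monoʳ-≤ w (ℕ.n≤1+n w′))) (polyWeight≥-⊠ p′ q′ p-rest (polyWeight≥-rest {p = q} q-in))))
        where
        p-rest = polyWeight≥-rest {p = p} p-in
        u-term = polyWeight≥-term {u = u} (weight≡⇒≥ (proj₁ p-in))
        v-term = polyWeight≥-term {u = v} (weight≡⇒≥ (proj₁ q-in))
      split : ∀ e → coefficient (p ⊠ q) e ≡ coefficient (term (u ℚ.* v) (a ℕ.+ b)) e ℚ.+ coefficient r e
      split e = trans (≈⇒coefficients (≈-trans
        (solve 6 (λ p q u v m n → p :* q := u :* v :* (m :* n) :+ (u :* m :* (q :- v :* n) :+
           ((p :- u :* m) :* (v :* n) :+ (p :- u :* m) :* (q :- v :* n)))) ≈-refl p q (constant u) (constant v) (monomial a) (monomial b))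
        (+-congʳ {r} (*-cong (≈-sym (constant-* u v)) (monomial-⊠ a b)))) e)
        (coefficient-⊞ (term (u ℚ.* v) (a ℕ.+ b)) r e)
        where open ℚ[s]

    clear-denominators : ∀ p → ∃[ c ] c ≢ + 0 × Integral (constant (int c) ⊠ p)
    clear-denominators [] = + 1 , (λ ()) , λ { zero → + 0 , refl ; (suc _) → + 0 , refl }
    clear-denominators (a ∷ p) with clear-denominators p
    ... | c , c≢0 , integral = c ℤ.* n , c*n≢0 , λ e →
        proj₁ (entries e) , trans (coefficient-constant-⊠ (int (c ℤ.* n)) (a ∷ p) e) (proj₂ (entries e))
      where
      n : ℤ
      n = ℚ.denominator a
      c*n≢0 : c ℤ.* n ≢ + 0
      c*n≢0 e with ℤ.i*j≡0⇒i≡0∨j≡0 c e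
      ... | inj₁ c≡0 = c≢0 c≡0
      ... | inj₂ ()
      entries : ∀ e → ∃[ z ] int (c ℤ.* n) ℚ.* coefficient (a ∷ p) e ≡ int z
      entries zero = c ℤ.* ℚ.numerator a , trans (cong (ℚ._* a) (int-* c n)) (trans (ℚ.*-assoc (int c) (int n) a)
        (trans (cong (int c ℚ.*_) (int-denominator a)) (sym (int-* c (ℚ.numerator a)))))
      entries (suc e) with integral e
      ... | z , eq = n ℤ.* z , trans (cong (ℚ._* coefficient p e) (trans (cong int (ℤ.*-comm c n)) (int-* n c)))
        (trans (ℚ.*-assoc (int n) (int c) (coefficient p e))
        (trans (cong (int n ℚ.*_) (trans (sym (coefficient-constant-⊠ (int c) p e)) eq)) (sym (int-* n z))))

    -- Dumas: the first and last terms have the least weight, whereas a product of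
    -- two polynomials of smaller degree has a single term of least weight.
    product-ends : Coprime h d → ∀ {w} p t → length p ℕ.≤ d → length t ℕ.≤ d → Integral p → Integral t →
      ∀ g → p ⊠ t ℚ[s].≈ g → PolyWeight≥ 0 w g → Weight≡ w 0 (coefficient g 0) → ¬ Weight≡ w d (coefficient g d)
    product-ends h⊥d {w} p t p-len t-len p-int t-int g pt≈g g-weight bottom top =
      conclude (initial-exists h⊥d 0 p p-len p-int) (initial-exists h⊥d 0 t t-len t-int)
      where
      g≢0 : ¬ g ℚ[s].≈ []
      g≢0 g≈0 = ℕ.<-irrefl refl (weight≥⇒≤ bottom (subst (Weight≥ (suc w) 0) (sym (ℚ[s].≈⇒coefficients g≈0 0)) weight≥-0))
      conclude : (∀ e → coefficient p e ≡ 0ℚ) ⊎ (∃[ w ] ∃[ a ] Initial 0 w a p) →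
                 (∀ e → coefficient t e ≡ 0ℚ) ⊎ (∃[ w ] ∃[ a ] Initial 0 w a t) → ⊥
      conclude (inj₁ p≡0) _ = g≢0 (ℚ[s].≈-trans (ℚ[s].≈-sym pt≈g) (ℚ[s].*-congʳ {t} {p} {[]} (ℚ[s].coefficients⇒ p≡0)))
      conclude (inj₂ _) (inj₁ t≡0) = g≢0 (ℚ[s].≈-trans (ℚ[s].≈-sym pt≈g)
        (ℚ[s].≈-trans (ℚ[s].*-congˡ {p} {t} {[]} (ℚ[s].coefficients⇒ t≡0)) (ℚ[s].zeroʳ p)))
      conclude (inj₂ (w₁ , a , p-in)) (inj₂ (w₂ , b , t-in)) = single (initial-⊠ p t p-in t-in) (0 ℕ.≟ a ℕ.+ b)
        where
        single : ∀ {w′ a} → Initial 0 w′ a (p ⊠ t) → Dec (0 ≡ a) → ⊥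
        single {w′} {a} (pt-w , others) = by-cases
          where
          w≤w′ : w ℕ.≤ w′
          w≤w′ = weight≥⇒≤ pt-w (polyWeight≥-≈ {p = g} {p ⊠ t} (ℚ[s].≈-sym pt≈g) g-weight a)
          other : ∀ e → e ≢ a → ¬ Weight≡ w e (coefficient g e)
          other e e≢ end = ℕ.<-irrefl refl (ℕ.≤-trans (weight≥⇒≤ end
            (subst (Weight≥ (suc w′) e) (ℚ[s].≈⇒coefficients pt≈g e) (others e e≢))) w≤w′)
          by-cases : Dec (0 ≡ a) → ⊥
          by-cases (no 0≢a)  = other 0 0≢a bottom
          by-cases (yes 0≡a) = other d (λ d≡a → ℕ.≢-nonZero⁻¹ d (trans d≡a (sym 0≡a))) top

    -- The end terms s^d and 2ʰ both have the least weight h d. Instead of Gauss's lemma, the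
    -- factors are multiplied by integers c and c′ that clear their denominators; the product
    -- becomes c c′ f, and all weights shift by that of c c′, so the two ends still tie.
    irreducible : Coprime h d → ∀ f → PolyWeight≥ 0 (h ℕ.* d) f → coefficient f d ≡ 1ℚ → coefficient f 0 ≡ int (+ (2 ^ h)) →
      ∀ p t → length p ℕ.≤ d → length t ℕ.≤ d → ¬ p ⊠ t ℚ[s].≈ f
    irreducible h⊥d f f-weight f-top f-bottom p t p-len t-len pt≈f =
      clear (clear-denominators p) (clear-denominators t)
      where
      scaled-integral : ∀ c q → Integral (constant c ⊠ q) → Integral (scale c q)
      scaled-integral c q q-int e with q-int e
      ... | z , eq = z , trans (ℚ[s].≈⇒coefficients (ℚ[s].scale-≈ c q) e) eq
      scaled-length : ∀ c q → length q ℕ.≤ d → length (scale c q) ℕ.≤ d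
      scaled-length c q = ℕ.≤-trans (ℕ.≤-reflexive (length-map (c ℚ.*_) q))
      scaled-product : ∀ c c′ → scale c p ⊠ scale c′ t ℚ[s].≈ constant (c ℚ.* c′) ⊠ f
      scaled-product c c′ = ≈-trans (*-cong (scale-≈ c p) (scale-≈ c′ t)) (≈-trans
        (solve 4 (λ c p c′ t → (c :* p) :* (c′ :* t) := (c :* c′) :* (p :* t)) ≈-refl (constant c) p (constant c′) t)
        (*-cong (≈-sym (constant-* c c′)) pt≈f))
        where open ℚ[s]
      clear : (∃[ c ] c ≢ + 0 × Integral (constant (int c) ⊠ p)) → (∃[ c ] c ≢ + 0 × Integral (constant (int c) ⊠ t)) → ⊥
      clear (c , c≢0 , p-int) (c′ , c′≢0 , t-int) = ends (weight≡-exists {0} c≢0) (weight≡-exists {0} c′≢0)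
        where
        ends : ∃[ w ] Weight≡ w 0 (int c) → ∃[ w ] Weight≡ w 0 (int c′) → ⊥
        ends (w , c-w) (w′ , c′-w) = product-ends h⊥d (scale (int c) p) (scale (int c′) t)
            (scaled-length (int c) p p-len) (scaled-length (int c′) t t-len)
            (scaled-integral (int c) p p-int) (scaled-integral (int c′) t t-int)
            (constant (int c ℚ.* int c′) ⊠ f) (scaled-product (int c) (int c′))
            (polyWeight≥-⊠ (constant (int c ℚ.* int c′)) f (polyWeight≥-constant (weight≡⇒≥ cc′-w)) f-weight)
            (end (weight≡ h (+ 0) (trans f-bottom (cong int (sym (ℤ.*-identityʳ (+ (2 ^ h))))))
              (sym (trans (cong (h ℕ.* d ℕ.+_) (ℕ.*-zeroʳ h)) (ℕ.+-identityʳ _)))))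
            (end (weight≡ 0 (+ 0) f-top refl))
          where
          cc′-w : Weight≡ (w ℕ.+ w′) 0 (int c ℚ.* int c′)
          cc′-w = weight≡-* c-w c′-w
          end : ∀ {e} → Weight≡ (h ℕ.* d) e (coefficient f e) →
                Weight≡ (w ℕ.+ w′ ℕ.+ h ℕ.* d) e (coefficient (constant (int c ℚ.* int c′) ⊠ f) e)
          end {e} g = subst (Weight≡ _ e) (sym (coefficient-constant-⊠ (int c ℚ.* int c′) f e)) (weight≡-* cc′-w g)

-- Iterated duplication on `E_Θ` in homogeneous coordinates.

module Doubling where

  open AlgebraSolver
  open GroupLaw
  open import Algebra.Bundles using (CommutativeRing)
  open import Data.Integer.Base using (+_)
  open import Data.Nat.Base as ℕ using (ℕ; zero; suc)
  import Data.Nat.Properties as ℕ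
  open import Data.Product.Base using (Σ-syntax; ∃-syntax; _×_; _,_; proj₁; proj₂)
  open import Data.Rational.Base as ℚ using (ℚ; 0ℚ; 1ℚ)
  open import Level using (0ℓ)
  open import Relation.Nullary using (¬_; yes; no)
  open import Relation.Binary.PropositionalEquality as ≡ using (_≡_)
  open import Algebra.Morphism.Structures using (module RingMorphisms)
  import Data.Rational.Properties as ℚ

  2ℚ 4ℚ 8ℚ 16ℚ : ℚ
  2ℚ = + 2 ℚ./ 1
  4ℚ = + 4 ℚ./ 1
  8ℚ = + 8 ℚ./ 1
  16ℚ = + 16 ℚ./ 1

  -- On E_Θ with Θ = τ / t, doubling takes the abscissa N / D to N′ / D′.  Since
  -- N′ + D′ = q², it ends at the point of abscissa -1 exactly when q vanishes.
  module Iteration (R : CommutativeRing 0ℓ 0ℓ) (ι : ℚ → CommutativeRing.Carrier R)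
                   (t τ : CommutativeRing.Carrier R) where
    open CommutativeRing R

    -- For x = N / D, the duplication formula of `E_Θ` has b₂ = (2 + Θ)², b₄ = Θ (2 + Θ), b₆ = Θ²
    -- and b₈ = 0. Its denominator 4 x³ + b₂ x² + 2 b₄ x + b₆ is (x + 1) (4 x² + (4 Θ + Θ²) x + Θ²),
    -- the second factor being `V`, and `q` is x² + 2 x + Θ; all are multiplied by powers of t and
    -- D.
    q V N′ D′ : Carrier → Carrier → Carrier
    q N D  = t * (N * N) + ι 2ℚ * (t * (N * D)) + τ * (D * D)
    V N D  = ι 4ℚ * (t * t * (N * N)) + (ι 4ℚ * (τ * t) + τ * τ) * (N * D) + τ * τ * (D * D)
    N′ N D = N * (t * t * (N * (N * N)) - (τ * (ι 2ℚ * t + τ) * (N * (D * D)) + ι 2ℚ * (τ * τ * (D * (D * D)))))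
    D′ N D = D * (N + D) * V N D

    iterate : ℕ → Carrier → Carrier → Carrier × Carrier
    iterate zero    N D = N , D
    iterate (suc k) N D = iterate k (N′ N D) (D′ N D)

  module DoublingTower (F : NumberField) (t τ : NumberField.Carrier F) where
    open NumberField F
    open NumberFieldProperties F
    open TwoTorsionCurves F
    open Iteration commutativeRing ι t τ

    -- In the coordinate Z = 4 t² (x + 1), E_Θ is a twist of Y² = Z³ + α Z² + β Z.
    α β : Carrier
    α = τ * τ + ι 4ℚ * (τ * t) - ι 8ℚ * (t * t)
    β = ι 16ℚ * (t * t * t * (t - τ))

    private
      :α :β : ∀ {n} (t τ : Polynomial n) → Polynomial n
      :α t τ = τ :* τ :+ con 4ℚ :* (τ :* t) :- con 8ℚ :* (t :* t)
      :β t τ = con 16ℚ :* (t :* t :* t :* (t :- τ))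

      :q :V :N′ :D′ : ∀ {n} (t τ N D : Polynomial n) → Polynomial n
      :q t τ N D  = t :* (N :* N) :+ con 2ℚ :* (t :* (N :* D)) :+ τ :* (D :* D)
      :V t τ N D  = con 4ℚ :* (t :* t :* (N :* N)) :+ (con 4ℚ :* (τ :* t) :+ τ :* τ) :* (N :* D) :+ τ :* τ :* (D :* D)
      :N′ t τ N D = N :* (t :* t :* (N :* (N :* N)) :- (τ :* (con 2ℚ :* t :+ τ) :* (N :* (D :* D)) :+ con 2ℚ :* (τ :* τ :* (D :* (D :* D)))))
      :D′ t τ N D = D :* (N :+ D) :* :V t τ N D

      :z : ∀ {n} (t n′ : Polynomial n) → Polynomial n
      :z t n = con 4ℚ :* (t :* t) :* (n :+ con 1ℚ)

    disc≈ : α * α - (β + β + (β + β)) ≈ τ * (τ * τ) * (τ + ι 8ℚ * t)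
    disc≈ = solve 2 (λ t τ → :α t τ :* :α t τ :- (:β t τ :+ :β t τ :+ (:β t τ :+ :β t τ)) :=
      τ :* (τ :* τ) :* (τ :+ con 8ℚ :* t)) refl t τ

    V-cong : ∀ {N N* D} → N ≈ N* → V N D ≈ V N* D
    V-cong e = +-congʳ (+-cong (*-congˡ (*-congˡ (*-cong e e))) (*-congˡ (*-congʳ e)))

    N′-cong : ∀ {N N* D} → N ≈ N* → N′ N D ≈ N′ N* D
    N′-cong e = *-cong e (+-cong (*-congˡ (*-cong e (*-cong e e))) (-‿cong (+-congʳ (*-congˡ (*-congʳ e)))))

    D′-cong : ∀ {N N* D} → N ≈ N* → D′ N D ≈ D′ N* D
    D′-cong e = *-cong (*-congˡ (+-congʳ e)) (V-cong e)

    q²≈N′+D′ : ∀ N D → N′ N D + D′ N D ≈ q N D * q N D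
    q²≈N′+D′ N D = solve 4 (λ t τ N D → :N′ t τ N D :+ :D′ t τ N D := :q t τ N D :* :q t τ N D) refl t τ N D

    abscissa : Carrier → Carrier
    abscissa n = ι 4ℚ * (t * t) * (n + ι 1ℚ)

    ι≉0 : ∀ {c} → ¬ c ≡ 0ℚ → ¬ ι c ≈ 0#
    ι≉0 {c} c≢0 ιc≈0 = 1≉0 (trans (sym (1#-homo)) (trans (reflexive (≡.cong ι (≡.sym (ℚ.*-inverseʳ c))))
      (trans (*-homo c (ℚ.1/ c)) (trans (*-congʳ ιc≈0) (zeroˡ _)))))
      where
      open RingMorphisms.IsRingHomomorphism ι-hom using (1#-homo; *-homo)
      instance
        c≠0 : ℚ.NonZero c
        c≠0 = ℚ.≢-nonZero c≢0

    -- The discriminant of `E_Θ` is Θ³ (Θ - 1)² (Θ + 8), so besides t = 0 these exclude exactly the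
    -- singular members.
    module _ (t≉0 : ¬ t ≈ 0#) (t-τ≉0 : ¬ t - τ ≈ 0#) (τ≉0 : ¬ τ ≈ 0#) (τ+8t≉0 : ¬ τ + ι 8ℚ * t ≈ 0#) where

      β≉0 : ¬ β ≈ 0#
      β≉0 = x≉0∧y≉0⇒x*y≉0 (ι≉0 λ ()) (x≉0∧y≉0⇒x*y≉0 (x≉0∧y≉0⇒x*y≉0 (x≉0∧y≉0⇒x*y≉0 t≉0 t≉0) t≉0) t-τ≉0)

      disc≉0 : ¬ α * α - (β + β + (β + β)) ≈ 0#
      disc≉0 e = x≉0∧y≉0⇒x*y≉0 (x≉0∧y≉0⇒x*y≉0 τ≉0 (x≉0∧y≉0⇒x*y≉0 τ≉0 τ≉0)) τ+8t≉0 (trans (sym disc≈) e)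

      N+D≉0 : ∀ {N D} → q N D ≈ 0# → ¬ D ≈ 0# → ¬ N + D ≈ 0#
      N+D≉0 {N} {D} q≈0 D≉0 e = x≉0∧y≉0⇒x*y≉0 t-τ≉0 (x≉0∧y≉0⇒x*y≉0 D≉0 D≉0)
        (trans (solve 4 (λ t τ N D → (t :- τ) :* (D :* D) := :- :q t τ N D :+ t :* (N :+ D) :* (N :+ D)) refl t τ N D)
          (trans (x+0*y≈x e) (trans (-‿cong q≈0) ε⁻¹≈ε)))

      -- In the coordinate Z, up to factors 16 t³ and 4 t², `q` is Z² - β D² and `V` is Z² + α Z D +
      -- β D². Their resultant is, up to sign, β (α² - 4 β) times a power of D; the identity below
      -- exhibits it as a combination of the two.
      V≉0 : ∀ {N D} → q N D ≈ 0# → ¬ D ≈ 0# → ¬ V N D ≈ 0#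
      V≉0 {N} {D} q≈0 D≉0 V≈0 = x≉0∧y≉0⇒x*y≉0 (x≉0∧y≉0⇒x*y≉0 β≉0 disc≉0)
          (x≉0∧y≉0⇒x*y≉0 (x≉0∧y≉0⇒x*y≉0 D≉0 D≉0) (x≉0∧y≉0⇒x*y≉0 D≉0 D≉0))
        (trans (solve 4 (λ α β Z D → let V = Z :* Z :+ α :* Z :* D :+ β :* (D :* D) ; q = Z :* Z :- β :* (D :* D) in
           β :* (α :* α :- (β :+ β :+ (β :+ β))) :* (D :* D :* (D :* D)) :=
           (α :* Z :- con 2ℚ :* β :* D) :* D :* V :+
           (:- ((α :* Z :- con 2ℚ :* β :* D) :* D) :- α :* α :* (D :* D)) :* q) refl α β Z D)
          (trans (x+0*y≈x Z²≈) (trans (*-congˡ quadratic≈) (zeroʳ _))))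
        where
        Z : Carrier
        Z = ι 4ℚ * (t * t) * (N + D)
        quadratic≈ : Z * Z + α * Z * D + β * (D * D) ≈ 0#
        quadratic≈ = trans (solve 4 (λ t τ N D → let Z = con 4ℚ :* (t :* t) :* (N :+ D) in
          Z :* Z :+ :α t τ :* Z :* D :+ :β t τ :* (D :* D) := con 4ℚ :* (t :* t) :* :V t τ N D) refl t τ N D)
          (trans (*-congˡ V≈0) (zeroʳ _))
        Z²≈ : Z * Z - β * (D * D) ≈ 0#
        Z²≈ = trans (solve 4 (λ t τ N D → let Z = con 4ℚ :* (t :* t) :* (N :+ D) in
          Z :* Z :- :β t τ :* (D :* D) := con 16ℚ :* (t :* t :* t) :* :q t τ N D) refl t τ N D)
          (trans (*-congˡ q≈0) (zeroʳ _))

      D′≉0 : ∀ {N D} → q N D ≈ 0# → ¬ D ≈ 0# → ¬ D′ N D ≈ 0#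
      D′≉0 q≈0 D≉0 = x≉0∧y≉0⇒x*y≉0 (x≉0∧y≉0⇒x*y≉0 D≉0 (N+D≉0 q≈0 D≉0)) (V≉0 q≈0 D≉0)

      q≈0∧D≈0⇒N≈0 : ∀ {N D} → q N D ≈ 0# → D ≈ 0# → N ≈ 0#
      q≈0∧D≈0⇒N≈0 {N} {D} q≈0 D≈0 = x*x≈0⇒x≈0 (x*y≈0⇒y≈0 t≉0 (trans
        (solve 4 (λ t τ N D → t :* (N :* N) := :q t τ N D :+ (:- (con 2ℚ :* (t :* N)) :- τ :* D) :* D) refl t τ N D)
        (trans (x+0*y≈x D≈0) q≈0)))

      -- If both vanish, then so does q² = N′ + D′. But q = 0 forces N = 0 when D = 0, and D′ ≠ 0
      -- when D ≠ 0.
      not-both-zero : ∀ {N D} → ¬ (N ≈ 0# × D ≈ 0#) → ¬ (N′ N D ≈ 0# × D′ N D ≈ 0#)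
      not-both-zero {N} {D} ≉0 (N′≈0 , D′≈0) with ≈0? D
      ... | yes D≈0 = ≉0 (q≈0∧D≈0⇒N≈0 q≈0 D≈0 , D≈0)
        where q≈0 = x*x≈0⇒x≈0 (trans (sym (q²≈N′+D′ N D)) (trans (+-cong N′≈0 D′≈0) (+-identityˡ 0#)))
      ... | no D≉0 = D′≉0 q≈0 D≉0 D′≈0
        where q≈0 = x*x≈0⇒x≈0 (trans (sym (q²≈N′+D′ N D)) (trans (+-cong N′≈0 D′≈0) (+-identityˡ 0#)))

      D≈0⇒D′≈0 : ∀ {N D} → D ≈ 0# → D′ N D ≈ 0#
      D≈0⇒D′≈0 D≈0 = trans (*-congʳ (trans (*-congʳ D≈0) (zeroˡ _))) (zeroˡ _)

      final-D≉0 : ∀ k {N D} → ¬ (N ≈ 0# × D ≈ 0#) → let (Nₖ , Dₖ) = iterate k N D in q Nₖ Dₖ ≈ 0# → ¬ Dₖ ≈ 0#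
      final-D≉0 zero    ≉0 q≈0 D≈0 = ≉0 (q≈0∧D≈0⇒N≈0 q≈0 D≈0 , D≈0)
      final-D≉0 (suc k) ≉0 q≈0     = final-D≉0 k (not-both-zero ≉0) q≈0

      -- `D′` is a multiple of `D`, so a non-zero last denominator certifies every earlier one; no
      -- intermediate multiple of the point has to be examined.
      D≉0-before : ∀ k {N D} → ¬ proj₂ (iterate k N D) ≈ 0# → ¬ D ≈ 0#
      D≉0-before zero    Dₖ≉0 = Dₖ≉0
      D≉0-before (suc k) Dₖ≉0 D≈0 = D≉0-before k Dₖ≉0 (D≈0⇒D′≈0 D≈0)

      -- `N′` and `D′` are homogeneous of degree 4 in N and D, which reduces everything to n and 1.
      -- There the cubic in Z is 16 t⁴ D′ and Z² - β is 16 t³ q, so the abscissa formula comes down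
      -- to N′ + D′ = q².
      doubling-step : ∀ {N D n n₁} → ¬ D ≈ 0# → ¬ D′ N D ≈ 0# → n * D ≈ N → n₁ * D′ N D ≈ N′ N D →
        let c = cubic α β (abscissa n) in
        ¬ c ≈ 0# × (c + c + (c + c)) * abscissa n₁ ≈ (abscissa n * abscissa n - β) * (abscissa n * abscissa n - β)
      doubling-step {N} {D} {n} {n₁} D≉0 D′≉0 nD≈N e = c≉0 , doubled
        where
        c δ ν D⁴ : Carrier
        c = cubic α β (abscissa n)
        δ = D′ n (ι 1ℚ)
        ν = N′ n (ι 1ℚ)
        D⁴ = D * D * (D * D)
        D′≈D⁴δ : D′ N D ≈ D⁴ * δ
        D′≈D⁴δ = trans (D′-cong (sym nD≈N))
          (solve 4 (λ t τ n D → :D′ t τ (n :* D) D := D :* D :* (D :* D) :* :D′ t τ n (con 1ℚ)) refl t τ n D)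
        N′≈D⁴ν : N′ N D ≈ D⁴ * ν
        N′≈D⁴ν = trans (N′-cong (sym nD≈N))
          (solve 4 (λ t τ n D → :N′ t τ (n :* D) D := D :* D :* (D :* D) :* :N′ t τ n (con 1ℚ)) refl t τ n D)
        c≈ : c ≈ ι 16ℚ * (t * t * (t * t)) * δ
        c≈ = solve 3 (λ t τ n → :cubic (:α t τ) (:β t τ) (:z t n) := con 16ℚ :* (t :* t :* (t :* t)) :* :D′ t τ n (con 1ℚ)) refl t τ n
        δ≉0 : ¬ δ ≈ 0#
        δ≉0 δ≈0 = D′≉0 (trans D′≈D⁴δ (trans (*-congˡ δ≈0) (zeroʳ D⁴)))
        c≉0 : ¬ c ≈ 0#
        c≉0 c≈0 = x≉0∧y≉0⇒x*y≉0 (x≉0∧y≉0⇒x*y≉0 (ι≉0 λ ()) (x≉0∧y≉0⇒x*y≉0 (x≉0∧y≉0⇒x*y≉0 t≉0 t≉0) (x≉0∧y≉0⇒x*y≉0 t≉0 t≉0))) δ≉0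
          (trans (sym c≈) c≈0)
        n₁δ≈ν : n₁ * δ ≈ ν
        n₁δ≈ν = *-cancelˡ-≉0 (x≉0∧y≉0⇒x*y≉0 (x≉0∧y≉0⇒x*y≉0 D≉0 D≉0) (x≉0∧y≉0⇒x*y≉0 D≉0 D≉0))
          (trans (solve 3 (λ a b c → a :* (b :* c) := b :* (a :* c)) refl D⁴ n₁ δ)
            (trans (*-congˡ (sym D′≈D⁴δ)) (trans e N′≈D⁴ν)))
        Q : Carrier
        Q = q n (ι 1ℚ)
        ν+δ≈Q² : ν + δ ≈ Q * Q
        ν+δ≈Q² = q²≈N′+D′ n (ι 1ℚ)
        16t³Q≈ : abscissa n * abscissa n - β ≈ ι 16ℚ * (t * t * t) * Q
        16t³Q≈ = solve 3 (λ t τ n → :z t n :* :z t n :- :β t τ := con 16ℚ :* (t :* t :* t) :* :q t τ n (con 1ℚ)) refl t τ n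
        doubled : (c + c + (c + c)) * abscissa n₁ ≈ (abscissa n * abscissa n - β) * (abscissa n * abscissa n - β)
        doubled = trans (*-congʳ (+-cong (+-cong c≈ c≈) (+-cong c≈ c≈))) (trans
          (solve 3 (λ t n₁ δ → let x = con 16ℚ :* (t :* t :* (t :* t)) :* δ in
             (x :+ x :+ (x :+ x)) :* :z t n₁ := con 16ℚ :* con 16ℚ :* (t :* t :* t :* (t :* t :* t)) :* (n₁ :* δ :+ δ)) refl t n₁ δ)
          (trans (*-congˡ (trans (+-congʳ n₁δ≈ν) ν+δ≈Q²))
          (trans (solve 2 (λ t Q → con 16ℚ :* con 16ℚ :* (t :* t :* t :* (t :* t :* t)) :* (Q :* Q) :=
             con 16ℚ :* (t :* t :* t) :* Q :* (con 16ℚ :* (t :* t :* t) :* Q)) refl t Q)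
            (sym (*-cong 16t³Q≈ 16t³Q≈)))))

      chain : ∀ k {N D n} → ¬ proj₂ (iterate k N D) ≈ 0# →
              (let (Nₖ , Dₖ) = iterate k N D in Nₖ + Dₖ ≈ 0#) → n * D ≈ N → DoublingChain α β k (abscissa n)
      chain zero {N} {D} {n} D≉0 e nD≈N = stop (trans (*-congˡ (x*y≈0⇒y≈0 D≉0 (trans
          (solve 2 (λ n D → D :* (n :+ con 1ℚ) := n :* D :+ D) refl n D) (trans (+-congʳ nD≈N) e)))) (zeroʳ _))
      chain (suc k) {N} {D} {n} Dₖ≉0 e nD≈N = via (quotient (N′ N D) (D′ N D) (D≉0-before k Dₖ≉0))
        where
        via : (∃[ n₁ ] n₁ * D′ N D ≈ N′ N D) → DoublingChain α β (suc k) (abscissa n)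
        via (n₁ , n₁D′≈N′) = step (proj₁ doubled) (proj₂ doubled) (chain k Dₖ≉0 e n₁D′≈N′)
          where doubled = doubling-step (D≉0-before (suc k) {N} {D} Dₖ≉0) (D≉0-before k Dₖ≉0) nD≈N n₁D′≈N′

      iterate-suc : ∀ k N D → let (Nₖ , Dₖ) = iterate k N D in
        iterate (suc k) N D ≡ (N′ Nₖ Dₖ , D′ Nₖ Dₖ)
      iterate-suc zero    N D = ≡.refl
      iterate-suc (suc k) N D = iterate-suc k (N′ N D) (D′ N D)

      tower⇒torsion : ∀ k {N D} → ¬ D ≈ 0# → (let (Nₖ , Dₖ) = iterate k N D in q Nₖ Dₖ ≈ 0#) →
        ∀ {l} → l ℕ.≤ suc (suc k) → Σ[ E ∈ EllipticCurve F ] AtLeast l (torsionPoints E)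
      tower⇒torsion k {N} {D} D≉0 q≈0 = via (quotient N D D≉0)
        where
        Nₖ Dₖ : Carrier
        Nₖ = proj₁ (iterate k N D)
        Dₖ = proj₂ (iterate k N D)
        last-D≉0 : ∀ {p} → p ≡ (N′ Nₖ Dₖ , D′ Nₖ Dₖ) → ¬ proj₂ p ≈ 0#
        last-D≉0 ≡.refl = D′≉0 q≈0 (final-D≉0 k (λ z → D≉0 (proj₂ z)) q≈0)
        last-zero : ∀ {p} → p ≡ (N′ Nₖ Dₖ , D′ Nₖ Dₖ) → proj₁ p + proj₂ p ≈ 0#
        last-zero ≡.refl = trans (q²≈N′+D′ Nₖ Dₖ) (trans (*-congʳ q≈0) (zeroˡ _))
        via : (∃[ n ] n * D ≈ N) → ∀ {l} → l ℕ.≤ suc (suc k) → Σ[ E ∈ EllipticCurve F ] AtLeast l (torsionPoints E)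
        via (n , nD≈N) = chain⇒torsion β≉0 disc≉0
          (chain (suc k) (last-D≉0 (iterate-suc k N D)) (last-zero (iterate-suc k N D)) nD≈N)

-- Degree, constant coefficient and weight of the iterated polynomial.

module DoublingPolynomials where

  open PolynomialRings
  open DyadicWeights
  open Doubling
  open import Data.Integer.Base using (+_)
  import Data.Integer.Properties as ℤ
  open import Data.List.Base using ([]; _∷_)
  open import Data.Nat.Base as ℕ using (ℕ; zero; suc; _^_)
  import Data.Nat.Properties as ℕ
  import Data.Nat.Solver as ℕ
  open import Data.Product.Base using (Σ-syntax; _×_; _,_)
  open import Data.Rational.Base as ℚ using (ℚ; 0ℚ)
  import Data.Rational.Properties as ℚ
  open import Relation.Binary.PropositionalEquality using (_≡_; refl; cong; cong₂; sym; trans)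

  -- X₃ r = (4ʳ - 1) / 3, and (M r , c r) is the bidegree in (x , Θ) of the polynomial q
  -- after r doublings.
  X₃ : ℕ → ℕ
  X₃ zero    = 0
  X₃ (suc r) = 4 ℕ.* X₃ r ℕ.+ 1

  c M : ℕ → ℕ
  c r = 4 ℕ.* X₃ r ℕ.+ 1
  M r = 6 ℕ.* X₃ r ℕ.+ 2

  -- One recurrence serves three times: for the degree of N (from j and i), for the exponent of 2 in
  -- the constant coefficient of D (from b and a), and for the weight bound of D (from b d and a d).
  -- The closing x + 2 y in `affine-iterate-closed` is the effect of `q`.
  affine-iterate : ℕ → ℕ → ℕ → ℕ
  affine-iterate x zero    y = y
  affine-iterate x (suc r) y = affine-iterate x r (2 ℕ.* x ℕ.+ 4 ℕ.* y)

  affine-iterate-closed : ∀ x r y → x ℕ.+ 2 ℕ.* affine-iterate x r y ≡ x ℕ.* c r ℕ.+ y ℕ.* M r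
  affine-iterate-closed x zero    y = solve 2 (λ x y → x :+ con 2 :* y := x :* con 1 :+ y :* con 2) refl x y
    where open ℕ.+-*-Solver
  affine-iterate-closed x (suc r) y = trans (affine-iterate-closed x r (2 ℕ.* x ℕ.+ 4 ℕ.* y))
    (solve 3 (λ x y z → x :* (con 4 :* z :+ con 1) :+ (con 2 :* x :+ con 4 :* y) :* (con 6 :* z :+ con 2) :=
       x :* (con 4 :* (con 4 :* z :+ con 1) :+ con 1) :+ y :* (con 6 :* (con 4 :* z :+ con 1) :+ con 2)) refl x y (X₃ r))
    where open ℕ.+-*-Solver

  record Below (n : ℕ) (p : Poly) : Set where
    constructor below
    field vanishes : ∀ e → n ℕ.≤ e → coefficient p e ≡ 0ℚ
  open Below

  below-≈ : ∀ {n p q} → p ℚ[s].≈ q → Below n p → Below n q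
  below-≈ p≈q p< = below λ e n≤e → trans (sym (ℚ[s].≈⇒coefficients p≈q e)) (vanishes p< e n≤e)

  below-mono : ∀ {m n p} → m ℕ.≤ n → Below m p → Below n p
  below-mono m≤n p< = below λ e n≤e → vanishes p< e (ℕ.≤-trans m≤n n≤e)

  below-⊞ : ∀ {n} p q → Below n p → Below n q → Below n (p ⊞ q)
  below-⊞ p q p< q< = below λ e n≤e → trans (coefficient-⊞ p q e)
    (trans (cong₂ ℚ._+_ (vanishes p< e n≤e) (vanishes q< e n≤e)) (ℚ.+-identityˡ 0ℚ))

  below-⊟ : ∀ {n} p → Below n p → Below n (⊟ p)
  below-⊟ p p< = below λ e n≤e → trans (coefficient-⊟ p e) (cong (λ x → ℚ.- x) (vanishes p< e n≤e))

  below-⊠ : ∀ {m n} p q → Below (suc m) p → Below n q → Below (m ℕ.+ n) (p ⊠ q)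
  below-⊠ []      q p< q< = below λ e _ → refl
  below-⊠ {m} {n} (a ∷ p) q p< q< = below-⊞ (scale a q) (0ℚ ∷ p ⊠ q)
    (below λ e le → trans (coefficient-scale a q e) (trans (cong (a ℚ.*_) (vanishes q< e (ℕ.≤-trans (ℕ.m≤n+m n m) le))) (ℚ.*-zeroʳ a)))
    (below (shifted m (below λ e le → vanishes p< (suc e) (ℕ.s≤s le))))
    where
    shifted : ∀ m → Below m p → ∀ e → m ℕ.+ n ℕ.≤ e → coefficient (0ℚ ∷ p ⊠ q) e ≡ 0ℚ
    shifted _       p< zero    _          = refl
    shifted zero    p< (suc e) _          =
      ℚ[s].≈⇒coefficients (ℚ[s].*-congʳ {q} {p} {[]} (ℚ[s].coefficients⇒ (λ e → vanishes p< e ℕ.z≤n))) e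
    shifted (suc m) p< (suc e) (ℕ.s≤s le) = vanishes (below-⊠ p q p< q<) e le

  below-constant : ∀ q → Below 1 (constant q)
  below-constant q = below λ { (suc e) _ → refl }

  below-monomial : ∀ n → Below (suc n) (monomial n)
  below-monomial n = below λ e n<e → coefficient-monomial-≢ (ℕ.<⇒≢ n<e)

  Monic : ℕ → Poly → Set
  Monic n p = Σ[ r ∈ Poly ] Below n r × p ℚ[s].≈ monomial n ⊞ r

  monic⇒below : ∀ {n p} → Monic n p → Below (suc n) p
  monic⇒below {n} (r , r< , p≈) = below-≈ (ℚ[s].≈-sym p≈)
    (below-⊞ (monomial n) r (below-monomial n) (below-mono (ℕ.n≤1+n n) r<))

  monic-monomial : ∀ n → Monic n (monomial n)
  monic-monomial n = [] , below (λ e _ → refl) , ℚ[s].≈-sym (ℚ[s].≈-intro λ v i → trans (ℚ[s].act-⊞ (monomial n) [] v i) (ℚ.+-identityʳ _))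

  monic-⊞ : ∀ {n} p q → Monic n p → Below n q → Monic n (p ⊞ q)
  monic-⊞ {n} p q (r , r< , p≈) q< = r ⊞ q , below-⊞ r q r< q< , ≈-trans (+-congʳ {q} p≈)
    (solve 3 (λ m r q → m :+ r :+ q := m :+ (r :+ q)) ≈-refl (monomial n) r q)
    where open ℚ[s]

  monic-⊠ : ∀ {m n} p q → Monic m p → Monic n q → Monic (m ℕ.+ n) (p ⊠ q)
  monic-⊠ {m} {n} p q (r , r< , p≈) (r′ , r′< , q≈) = monomial m ⊠ r′ ⊞ (monomial n ⊠ r ⊞ r ⊠ r′) ,
    below-⊞ (monomial m ⊠ r′) (monomial n ⊠ r ⊞ r ⊠ r′) (below-⊠ (monomial m) r′ (below-monomial m) r′<)
      (below-⊞ (monomial n ⊠ r) (r ⊠ r′) (below-mono (ℕ.≤-reflexive (ℕ.+-comm n m)) (below-⊠ (monomial n) r (below-monomial n) r<))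
        (below-⊠ r r′ (below-mono (ℕ.n≤1+n m) r<) r′<)) ,
    ≈-trans (*-cong p≈ q≈) (≈-trans
      (solve 4 (λ s s′ r r′ → (s :+ r) :* (s′ :+ r′) := s :* s′ :+ (s :* r′ :+ (s′ :* r :+ r :* r′))) ≈-refl
        (monomial m) (monomial n) r r′)
      (+-congʳ {monomial m ⊠ r′ ⊞ (monomial n ⊠ r ⊞ r ⊠ r′)} (monomial-⊠ m n)))
    where open ℚ[s]

  monic-degree : ∀ {n n′ p} → n ≡ n′ → Monic n p → Monic n′ p
  monic-degree refl p = p

  coefficient-0-⊠ : ∀ p q → coefficient (p ⊠ q) 0 ≡ coefficient p 0 ℚ.* coefficient q 0
  coefficient-0-⊠ []      q = sym (ℚ.*-zeroˡ (coefficient q 0))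
  coefficient-0-⊠ (a ∷ p) q = trans (coefficient-⊞ (scale a q) (0ℚ ∷ p ⊠ q) 0)
    (trans (ℚ.+-identityʳ _) (coefficient-scale a q 0))

  2^ℚ : ℕ → ℚ
  2^ℚ n = int (+ (2 ^ n))

  2^ℚ-+ : ∀ m n → 2^ℚ m ℚ.* 2^ℚ n ≡ 2^ℚ (m ℕ.+ n)
  2^ℚ-+ m n = trans (sym (int-* (+ (2 ^ m)) (+ (2 ^ n)))) (cong int (sym (trans (cong +_ (ℕ.^-distribˡ-+-* 2 m n)) (ℤ.pos-* (2 ^ m) (2 ^ n)))))

  module TowerPolynomial (j b : ℕ) where
    t τ : Poly
    t = monomial j
    τ = constant (2^ℚ b)

    open Iteration ℚ[s].commutativeRing constant t τ public

    module _ {n : ℕ} {N D : Poly} (N-monic : Monic n N) (D-below : Below n D) where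
      private
        t< : Below (suc j) t
        t< = below-monomial j
        N< : Below (suc n) N
        N< = monic⇒below N-monic
        D< : Below (suc n) D
        D< = below-mono (ℕ.n≤1+n n) D-below
        const< : ∀ {m} q p → Below m p → Below m (constant q ⊠ p)
        const< q p = below-⊠ (constant q) p (below-constant q)

      -- The term t² N⁴ dominates, since every other one trades factors N or t for D or constants.
      N′-monic : Monic (2 ℕ.* j ℕ.+ 4 ℕ.* n) (N′ N D)
      N′-monic = monic-degree degree (monic-⊠ N _ N-monic (monic-⊞ (t ⊠ t ⊠ (N ⊠ (N ⊠ N))) _
          (monic-⊠ (t ⊠ t) (N ⊠ (N ⊠ N)) (monic-⊠ t t (monic-monomial j) (monic-monomial j))
            (monic-⊠ N (N ⊠ N) N-monic (monic-⊠ N N N-monic N-monic)))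
          (below-⊟ _ (below-⊞ (τ ⊠ (constant 2ℚ ⊠ t ⊞ τ) ⊠ (N ⊠ (D ⊠ D))) (constant 2ℚ ⊠ (τ ⊠ τ ⊠ (D ⊠ (D ⊠ D))))
            (below-mono (ℕ.+-monoˡ-≤ (n ℕ.+ (n ℕ.+ n)) (ℕ.m≤n+m j j)) (below-⊠ (τ ⊠ (constant 2ℚ ⊠ t ⊞ τ)) (N ⊠ (D ⊠ D))
              (const< (2^ℚ b) (constant 2ℚ ⊠ t ⊞ τ) (below-⊞ (constant 2ℚ ⊠ t) τ (const< 2ℚ t t<) (below-mono (ℕ.s≤s ℕ.z≤n) (below-constant _))))
              (below-⊠ N (D ⊠ D) N< (below-⊠ D D D< D-below))))
            (const< 2ℚ (τ ⊠ τ ⊠ (D ⊠ (D ⊠ D))) (below-mono (ℕ.m≤n+m (n ℕ.+ (n ℕ.+ n)) (j ℕ.+ j))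
              (below-⊠ (τ ⊠ τ) (D ⊠ (D ⊠ D)) (const< (2^ℚ b) τ (below-constant _)) (below-⊠ D (D ⊠ D) D< (below-⊠ D D D< D-below)))))))))
        where
        degree : n ℕ.+ (j ℕ.+ j ℕ.+ (n ℕ.+ (n ℕ.+ n))) ≡ 2 ℕ.* j ℕ.+ 4 ℕ.* n
        degree = solve 2 (λ j n → n :+ (j :+ j :+ (n :+ (n :+ n))) := con 2 :* j :+ con 4 :* n) refl j n
          where open ℕ.+-*-Solver

      D′-below : Below (2 ℕ.* j ℕ.+ 4 ℕ.* n) (D′ N D)
      -- D is moved to the end: it alone has a strict degree bound against n, and `below-⊠` takes
      -- its strict bound from the last factor.
      D′-below = below-mono (ℕ.≤-reflexive degree) (below-≈ {p = V N D ⊠ ((N ⊞ D) ⊠ D)} {D′ N D}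
          (solve 3 (λ V S D → V :* (S :* D) := D :* S :* V) ≈-refl (V N D) (N ⊞ D) D)
          (below-⊠ (V N D) ((N ⊞ D) ⊠ D) V< (below-⊠ (N ⊞ D) D (below-⊞ N D N< D<) D-below)))
        where
        open ℚ[s]
        open ℕ.+-*-Solver using () renaming (solve to solveℕ; con to con′; _:*_ to _✶_; _:+_ to _✚_; _:=_ to _≔_)
        degree : 2 ℕ.* j ℕ.+ 2 ℕ.* n ℕ.+ (n ℕ.+ n) ≡ 2 ℕ.* j ℕ.+ 4 ℕ.* n
        degree = solveℕ 2 (λ j n → con′ 2 ✶ j ✚ con′ 2 ✶ n ✚ (n ✚ n) ≔ con′ 2 ✶ j ✚ con′ 4 ✶ n) refl j n
        2j+2n : ℕ
        2j+2n = 2 ℕ.* j ℕ.+ 2 ℕ.* n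
        ND< : ∀ p q → Below (suc n) p → Below (suc n) q → Below (suc (n ℕ.+ n)) (p ⊠ q)
        ND< p q p< q< = below-mono (ℕ.≤-reflexive (ℕ.+-suc n n)) (below-⊠ p q p< q<)
        V< : Below (suc 2j+2n) (V N D)
        V< = below-⊞ (constant 4ℚ ⊠ (t ⊠ t ⊠ (N ⊠ N)) ⊞ (constant 4ℚ ⊠ (τ ⊠ t) ⊞ τ ⊠ τ) ⊠ (N ⊠ D)) (τ ⊠ τ ⊠ (D ⊠ D))
          (below-⊞ (constant 4ℚ ⊠ (t ⊠ t ⊠ (N ⊠ N))) ((constant 4ℚ ⊠ (τ ⊠ t) ⊞ τ ⊠ τ) ⊠ (N ⊠ D))
            (const< 4ℚ (t ⊠ t ⊠ (N ⊠ N)) (below-mono (ℕ.≤-reflexive eq) (below-⊠ (t ⊠ t) (N ⊠ N)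
              (below-mono (ℕ.≤-reflexive (ℕ.+-suc j j)) (below-⊠ t t t< t<)) (ND< N N N< N<))))
            (below-mono (ℕ.≤-trans (ℕ.+-monoˡ-≤ (suc (n ℕ.+ n)) (ℕ.m≤m+n j j)) (ℕ.≤-reflexive eq))
              (below-⊠ (constant 4ℚ ⊠ (τ ⊠ t) ⊞ τ ⊠ τ) (N ⊠ D)
                (below-⊞ (constant 4ℚ ⊠ (τ ⊠ t)) (τ ⊠ τ) (const< 4ℚ (τ ⊠ t) (const< (2^ℚ b) t t<)) (const< (2^ℚ b) τ (below-mono (ℕ.s≤s ℕ.z≤n) (below-constant _))))
                (ND< N D N< D<))))
          (below-mono (ℕ.≤-trans (ℕ.m≤n+m (suc (n ℕ.+ n)) (j ℕ.+ j)) (ℕ.≤-reflexive eq))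
            (below-⊠ (τ ⊠ τ) (D ⊠ D) (const< (2^ℚ b) τ (below-constant _)) (ND< D D D< D<)))
          where
          eq : j ℕ.+ j ℕ.+ suc (n ℕ.+ n) ≡ suc 2j+2n
          eq = solveℕ 2 (λ j n → j ✚ j ✚ (con′ 1 ✚ (n ✚ n)) ≔ con′ 1 ✚ (con′ 2 ✶ j ✚ con′ 2 ✶ n)) refl j n

      q-monic : Monic (j ℕ.+ 2 ℕ.* n) (q N D)
      q-monic = monic-degree (cong (j ℕ.+_) (cong (n ℕ.+_) (sym (ℕ.+-identityʳ n))))
        (monic-⊞ (t ⊠ (N ⊠ N) ⊞ constant 2ℚ ⊠ (t ⊠ (N ⊠ D))) (τ ⊠ (D ⊠ D))
          (monic-⊞ (t ⊠ (N ⊠ N)) (constant 2ℚ ⊠ (t ⊠ (N ⊠ D))) (monic-⊠ t (N ⊠ N) (monic-monomial j) (monic-⊠ N N N-monic N-monic))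
            (const< 2ℚ (t ⊠ (N ⊠ D)) (below-⊠ t (N ⊠ D) t< (below-⊠ N D N< D-below))))
          (below-mono (ℕ.m≤n+m (n ℕ.+ n) j) (const< (2^ℚ b) (D ⊠ D) (below-⊠ D D D< D-below))))

    iterate-monic : ∀ r {n N D} → Monic n N → Below n D →
      let (Nᵣ , Dᵣ) = iterate r N D in Monic (j ℕ.+ 2 ℕ.* affine-iterate j r n) (q Nᵣ Dᵣ)
    iterate-monic zero    N-monic D-below = q-monic N-monic D-below
    iterate-monic (suc r) N-monic D-below = iterate-monic r (N′-monic N-monic D-below) (D′-below N-monic D-below)

    -- At s = 0 the monomial t vanishes, and N stays 0 because it divides `N′`. So D′ becomes τ² D⁴
    -- and q becomes τ D², pure powers of 2.
    iterate-constant : 1 ℕ.≤ j → ∀ r {e N D} → coefficient N 0 ≡ 0ℚ → coefficient D 0 ≡ 2^ℚ e →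
      let (Nᵣ , Dᵣ) = iterate r N D in coefficient (q Nᵣ Dᵣ) 0 ≡ 2^ℚ (b ℕ.+ 2 ℕ.* affine-iterate b r e)
    iterate-constant 1≤j zero {e} {N} {D} N₀ D₀ = trans (trans (coefficient-⊞ (t ⊠ (N ⊠ N) ⊞ constant 2ℚ ⊠ (t ⊠ (N ⊠ D))) (τ ⊠ (D ⊠ D)) 0)
        (cong₂ ℚ._+_ (trans (coefficient-⊞ (t ⊠ (N ⊠ N)) (constant 2ℚ ⊠ (t ⊠ (N ⊠ D))) 0)
           (cong₂ ℚ._+_ (t-multiple (N ⊠ N)) (trans (coefficient-0-⊠ (constant 2ℚ) (t ⊠ (N ⊠ D))) (trans (cong (2ℚ ℚ.*_) (t-multiple (N ⊠ D))) (ℚ.*-zeroʳ 2ℚ)))))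
         (trans (coefficient-0-⊠ τ (D ⊠ D)) (cong (2^ℚ b ℚ.*_) (trans (coefficient-0-⊠ D D) (cong₂ ℚ._*_ D₀ D₀))))))
      (trans (ℚ.+-identityˡ _) (trans (cong (2^ℚ b ℚ.*_) (2^ℚ-+ e e)) (trans (2^ℚ-+ b (e ℕ.+ e))
        (cong 2^ℚ (cong (b ℕ.+_) (cong (e ℕ.+_) (sym (ℕ.+-identityʳ e))))))))
      where
      t-multiple : ∀ p → coefficient (t ⊠ p) 0 ≡ 0ℚ
      t-multiple p = trans (coefficient-0-⊠ t p) (trans (cong (ℚ._* coefficient p 0) (coefficient-monomial-< 1≤j)) (ℚ.*-zeroˡ (coefficient p 0)))
    iterate-constant 1≤j (suc r) {e} {N} {D} N₀ D₀ = iterate-constant 1≤j r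
        (zero-multiple N _ N₀)
        (trans (coefficient-0-⊠ (D ⊠ (N ⊞ D)) (V N D)) (trans (cong₂ ℚ._*_
            (trans (coefficient-0-⊠ D (N ⊞ D)) (cong₂ ℚ._*_ D₀ N+D₀)) V₀)
          (trans (cong₂ ℚ._*_ (2^ℚ-+ e e) (cong₂ ℚ._*_ (2^ℚ-+ b b) (2^ℚ-+ e e)))
          (trans (cong (2^ℚ (e ℕ.+ e) ℚ.*_) (2^ℚ-+ (b ℕ.+ b) (e ℕ.+ e))) (trans (2^ℚ-+ (e ℕ.+ e) (b ℕ.+ b ℕ.+ (e ℕ.+ e)))
            (cong 2^ℚ (solve 2 (λ b e → e :+ e :+ (b :+ b :+ (e :+ e)) := con 2 :* b :+ con 4 :* e) refl b e)))))))
      where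
      open ℕ.+-*-Solver
      zero-multiple : ∀ p q → coefficient p 0 ≡ 0ℚ → coefficient (p ⊠ q) 0 ≡ 0ℚ
      zero-multiple p q p₀ = trans (coefficient-0-⊠ p q) (trans (cong (ℚ._* coefficient q 0) p₀) (ℚ.*-zeroˡ (coefficient q 0)))
      N+D₀ : coefficient (N ⊞ D) 0 ≡ 2^ℚ e
      N+D₀ = trans (coefficient-⊞ N D 0) (trans (cong₂ ℚ._+_ N₀ D₀) (ℚ.+-identityˡ (2^ℚ e)))
      V₀ : coefficient (V N D) 0 ≡ 2^ℚ b ℚ.* 2^ℚ b ℚ.* (2^ℚ e ℚ.* 2^ℚ e)
      V₀ = trans (coefficient-⊞ (constant 4ℚ ⊠ (t ⊠ t ⊠ (N ⊠ N)) ⊞ (constant 4ℚ ⊠ (τ ⊠ t) ⊞ τ ⊠ τ) ⊠ (N ⊠ D)) (τ ⊠ τ ⊠ (D ⊠ D)) 0)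
        (trans (cong₂ ℚ._+_ (trans (coefficient-⊞ (constant 4ℚ ⊠ (t ⊠ t ⊠ (N ⊠ N))) ((constant 4ℚ ⊠ (τ ⊠ t) ⊞ τ ⊠ τ) ⊠ (N ⊠ D)) 0)
            (cong₂ ℚ._+_
              (trans (coefficient-0-⊠ (constant 4ℚ) (t ⊠ t ⊠ (N ⊠ N))) (trans (cong (4ℚ ℚ.*_)
                (zero-multiple (t ⊠ t) (N ⊠ N) (zero-multiple t t (coefficient-monomial-< 1≤j)))) (ℚ.*-zeroʳ 4ℚ)))
              (trans (coefficient-0-⊠ (constant 4ℚ ⊠ (τ ⊠ t) ⊞ τ ⊠ τ) (N ⊠ D)) (trans (cong (coefficient (constant 4ℚ ⊠ (τ ⊠ t) ⊞ τ ⊠ τ) 0 ℚ.*_)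
                (zero-multiple N D N₀)) (ℚ.*-zeroʳ (coefficient (constant 4ℚ ⊠ (τ ⊠ t) ⊞ τ ⊠ τ) 0))))))
          (trans (coefficient-0-⊠ (τ ⊠ τ) (D ⊠ D)) (cong₂ ℚ._*_ (coefficient-0-⊠ τ τ) (trans (coefficient-0-⊠ D D) (cong₂ ℚ._*_ D₀ D₀)))))
        (ℚ.+-identityˡ _))

  -- Weights along the iteration.

  module TowerWeight (j b d h : ℕ) .{{d≢0 : ℕ.NonZero d}} where
    open TowerPolynomial j b
    open Weight d h

    2^-weight : ∀ k → Weight≥ (k ℕ.* d) 0 (2^ℚ k)
    2^-weight k = weight≥ k (+ 1) (cong int (sym (ℤ.*-identityʳ (+ (2 ^ k))))) (ℕ.m≤m+n _ _)

    private
      infix 4 _⊵_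
      _⊵_ : Poly → ℕ → Set
      p ⊵ w = PolyWeight≥ 0 w p

      open ℕ.+-*-Solver

      u v : ℕ
      u = h ℕ.* j
      v = b ℕ.* d

      slack : ∀ {m n} k → m ℕ.+ k ≡ n → m ℕ.≤ n
      slack {m} k eq = ℕ.≤-trans (ℕ.m≤m+n m k) (ℕ.≤-reflexive eq)

      weaken : ∀ {w w′} p → w ℕ.≤ w′ → p ⊵ w′ → p ⊵ w
      weaken p w≤w′ = polyWeight≥-mono {p = p} w≤w′

      _∙_ : ∀ {w w′ p q} → p ⊵ w → q ⊵ w′ → p ⊠ q ⊵ w ℕ.+ w′
      _∙_ {p = p} {q} = polyWeight≥-⊠ p q

      2-weight : constant 2ℚ ⊵ d
      2-weight = polyWeight≥-constant (weight≥-mono (ℕ.≤-reflexive (sym (ℕ.*-identityˡ d))) (2^-weight 1))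

      4-weight : constant 4ℚ ⊵ 2 ℕ.* d
      4-weight = polyWeight≥-constant (2^-weight 2)

      τ-weight : τ ⊵ v
      τ-weight = polyWeight≥-constant (2^-weight b)

      t-weight : t ⊵ u
      t-weight = polyWeight≥-monomial j

    -- With x = X₃ r when r doublings are left, N / D has weight c r e, Θ = τ / t has
    -- weight M r e, and 2 has at least half of that.
    module _ {N D : Poly} {ω δ : ℕ} (x e y : ℕ) (ω≡ : ω ≡ δ ℕ.+ (4 ℕ.* x ℕ.+ 1) ℕ.* e) (v≡ : v ≡ u ℕ.+ (6 ℕ.* x ℕ.+ 2) ℕ.* e)
             (d≡ : d ≡ (3 ℕ.* x ℕ.+ 1) ℕ.* e ℕ.+ y) (N-weight : N ⊵ ω) (D-weight : D ⊵ δ) where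
      private
        N⊵δ : N ⊵ δ
        N⊵δ = weaken N (slack ((4 ℕ.* x ℕ.+ 1) ℕ.* e) (sym ω≡)) N-weight

      -- The bound is the weight of t² N⁴, the term that leads to x^M. The lower bound on the weight
      -- of 2 enters through 2 t in `A` and through the factor 2 of `B`.
      N′-weight : N′ N D ⊵ 2 ℕ.* u ℕ.+ 4 ℕ.* ω
      N′-weight = weaken (N′ N D) (ℕ.≤-reflexive (solve 2 (λ u ω → con 2 :* u :+ con 4 :* ω := ω :+ (u :+ u :+ (ω :+ (ω :+ ω)))) refl u ω))
        (_∙_ {p = N} {S ⊞ ⊟ (A ⊞ B)} N-weight (polyWeight≥-⊞ S (⊟ (A ⊞ B))
          (_∙_ {p = t ⊠ t} {N ⊠ (N ⊠ N)} (_∙_ {p = t} {t} t-weight t-weight)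
            (_∙_ {p = N} {N ⊠ N} N-weight (_∙_ {p = N} {N} N-weight N-weight)))
          (polyWeight≥-⊟ (A ⊞ B) (polyWeight≥-⊞ A B
            (weaken A (ℕ.≤-reflexive (A-weight ω≡ v≡)) (_∙_ {p = τ ⊠ (constant 2ℚ ⊠ t ⊞ τ)} {N ⊠ (D ⊠ D)}
              (_∙_ {p = τ} {constant 2ℚ ⊠ t ⊞ τ} τ-weight (polyWeight≥-⊞ (constant 2ℚ ⊠ t) τ
                (weaken (constant 2ℚ ⊠ t) (slack ((x ℕ.+ 1) ℕ.* e ℕ.+ y) (2t-weight d≡)) (_∙_ {p = constant 2ℚ} {t} 2-weight t-weight))
                (weaken τ (slack ((4 ℕ.* x ℕ.+ 2) ℕ.* e) (τ-slack v≡)) τ-weight)))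
              (_∙_ {p = N} {D ⊠ D} N-weight (_∙_ {p = D} {D} D-weight D-weight))))
            (weaken B (slack ((3 ℕ.* x ℕ.+ 2) ℕ.* e ℕ.+ y) (B-weight ω≡ v≡ d≡)) (_∙_ {p = constant 2ℚ} {τ ⊠ τ ⊠ (D ⊠ (D ⊠ D))} 2-weight
              (_∙_ {p = τ ⊠ τ} {D ⊠ (D ⊠ D)} (_∙_ {p = τ} {τ} τ-weight τ-weight)
                (_∙_ {p = D} {D ⊠ D} D-weight (_∙_ {p = D} {D} D-weight D-weight)))))))))
        where
        S A B : Poly
        S = t ⊠ t ⊠ (N ⊠ (N ⊠ N))
        A = τ ⊠ (constant 2ℚ ⊠ t ⊞ τ) ⊠ (N ⊠ (D ⊠ D))
        B = constant 2ℚ ⊠ (τ ⊠ τ ⊠ (D ⊠ (D ⊠ D)))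
        A-weight : ∀ {ω v} → ω ≡ δ ℕ.+ (4 ℕ.* x ℕ.+ 1) ℕ.* e → v ≡ u ℕ.+ (6 ℕ.* x ℕ.+ 2) ℕ.* e →
          u ℕ.+ u ℕ.+ (ω ℕ.+ (ω ℕ.+ ω)) ≡ v ℕ.+ (u ℕ.+ 2 ℕ.* x ℕ.* e) ℕ.+ (ω ℕ.+ (δ ℕ.+ δ))
        A-weight refl refl = solve 4 (λ u δ x e → let ω = δ :+ (con 4 :* x :+ con 1) :* e ; v = u :+ (con 6 :* x :+ con 2) :* e in
          u :+ u :+ (ω :+ (ω :+ ω)) := v :+ (u :+ con 2 :* x :* e) :+ (ω :+ (δ :+ δ))) refl u δ x e
        2t-weight : ∀ {d} → d ≡ (3 ℕ.* x ℕ.+ 1) ℕ.* e ℕ.+ y → u ℕ.+ 2 ℕ.* x ℕ.* e ℕ.+ ((x ℕ.+ 1) ℕ.* e ℕ.+ y) ≡ d ℕ.+ u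
        2t-weight refl = solve 4 (λ u x e y → u :+ con 2 :* x :* e :+ ((x :+ con 1) :* e :+ y) :=
          (con 3 :* x :+ con 1) :* e :+ y :+ u) refl u x e y
        τ-slack : ∀ {v} → v ≡ u ℕ.+ (6 ℕ.* x ℕ.+ 2) ℕ.* e → u ℕ.+ 2 ℕ.* x ℕ.* e ℕ.+ (4 ℕ.* x ℕ.+ 2) ℕ.* e ≡ v
        τ-slack refl = solve 3 (λ u x e → u :+ con 2 :* x :* e :+ (con 4 :* x :+ con 2) :* e := u :+ (con 6 :* x :+ con 2) :* e) refl u x e
        B-weight : ∀ {ω v d} → ω ≡ δ ℕ.+ (4 ℕ.* x ℕ.+ 1) ℕ.* e → v ≡ u ℕ.+ (6 ℕ.* x ℕ.+ 2) ℕ.* e → d ≡ (3 ℕ.* x ℕ.+ 1) ℕ.* e ℕ.+ y →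
          u ℕ.+ u ℕ.+ (ω ℕ.+ (ω ℕ.+ ω)) ℕ.+ ((3 ℕ.* x ℕ.+ 2) ℕ.* e ℕ.+ y) ≡ d ℕ.+ (v ℕ.+ v ℕ.+ (δ ℕ.+ (δ ℕ.+ δ)))
        B-weight refl refl refl = solve 5 (λ u δ x e y → let ω = δ :+ (con 4 :* x :+ con 1) :* e ; v = u :+ (con 6 :* x :+ con 2) :* e in
          u :+ u :+ (ω :+ (ω :+ ω)) :+ ((con 3 :* x :+ con 2) :* e :+ y) :=
          (con 3 :* x :+ con 1) :* e :+ y :+ (v :+ v :+ (δ :+ (δ :+ δ)))) refl u δ x e y

      -- The bound is the weight of τ² D⁴, the term that leads to Θ^c. The other terms of `V` have
      -- more factors t, which is lighter than τ, and are compensated by 4 and by N being heavier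
      -- than D.
      D′-weight : D′ N D ⊵ 2 ℕ.* v ℕ.+ 4 ℕ.* δ
      D′-weight = weaken (D′ N D) (ℕ.≤-reflexive (solve 2 (λ v δ → con 2 :* v :+ con 4 :* δ := δ :+ δ :+ (v :+ v :+ (δ :+ δ))) refl v δ))
        (_∙_ {p = D ⊠ (N ⊞ D)} {V N D} (_∙_ {p = D} {N ⊞ D} D-weight (polyWeight≥-⊞ N D N⊵δ D-weight))
          (polyWeight≥-⊞ (A ⊞ B) C (polyWeight≥-⊞ A B
            (weaken A (slack (2 ℕ.* x ℕ.* e ℕ.+ 2 ℕ.* y) (A-weight ω≡ v≡ d≡)) (_∙_ {p = constant 4ℚ} {t ⊠ t ⊠ (N ⊠ N)} 4-weight
              (_∙_ {p = t ⊠ t} {N ⊠ N} (_∙_ {p = t} {t} t-weight t-weight) (_∙_ {p = N} {N} N-weight N-weight))))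
            (weaken B (ℕ.≤-reflexive (B-weight ω≡ v≡)) (_∙_ {p = constant 4ℚ ⊠ (τ ⊠ t) ⊞ τ ⊠ τ} {N ⊠ D}
              (polyWeight≥-⊞ (constant 4ℚ ⊠ (τ ⊠ t)) (τ ⊠ τ)
                (weaken (constant 4ℚ ⊠ (τ ⊠ t)) (slack ((4 ℕ.* x ℕ.+ 1) ℕ.* e ℕ.+ 2 ℕ.* y) (4τt-weight v≡ d≡))
                  (_∙_ {p = constant 4ℚ} {τ ⊠ t} 4-weight (_∙_ {p = τ} {t} τ-weight t-weight)))
                (weaken (τ ⊠ τ) (slack ((4 ℕ.* x ℕ.+ 1) ℕ.* e) (ττ-weight v≡)) (_∙_ {p = τ} {τ} τ-weight τ-weight)))
              (_∙_ {p = N} {D} N-weight D-weight))))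
            (_∙_ {p = τ ⊠ τ} {D ⊠ D} (_∙_ {p = τ} {τ} τ-weight τ-weight) (_∙_ {p = D} {D} D-weight D-weight))))
        where
        A B C : Poly
        A = constant 4ℚ ⊠ (t ⊠ t ⊠ (N ⊠ N))
        B = (constant 4ℚ ⊠ (τ ⊠ t) ⊞ τ ⊠ τ) ⊠ (N ⊠ D)
        C = τ ⊠ τ ⊠ (D ⊠ D)
        s : ℕ
        s = 2 ℕ.* u ℕ.+ (8 ℕ.* x ℕ.+ 3) ℕ.* e
        A-weight : ∀ {ω v d} → ω ≡ δ ℕ.+ (4 ℕ.* x ℕ.+ 1) ℕ.* e → v ≡ u ℕ.+ (6 ℕ.* x ℕ.+ 2) ℕ.* e → d ≡ (3 ℕ.* x ℕ.+ 1) ℕ.* e ℕ.+ y →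
          v ℕ.+ v ℕ.+ (δ ℕ.+ δ) ℕ.+ (2 ℕ.* x ℕ.* e ℕ.+ 2 ℕ.* y) ≡ 2 ℕ.* d ℕ.+ (u ℕ.+ u ℕ.+ (ω ℕ.+ ω))
        A-weight refl refl refl = solve 5 (λ u δ x e y → let ω = δ :+ (con 4 :* x :+ con 1) :* e ; v = u :+ (con 6 :* x :+ con 2) :* e in
          v :+ v :+ (δ :+ δ) :+ (con 2 :* x :* e :+ con 2 :* y) :=
          con 2 :* ((con 3 :* x :+ con 1) :* e :+ y) :+ (u :+ u :+ (ω :+ ω))) refl u δ x e y
        B-weight : ∀ {ω v} → ω ≡ δ ℕ.+ (4 ℕ.* x ℕ.+ 1) ℕ.* e → v ≡ u ℕ.+ (6 ℕ.* x ℕ.+ 2) ℕ.* e →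
          v ℕ.+ v ℕ.+ (δ ℕ.+ δ) ≡ s ℕ.+ (ω ℕ.+ δ)
        B-weight refl refl = solve 4 (λ u δ x e → let ω = δ :+ (con 4 :* x :+ con 1) :* e ; v = u :+ (con 6 :* x :+ con 2) :* e in
          v :+ v :+ (δ :+ δ) := con 2 :* u :+ (con 8 :* x :+ con 3) :* e :+ (ω :+ δ)) refl u δ x e
        4τt-weight : ∀ {v d} → v ≡ u ℕ.+ (6 ℕ.* x ℕ.+ 2) ℕ.* e → d ≡ (3 ℕ.* x ℕ.+ 1) ℕ.* e ℕ.+ y →
          s ℕ.+ ((4 ℕ.* x ℕ.+ 1) ℕ.* e ℕ.+ 2 ℕ.* y) ≡ 2 ℕ.* d ℕ.+ (v ℕ.+ u)
        4τt-weight refl refl = solve 4 (λ u x e y → con 2 :* u :+ (con 8 :* x :+ con 3) :* e :+ ((con 4 :* x :+ con 1) :* e :+ con 2 :* y) :=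
          con 2 :* ((con 3 :* x :+ con 1) :* e :+ y) :+ (u :+ (con 6 :* x :+ con 2) :* e :+ u)) refl u x e y
        ττ-weight : ∀ {v} → v ≡ u ℕ.+ (6 ℕ.* x ℕ.+ 2) ℕ.* e → s ℕ.+ (4 ℕ.* x ℕ.+ 1) ℕ.* e ≡ v ℕ.+ v
        ττ-weight refl = solve 3 (λ u x e → let v = u :+ (con 6 :* x :+ con 2) :* e in
          con 2 :* u :+ (con 8 :* x :+ con 3) :* e :+ (con 4 :* x :+ con 1) :* e := v :+ v) refl u x e

    q-weight : ∀ {N D ω δ} e y → ω ≡ δ ℕ.+ 1 ℕ.* e → v ≡ u ℕ.+ 2 ℕ.* e → d ≡ 1 ℕ.* e ℕ.+ y → N ⊵ ω → D ⊵ δ →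
      q N D ⊵ v ℕ.+ 2 ℕ.* δ
    q-weight {N} {D} {ω} {δ} e y ω≡ v≡ d≡ N-weight D-weight =
      polyWeight≥-⊞ (A ⊞ B) (τ ⊠ (D ⊠ D)) (polyWeight≥-⊞ A B
          (weaken A (ℕ.≤-reflexive (A-weight ω≡ v≡)) (_∙_ {p = t} {N ⊠ N} t-weight (_∙_ {p = N} {N} N-weight N-weight)))
          (weaken B (slack y (B-weight ω≡ v≡ d≡)) (_∙_ {p = constant 2ℚ} {t ⊠ (N ⊠ D)} 2-weight
            (_∙_ {p = t} {N ⊠ D} t-weight (_∙_ {p = N} {D} N-weight D-weight)))))
        (weaken (τ ⊠ (D ⊠ D)) (ℕ.≤-reflexive (solve 2 (λ v δ → v :+ con 2 :* δ := v :+ (δ :+ δ)) refl v δ))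
          (_∙_ {p = τ} {D ⊠ D} τ-weight (_∙_ {p = D} {D} D-weight D-weight)))
      where
      A B : Poly
      A = t ⊠ (N ⊠ N)
      B = constant 2ℚ ⊠ (t ⊠ (N ⊠ D))
      A-weight : ∀ {ω v} → ω ≡ δ ℕ.+ 1 ℕ.* e → v ≡ u ℕ.+ 2 ℕ.* e → v ℕ.+ 2 ℕ.* δ ≡ u ℕ.+ (ω ℕ.+ ω)
      A-weight refl refl = solve 3 (λ u δ e → u :+ con 2 :* e :+ con 2 :* δ := u :+ (δ :+ con 1 :* e :+ (δ :+ con 1 :* e))) refl u δ e
      B-weight : ∀ {ω v d} → ω ≡ δ ℕ.+ 1 ℕ.* e → v ≡ u ℕ.+ 2 ℕ.* e → d ≡ 1 ℕ.* e ℕ.+ y → v ℕ.+ 2 ℕ.* δ ℕ.+ y ≡ d ℕ.+ (u ℕ.+ (ω ℕ.+ δ))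
      B-weight refl refl refl = solve 4 (λ u δ e y → u :+ con 2 :* e :+ con 2 :* δ :+ y :=
        con 1 :* e :+ y :+ (u :+ (δ :+ con 1 :* e :+ δ))) refl u δ e y

    iterate-weight : ∀ r {N D ω δ} e y → ω ≡ δ ℕ.+ c r ℕ.* e → v ≡ u ℕ.+ M r ℕ.* e → d ≡ (3 ℕ.* X₃ r ℕ.+ 1) ℕ.* e ℕ.+ y →
      N ⊵ ω → D ⊵ δ → let (Nᵣ , Dᵣ) = iterate r N D in q Nᵣ Dᵣ ⊵ v ℕ.+ 2 ℕ.* affine-iterate v r δ
    iterate-weight zero    {N} {D} e y ω≡ v≡ d≡ N-weight D-weight = q-weight {N} {D} e y ω≡ v≡ d≡ N-weight D-weight
    -- As r drops by one, e is multiplied by 4: M (r + 1) = 4 M r keeps the weight of Θ, and the new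
    -- weight of N / D is 4 c (r + 1) e - 2 M (r + 1) e = c r (4 e).
    iterate-weight (suc r) {N} {D} {ω} {δ} e y ω≡ v≡ d≡ N-weight D-weight = iterate-weight r {N′ N D} {D′ N D} (4 ℕ.* e) y (ω′≡ ω≡ v≡)
        (trans v≡ (solve 3 (λ u x e → u :+ (con 6 :* (con 4 :* x :+ con 1) :+ con 2) :* e := u :+ (con 6 :* x :+ con 2) :* (con 4 :* e)) refl u (X₃ r) e))
        (trans d≡ (solve 3 (λ x e y → (con 3 :* (con 4 :* x :+ con 1) :+ con 1) :* e :+ y := (con 3 :* x :+ con 1) :* (con 4 :* e) :+ y) refl (X₃ r) e y))
        (N′-weight {N} {D} (X₃ (suc r)) e y ω≡ v≡ d≡ N-weight D-weight)
        (D′-weight {N} {D} (X₃ (suc r)) e y ω≡ v≡ d≡ N-weight D-weight)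
      where
      ω′≡ : ∀ {ω v} → ω ≡ δ ℕ.+ c (suc r) ℕ.* e → v ≡ u ℕ.+ M (suc r) ℕ.* e →
        2 ℕ.* u ℕ.+ 4 ℕ.* ω ≡ 2 ℕ.* v ℕ.+ 4 ℕ.* δ ℕ.+ c r ℕ.* (4 ℕ.* e)
      ω′≡ refl refl = solve 4 (λ u δ x e → let x₁ = con 4 :* x :+ con 1 in
        con 2 :* u :+ con 4 :* (δ :+ (con 4 :* x₁ :+ con 1) :* e) :=
        con 2 :* (u :+ (con 6 :* x₁ :+ con 2) :* e) :+ con 4 :* δ :+ (con 4 :* x :+ con 1) :* (con 4 :* e)) refl u δ (X₃ r) e

-- Choice of the exponents for a prescribed degree.

module Exponents where

  open DoublingPolynomials using (c; M; X₃)
  open import Data.Nat.Base as ℕ using (ℕ; zero; suc; _^_)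
  import Data.Nat.Properties as ℕ
  import Data.Nat.Divisibility as ℕ
  import Data.Nat.Solver as ℕ
  open import Data.Nat.DivMod using (m≡m%n+[m/n]*n; m%n<n)
  open import Data.Nat.Coprimality as Coprime using (Coprime)
  open import Data.Nat.GCD using (gcd; gcd-GCD; gcd[m,n]∣m; gcd[m,n]∣n; gcd[m,n]≢0; module Bézout)
  open import Data.Nat.Induction using (<-rec)
  open import Data.Product.Base using (∃-syntax; _×_; _,_)
  open import Data.Sum.Base using (inj₂)
  open import Relation.Nullary using (Dec; yes; no)
  open import Relation.Binary.PropositionalEquality using (_≡_; refl; cong; cong₂; sym; trans; subst)

  coprime-∣ˡ : ∀ {x y z} → z ℕ.∣ x → Coprime x y → Coprime z y
  coprime-∣ˡ z∣x x⊥y (i∣z , i∣y) = x⊥y (ℕ.∣-trans i∣z z∣x , i∣y)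

  coprime-∣ʳ : ∀ {x y z} → z ℕ.∣ y → Coprime x y → Coprime x z
  coprime-∣ʳ z∣y x⊥y (i∣x , i∣z) = x⊥y (i∣x , ℕ.∣-trans i∣z z∣y)

  coprime-* : ∀ {x y z} → Coprime x y → Coprime x z → Coprime x (y ℕ.* z)
  coprime-* x⊥y x⊥z (i∣x , i∣yz) = x⊥z (i∣x , Coprime.coprime-divisor (coprime-∣ˡ i∣x x⊥y) i∣yz)

  coprime-^ : ∀ {x y} k → Coprime x y → Coprime x (y ^ k)
  coprime-^ zero    x⊥y = Coprime.sym (Coprime.1-coprimeTo _)
  coprime-^ (suc k) x⊥y = coprime-* x⊥y (coprime-^ k x⊥y)

  coprime-+* : ∀ {x y} k → Coprime x y → Coprime (x ℕ.+ k ℕ.* y) y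
  coprime-+* {x} {y} k x⊥y {d} (i∣x+ky , i∣y) =
    x⊥y (ℕ.∣m+n∣m⇒∣n (subst (d ℕ.∣_) (ℕ.+-comm x (k ℕ.* y)) i∣x+ky) (ℕ.∣n⇒∣m*n k i∣y) , i∣y)

  -- Factors gcd(g , h) are stripped from g until none but 1 is left; each one divides h, so k of
  -- them divide hᵏ.
  coprime-part : ∀ h g → 1 ℕ.≤ g → ∃[ u ] ∃[ v ] ∃[ k ] g ≡ u ℕ.* v × Coprime u h × v ℕ.∣ h ^ k
  coprime-part h = <-rec _ go
    where
    go : ∀ g → (∀ {m} → m ℕ.< g → 1 ℕ.≤ m → ∃[ u ] ∃[ v ] ∃[ k ] m ≡ u ℕ.* v × Coprime u h × v ℕ.∣ h ^ k) →
         1 ℕ.≤ g → ∃[ u ] ∃[ v ] ∃[ k ] g ≡ u ℕ.* v × Coprime u h × v ℕ.∣ h ^ k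
    go g rec 1≤g = by (gcd g h ℕ.≟ 1) (gcd[m,n]∣m g h)
      where
      by : Dec (gcd g h ≡ 1) → gcd g h ℕ.∣ g → ∃[ u ] ∃[ v ] ∃[ k ] g ≡ u ℕ.* v × Coprime u h × v ℕ.∣ h ^ k
      by (yes e≡1) _ = g , 1 , 0 , sym (ℕ.*-identityʳ g) , Coprime.gcd≡1⇒coprime e≡1 , ℕ.∣-refl
      by (no e≢1) (ℕ.divides g′ eq) = extend (rec g′<g 1≤g′)
        where
        e : ℕ
        e = gcd g h
        1≤g′ : 1 ℕ.≤ g′
        1≤g′ = ℕ.n≢0⇒n>0 λ g′≡0 → ℕ.<⇒≢ 1≤g (sym (trans eq (cong (ℕ._* e) g′≡0)))
        2≤e : 2 ℕ.≤ e
        2≤e = ℕ.≤∧≢⇒< (ℕ.n≢0⇒n>0 λ e≡0 → ℕ.<⇒≢ 1≤g (sym (trans eq (trans (cong (g′ ℕ.*_) e≡0) (ℕ.*-zeroʳ g′))))) (λ 1≡e → e≢1 (sym 1≡e))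
        g′<g : g′ ℕ.< g
        g′<g = subst (g′ ℕ.<_) (sym eq) (ℕ.m<m*n g′ e {{ℕ.>-nonZero 1≤g′}} 2≤e)
        extend : ∃[ u ] ∃[ v ] ∃[ k ] g′ ≡ u ℕ.* v × Coprime u h × v ℕ.∣ h ^ k →
                 ∃[ u ] ∃[ v ] ∃[ k ] g ≡ u ℕ.* v × Coprime u h × v ℕ.∣ h ^ k
        extend (u , v , k , g′≡uv , u⊥h , v∣hᵏ) = u , e ℕ.* v , suc k ,
          trans eq (trans (cong (ℕ._* e) g′≡uv) (trans (ℕ.*-assoc u v e) (cong (u ℕ.*_) (ℕ.*-comm v e)))) ,
          u⊥h , ℕ.*-pres-∣ (gcd[m,n]∣n g h) v∣hᵏ

  -- Take for u the part of g prime to h, and g = u v. Modulo u and modulo d the number H = h + u d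
  -- is h, prime to both. A common divisor of H and h divides u d, which is prime to h; so H is
  -- prime to h and therefore to v.
  coprime-lift : ∀ {h d} g → 1 ℕ.≤ g → Coprime h d → ∃[ u ] Coprime (h ℕ.+ u ℕ.* d) (g ℕ.* d)
  coprime-lift {h} {d} g 1≤g h⊥d with coprime-part h g 1≤g
  ... | u , v , k , refl , u⊥h , v∣hᵏ = u , coprime-* (coprime-* H⊥u H⊥v) (coprime-+* u h⊥d)
    where
    H : ℕ
    H = h ℕ.+ u ℕ.* d
    H⊥u : Coprime H u
    H⊥u = subst (λ x → Coprime (h ℕ.+ x) u) (ℕ.*-comm d u) (coprime-+* d (Coprime.sym u⊥h))
    H⊥h : Coprime H h
    H⊥h (i∣H , i∣h) = h⊥d (i∣h , Coprime.coprime-divisor (coprime-∣ˡ i∣h (Coprime.sym u⊥h)) (ℕ.∣m+n∣m⇒∣n i∣H i∣h))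
    H⊥v : Coprime H v
    H⊥v = coprime-∣ʳ v∣hᵏ (coprime-^ k H⊥h)

  -- Dividing the Bézout identity by g shows h prime to d / g. Adding multiples of d / g to h
  -- preserves the identity with another m, and `coprime-lift` picks one that is prime to d itself.
  unit-bézout : ∀ n d → 1 ℕ.≤ d → ∃[ h ] ∃[ m ] Coprime h d × gcd n d ℕ.+ n ℕ.* h ≡ d ℕ.* m
  unit-bézout n d@(suc d₋) 1≤d = lift (initial (Bézout.identity (gcd-GCD n d))) (gcd[m,n]∣m n d) (gcd[m,n]∣n n d)
    where
    open ℕ.+-*-Solver
    g : ℕ
    g = gcd n d
    instance
      g≢0 : ℕ.NonZero g
      g≢0 = ℕ.≢-nonZero (gcd[m,n]≢0 n d (inj₂ λ ()))
    initial : Bézout.Identity g n d → ∃[ h ] ∃[ m ] g ℕ.+ n ℕ.* h ≡ d ℕ.* m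
    initial (Bézout.-+ x y eq) = x , y , trans (cong (g ℕ.+_) (ℕ.*-comm n x)) (trans eq (ℕ.*-comm y d))
    -- The identity has the opposite sign here; multiplying x by d - 1, which is -1 modulo d,
    -- corrects it within ℕ.
    initial (Bézout.+- x y eq) = x ℕ.* d₋ , n ℕ.* x ℕ.∸ y , ℕ.+-cancelʳ-≡ (d ℕ.* y) _ _
      (trans (solve 5 (λ g n x d₋ y → g :+ n :* (x :* d₋) :+ (con 1 :+ d₋) :* y := g :+ y :* (con 1 :+ d₋) :+ n :* (x :* d₋)) refl g n x d₋ y)
      (trans (cong (ℕ._+ n ℕ.* (x ℕ.* d₋)) eq)
      (trans (solve 3 (λ n x d₋ → x :* n :+ n :* (x :* d₋) := (con 1 :+ d₋) :* (n :* x)) refl n x d₋)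
      (trans (cong (d ℕ.*_) (sym (ℕ.m∸n+n≡m y≤nx))) (ℕ.*-distribˡ-+ d (n ℕ.* x ℕ.∸ y) y)))))
      where
      y≤nx : y ℕ.≤ n ℕ.* x
      y≤nx = ℕ.≤-trans (ℕ.m≤m*n y d) (ℕ.≤-trans (ℕ.m≤n+m (y ℕ.* d) g) (ℕ.≤-reflexive (trans eq (ℕ.*-comm x n))))
    lift : ∃[ h ] ∃[ m ] g ℕ.+ n ℕ.* h ≡ d ℕ.* m → g ℕ.∣ n → g ℕ.∣ d →
           ∃[ h ] ∃[ m ] Coprime h d × g ℕ.+ n ℕ.* h ≡ d ℕ.* m
    lift (h , m , eq) (ℕ.divides n₁ n≡) (ℕ.divides d₁ d≡) = finish (coprime-lift g (ℕ.>-nonZero⁻¹ g) h⊥d₁)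
      where
      reduced : 1 ℕ.+ n₁ ℕ.* h ≡ d₁ ℕ.* m
      reduced = ℕ.*-cancelˡ-≡ _ _ g (trans (solve 3 (λ g n₁ h → g :* (con 1 :+ n₁ :* h) := g :+ n₁ :* g :* h) refl g n₁ h)
        (trans (cong (λ x → g ℕ.+ x ℕ.* h) (sym n≡)) (trans eq (trans (cong (ℕ._* m) d≡)
          (solve 3 (λ d₁ g m → d₁ :* g :* m := g :* (d₁ :* m)) refl d₁ g m)))))
      h⊥d₁ : Coprime h d₁
      h⊥d₁ {i} (i∣h , i∣d₁) = ℕ.∣1⇒≡1 (ℕ.∣m+n∣m⇒∣n (subst (i ℕ.∣_) (trans (sym reduced) (ℕ.+-comm 1 (n₁ ℕ.* h)))
        (ℕ.∣m⇒∣m*n m i∣d₁)) (ℕ.∣n⇒∣m*n n₁ i∣h))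
      finish : ∃[ u ] Coprime (h ℕ.+ u ℕ.* d₁) (g ℕ.* d₁) → ∃[ h ] ∃[ m ] Coprime h d × g ℕ.+ n ℕ.* h ≡ d ℕ.* m
      finish (u , H⊥) = h ℕ.+ u ℕ.* d₁ , m ℕ.+ u ℕ.* n₁ ,
        subst (Coprime (h ℕ.+ u ℕ.* d₁)) (trans (ℕ.*-comm g d₁) (sym d≡)) H⊥ ,
        trans (solve 5 (λ g n h u d₁ → g :+ n :* (h :+ u :* d₁) := g :+ n :* h :+ n :* (u :* d₁)) refl g n h u d₁)
        (trans (cong₂ ℕ._+_ eq (trans (cong (ℕ._* (u ℕ.* d₁)) n≡) (trans
            (solve 4 (λ n₁ g u d₁ → n₁ :* g :* (u :* d₁) := d₁ :* g :* (u :* n₁)) refl n₁ g u d₁) (cong (ℕ._* (u ℕ.* n₁)) (sym d≡)))))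
          (sym (ℕ.*-distribˡ-+ d m (u ℕ.* n₁))))

  -- x = sⁱ / 2ᵃ and Θ = 2ᵇ / sʲ, where s has weight h and 2 has weight d.
  record Parameters (K d : ℕ) : Set where
    field
      i j a b h g : ℕ
      h⊥d      : Coprime h d
      1≤i      : 1 ℕ.≤ i
      1≤j      : 1 ℕ.≤ j
      j<d      : j ℕ.< d
      degree   : j ℕ.* c K ℕ.+ i ℕ.* M K ≡ d
      exponent : b ℕ.* c K ℕ.+ a ℕ.* M K ≡ h
      x-weight : h ℕ.* i ≡ a ℕ.* d ℕ.+ c K ℕ.* g
      Θ-weight : b ℕ.* d ≡ h ℕ.* j ℕ.+ M K ℕ.* g
      bound    : (3 ℕ.* X₃ K ℕ.+ 1) ℕ.* g ℕ.≤ d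

  -- The first summand covers c j, as j ≤ M. The second leaves i ≥ M c, which keeps a non-negative,
  -- and gives room for g ≤ M in `bound`.
  threshold : ℕ → ℕ
  threshold K = M K ℕ.* c K ℕ.+ M K ℕ.* (M K ℕ.* c K)

  parameters : ∀ K d → threshold K ℕ.≤ d → Parameters K d
  parameters K d large = build (unit-bézout n d 1≤d)
    where
    open ℕ.+-*-Solver
    m₀ c₀ : ℕ
    m₀ = M K
    c₀ = c K
    1≤c₀ : 1 ℕ.≤ c₀
    1≤c₀ = ℕ.m≤n+m 1 (4 ℕ.* X₃ K)
    2≤m₀ : 2 ℕ.≤ m₀
    2≤m₀ = ℕ.m≤n+m 2 (6 ℕ.* X₃ K)
    instance
      m₀≢0 : ℕ.NonZero m₀
      m₀≢0 = ℕ.>-nonZero (ℕ.≤-trans (ℕ.s≤s ℕ.z≤n) 2≤m₀)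
      c₀≢0 : ℕ.NonZero c₀
      c₀≢0 = ℕ.>-nonZero 1≤c₀
    2m₀≡3c₀+1 : 2 ℕ.* m₀ ≡ 3 ℕ.* c₀ ℕ.+ 1
    2m₀≡3c₀+1 = solve 1 (λ x → con 2 :* (con 6 :* x :+ con 2) := con 3 :* (con 4 :* x :+ con 1) :+ con 1) refl (X₃ K)
    m₀≤m₀c₀ : m₀ ℕ.≤ m₀ ℕ.* c₀
    m₀≤m₀c₀ = ℕ.m≤m*n m₀ c₀
    m₀<d : m₀ ℕ.< d
    m₀<d = ℕ.≤-trans (ℕ.≤-trans (ℕ.≤-reflexive (ℕ.+-comm 1 m₀)) (ℕ.+-mono-≤ m₀≤m₀c₀
      (ℕ.≤-trans (ℕ.≤-trans (ℕ.≤-trans (ℕ.s≤s ℕ.z≤n) 2≤m₀) m₀≤m₀c₀) (ℕ.m≤n*m (m₀ ℕ.* c₀) m₀)))) large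
    1≤d : 1 ℕ.≤ d
    1≤d = ℕ.≤-trans (ℕ.s≤s ℕ.z≤n) m₀<d
    instance
      d≢0 : ℕ.NonZero d
      d≢0 = ℕ.>-nonZero 1≤d
    r k n j i g : ℕ
    -- Here n is the least integer with M n > 3 d, so that j = M n - 3 d lies between 1 and M; a
    -- small j leaves most of the degree d to i.
    r = (3 ℕ.* d) ℕ.% m₀
    k = (3 ℕ.* d) ℕ./ m₀
    n = suc k
    j = m₀ ℕ.∸ r
    i = 2 ℕ.* d ℕ.∸ c₀ ℕ.* n
    g = gcd n d
    r<m₀ : r ℕ.< m₀
    r<m₀ = m%n<n (3 ℕ.* d) m₀
    1≤j : 1 ℕ.≤ j
    1≤j = ℕ.m<n⇒0<n∸m r<m₀
    j≤m₀ : j ℕ.≤ m₀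
    j≤m₀ = ℕ.m∸n≤m m₀ r
    m₀n≡ : m₀ ℕ.* n ≡ 3 ℕ.* d ℕ.+ j
    m₀n≡ = trans (solve 2 (λ m k → m :* (con 1 :+ k) := k :* m :+ m) refl m₀ k)
      (trans (cong (k ℕ.* m₀ ℕ.+_) (sym (ℕ.m+[n∸m]≡n (ℕ.<⇒≤ r<m₀))))
      (trans (solve 3 (λ q r j → q :+ (r :+ j) := r :+ q :+ j) refl (k ℕ.* m₀) r j)
        (cong (ℕ._+ j) (sym (m≡m%n+[m/n]*n (3 ℕ.* d) m₀)))))
    c₀j+m₀m₀c₀≤d : c₀ ℕ.* j ℕ.+ m₀ ℕ.* (m₀ ℕ.* c₀) ℕ.≤ d
    c₀j+m₀m₀c₀≤d = ℕ.≤-trans (ℕ.+-monoˡ-≤ (m₀ ℕ.* (m₀ ℕ.* c₀)) (ℕ.≤-trans (ℕ.*-monoʳ-≤ c₀ j≤m₀) (ℕ.≤-reflexive (ℕ.*-comm c₀ m₀)))) large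
    m₀c₀n≡ : m₀ ℕ.* (c₀ ℕ.* n) ≡ 3 ℕ.* c₀ ℕ.* d ℕ.+ c₀ ℕ.* j
    m₀c₀n≡ = trans (solve 3 (λ m c n → m :* (c :* n) := c :* (m :* n)) refl m₀ c₀ n) (trans (cong (c₀ ℕ.*_) m₀n≡)
      (solve 3 (λ c d j → c :* (con 3 :* d :+ j) := con 3 :* c :* d :+ c :* j) refl c₀ d j))
    m₀2d≡ : m₀ ℕ.* (2 ℕ.* d) ≡ 3 ℕ.* c₀ ℕ.* d ℕ.+ d
    m₀2d≡ = trans (solve 2 (λ m d → m :* (con 2 :* d) := con 2 :* m :* d) refl m₀ d) (trans (cong (ℕ._* d) 2m₀≡3c₀+1)
      (solve 2 (λ c d → (con 3 :* c :+ con 1) :* d := con 3 :* c :* d :+ d) refl c₀ d))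
    i+c₀n≡2d : i ℕ.+ c₀ ℕ.* n ≡ 2 ℕ.* d
    i+c₀n≡2d = ℕ.m∸n+n≡m (ℕ.*-cancelˡ-≤ m₀ (ℕ.≤-trans (ℕ.≤-reflexive m₀c₀n≡)
      (ℕ.≤-trans (ℕ.+-monoʳ-≤ (3 ℕ.* c₀ ℕ.* d) (ℕ.≤-trans (ℕ.m≤m+n _ _) c₀j+m₀m₀c₀≤d)) (ℕ.≤-reflexive (sym m₀2d≡)))))
    degree : j ℕ.* c₀ ℕ.+ i ℕ.* m₀ ≡ d
    degree = ℕ.+-cancelˡ-≡ (3 ℕ.* c₀ ℕ.* d) _ _ (trans
      (solve 5 (λ c d j i m → con 3 :* c :* d :+ (j :* c :+ i :* m) := con 3 :* c :* d :+ c :* j :+ m :* i) refl c₀ d j i m₀)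
      (trans (cong (ℕ._+ m₀ ℕ.* i) (sym m₀c₀n≡)) (trans (sym (ℕ.*-distribˡ-+ m₀ (c₀ ℕ.* n) i))
        (trans (cong (m₀ ℕ.*_) (trans (ℕ.+-comm (c₀ ℕ.* n) i) i+c₀n≡2d)) m₀2d≡))))
    m₀c₀≤i : m₀ ℕ.* c₀ ℕ.≤ i
    m₀c₀≤i = ℕ.*-cancelˡ-≤ m₀ (ℕ.+-cancelˡ-≤ (c₀ ℕ.* j) _ _ (ℕ.≤-trans c₀j+m₀m₀c₀≤d (ℕ.≤-reflexive (trans (sym degree)
      (cong₂ ℕ._+_ (ℕ.*-comm j c₀) (ℕ.*-comm i m₀))))))
    g≤m₀ : g ℕ.≤ m₀
    g≤m₀ = ℕ.≤-trans (ℕ.∣⇒≤ {{ℕ.>-nonZero 1≤j}} (ℕ.∣m+n∣m⇒∣n (subst (g ℕ.∣_) m₀n≡ (ℕ.∣n⇒∣m*n m₀ (gcd[m,n]∣m n d)))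
      (ℕ.∣n⇒∣m*n 3 (gcd[m,n]∣n n d)))) j≤m₀
    build : ∃[ h ] ∃[ m ] Coprime h d × g ℕ.+ n ℕ.* h ≡ d ℕ.* m → Parameters K d
    build (h , m , h⊥d , eq) = record
      { i = i ; j = j ; a = a ; b = b ; h = h ; g = g
      ; h⊥d = h⊥d
      ; 1≤i = ℕ.≤-trans (ℕ.≤-trans (ℕ.≤-trans (ℕ.s≤s ℕ.z≤n) 2≤m₀) m₀≤m₀c₀) m₀c₀≤i
      ; 1≤j = 1≤j
      ; j<d = ℕ.≤-<-trans j≤m₀ m₀<d
      ; degree = degree
      ; exponent = ℕ.+-cancelʳ-≡ (3 ℕ.* h ℕ.* c₀ ℕ.+ c₀ ℕ.* m ℕ.* m₀) _ _ (trans
          (solve 6 (λ b c a m₀ h m → b :* c :+ a :* m₀ :+ (con 3 :* h :* c :+ c :* m :* m₀) :=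
             (b :+ con 3 :* h) :* c :+ (a :+ c :* m) :* m₀) refl b c₀ a m₀ h m)
          (trans (cong₂ (λ x y → x ℕ.* c₀ ℕ.+ y ℕ.* m₀) b+3h≡ a+c₀m≡)
          (trans (solve 4 (λ m₀ m c h → m₀ :* m :* c :+ con 2 :* h :* m₀ := con 2 :* m₀ :* h :+ c :* m :* m₀) refl m₀ m c₀ h)
          (trans (cong (λ x → x ℕ.* h ℕ.+ c₀ ℕ.* m ℕ.* m₀) 2m₀≡3c₀+1)
            (solve 4 (λ m₀ m c h → (con 3 :* c :+ con 1) :* h :+ c :* m :* m₀ := h :+ (con 3 :* h :* c :+ c :* m :* m₀)) refl m₀ m c₀ h)))))
      ; x-weight = ℕ.+-cancelʳ-≡ (c₀ ℕ.* (n ℕ.* h)) _ _ (trans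
          (solve 4 (λ h i c n → h :* i :+ c :* (n :* h) := (i :+ c :* n) :* h) refl h i c₀ n)
          (trans (cong (ℕ._* h) i+c₀n≡2d) (trans (solve 2 (λ d h → con 2 :* d :* h := con 2 :* h :* d) refl d h)
          (trans (cong (ℕ._* d) (sym a+c₀m≡)) (trans (solve 4 (λ a c m d → (a :+ c :* m) :* d := a :* d :+ c :* (d :* m)) refl a c₀ m d)
          (trans (cong (λ x → a ℕ.* d ℕ.+ c₀ ℕ.* x) (sym eq))
            (solve 4 (λ y c g n → y :+ c :* (g :+ n) := y :+ c :* g :+ c :* n) refl (a ℕ.* d) c₀ g (n ℕ.* h))))))))
      ; Θ-weight = ℕ.+-cancelʳ-≡ (3 ℕ.* h ℕ.* d) _ _ (trans (sym (ℕ.*-distribʳ-+ d b (3 ℕ.* h)))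
          (trans (cong (ℕ._* d) b+3h≡) (trans (solve 3 (λ m₀ m d → m₀ :* m :* d := m₀ :* (d :* m)) refl m₀ m d)
          (trans (cong (m₀ ℕ.*_) (sym eq)) (trans (solve 4 (λ m g n h → m :* (g :+ n :* h) := m :* n :* h :+ m :* g) refl m₀ g n h)
          (trans (cong (λ x → x ℕ.* h ℕ.+ m₀ ℕ.* g) m₀n≡)
            (solve 4 (λ d j h y → (con 3 :* d :+ j) :* h :+ y := h :* j :+ y :+ con 3 :* h :* d) refl d j h (m₀ ℕ.* g))))))))
      ; bound = ℕ.≤-trans (ℕ.*-mono-≤ (ℕ.≤-trans (ℕ.m≤m+n (3 ℕ.* X₃ K ℕ.+ 1) (3 ℕ.* X₃ K ℕ.+ 1)) (ℕ.≤-reflexive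
          (solve 1 (λ x → con 3 :* x :+ con 1 :+ (con 3 :* x :+ con 1) := con 6 :* x :+ con 2) refl (X₃ K)))) g≤m₀)
          (ℕ.≤-trans (ℕ.*-monoʳ-≤ m₀ m₀≤m₀c₀) (ℕ.≤-trans (ℕ.m≤n+m _ _) large))
      }
      where
      a b : ℕ
      a = 2 ℕ.* h ℕ.∸ c₀ ℕ.* m
      b = m₀ ℕ.* m ℕ.∸ 3 ℕ.* h
      1≤h : 1 ℕ.≤ h
      1≤h = ℕ.n≢0⇒n>0 λ h≡0 → ℕ.<⇒≢ (ℕ.≤-trans 2≤m₀ (ℕ.<⇒≤ m₀<d)) (sym (h⊥d (subst (d ℕ.∣_) (sym h≡0) (d ℕ.∣0) , ℕ.∣-refl)))
      -- The truncated subtraction in a is exact: d (2 h - c m) = h i - c g, and c g ≤ c M ≤ i ≤ i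
      -- h.
      a+c₀m≡ : a ℕ.+ c₀ ℕ.* m ≡ 2 ℕ.* h
      a+c₀m≡ = ℕ.m∸n+n≡m (ℕ.*-cancelˡ-≤ d (ℕ.≤-trans (ℕ.≤-reflexive (trans
          (solve 3 (λ d c m → d :* (c :* m) := c :* (d :* m)) refl d c₀ m) (trans (cong (c₀ ℕ.*_) (sym eq)) (ℕ.*-distribˡ-+ c₀ g (n ℕ.* h)))))
        (ℕ.≤-trans (ℕ.+-monoˡ-≤ (c₀ ℕ.* (n ℕ.* h)) (ℕ.≤-trans (ℕ.*-monoʳ-≤ c₀ g≤m₀) (ℕ.≤-trans (ℕ.≤-reflexive (ℕ.*-comm c₀ m₀))
            (ℕ.≤-trans m₀c₀≤i (ℕ.m≤m*n i h {{ℕ.>-nonZero 1≤h}})))))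
          (ℕ.≤-reflexive (trans (solve 4 (λ i h c n → i :* h :+ c :* (n :* h) := (i :+ c :* n) :* h) refl i h c₀ n)
            (trans (cong (ℕ._* h) i+c₀n≡2d) (solve 2 (λ d h → con 2 :* d :* h := d :* (con 2 :* h)) refl d h)))))))
      -- Exact as well, since d (M m - 3 h) = j h + M g.
      b+3h≡ : b ℕ.+ 3 ℕ.* h ≡ m₀ ℕ.* m
      b+3h≡ = ℕ.m∸n+n≡m (ℕ.*-cancelˡ-≤ d (ℕ.≤-trans (ℕ.m≤m+n _ (j ℕ.* h ℕ.+ m₀ ℕ.* g)) (ℕ.≤-reflexive (trans
        (solve 4 (λ d h j y → d :* (con 3 :* h) :+ (j :* h :+ y) := (con 3 :* d :+ j) :* h :+ y) refl d h j (m₀ ℕ.* g))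
        (trans (cong (λ x → x ℕ.* h ℕ.+ m₀ ℕ.* g) (sym m₀n≡)) (trans (solve 4 (λ m n h g → m :* n :* h :+ m :* g := m :* (g :+ n :* h)) refl m₀ n h g)
        (trans (cong (m₀ ℕ.*_) eq) (solve 3 (λ m₀ d m → m₀ :* (d :* m) := d :* (m₀ :* m)) refl m₀ d m))))))))

-- The fields of degree d, and the upper density.

module TorsionFields where

  open GroupLaw
  open PolynomialRings
  open DyadicWeights
  open Doubling
  open DoublingPolynomials
  open Exponents
  open import Data.Fin.Base using (Fin; toℕ; fromℕ<)
  import Data.Fin.Properties as Fin
  open import Data.Integer.Base as ℤ using (ℤ; +_)
  import Data.Integer.Properties as ℤ
  open import Data.List.Base using ([]; _∷_; length)
  open import Data.List.Properties using (length-map)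
  open import Data.Nat.Base as ℕ using (ℕ; zero; suc; _^_)
  import Data.Nat.Properties as ℕ
  open import Data.Product.Base using (Σ-syntax; ∃-syntax; _,_; proj₁; proj₂)
  open import Data.Rational.Base as ℚ using (ℚ; 0ℚ; 1ℚ)
  import Data.Rational.Properties as ℚ
  import Data.Rational.Unnormalised.Base as ℚᵘ
  import Data.Rational.Unnormalised.Properties as ℚᵘ
  open import Data.Unit.Polymorphic.Base using (tt)
  open import Function.Base using (_∘_)
  open import Relation.Nullary using (¬_)
  open import Relation.Unary using (Pred)
  open import Relation.Binary.Definitions using (tri<; tri≈; tri>)
  open import Relation.Binary.PropositionalEquality using (_≡_; _≢_; refl; cong; cong₂; sym; trans; subst)
  import Data.Nat.Solver as ℕ

  2^ℚ≢0 : ∀ n → 2^ℚ n ≢ 0ℚ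
  2^ℚ≢0 n e = ℕ.≢-nonZero⁻¹ (2 ^ n) {{ℕ.m^n≢0 2 n}} (ℤ.+-injective (int-injective e))

  module TowerField {K d₋ : ℕ} (parameters : Parameters K (suc d₋)) where
    open Parameters parameters
    open TowerPolynomial j b using (t; τ; iterate-monic; iterate-constant) renaming (iterate to iterateₚ; q to qₚ)
    open TowerWeight j b (suc d₋) h using (iterate-weight; 2^-weight)
    open Weight (suc d₋) h

    private
      d : ℕ
      d = suc d₋
      N₀ D₀ Q : Poly
      N₀ = monomial i
      D₀ = constant (2^ℚ a)
      Q = qₚ (proj₁ (iterateₚ K N₀ D₀)) (proj₂ (iterateₚ K N₀ D₀))

    Q-monic : Monic d Q
    Q-monic = monic-degree (trans (affine-iterate-closed j K i) degree)
      (iterate-monic K (monic-monomial i) (below-mono 1≤i (below-constant (2^ℚ a))))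

    Q-constant : coefficient Q 0 ≡ 2^ℚ h
    Q-constant = trans (iterate-constant 1≤j K {a} {N₀} {D₀} (coefficient-monomial-< 1≤i) refl)
      (cong 2^ℚ (trans (affine-iterate-closed b K a) exponent))

    Q-weight : PolyWeight≥ 0 (h ℕ.* d) Q
    Q-weight = subst (λ w → PolyWeight≥ 0 w Q)
      (trans (affine-iterate-closed (b ℕ.* d) K (a ℕ.* d)) (trans
        (solve 5 (λ b d c a m → b :* d :* c :+ a :* d :* m := (b :* c :+ a :* m) :* d) refl b d (c K) a (M K))
        (cong (ℕ._* d) exponent)))
      (iterate-weight K {N₀} {D₀} g (d ℕ.∸ (3 ℕ.* X₃ K ℕ.+ 1) ℕ.* g) x-weight Θ-weight (sym (ℕ.m+[n∸m]≡n bound))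
        (polyWeight≥-monomial i) (polyWeight≥-constant (2^-weight a)))
      where open ℕ.+-*-Solver

    f : Fin d → ℚ
    f k = coefficient Q (toℕ k)

    monic-f≈Q : ℚ[s].monic f ℚ[s].≈ Q
    monic-f≈Q = ℚ[s].coefficients⇒ λ e → trans (coefficient-⊞ (polynomial f) (monomial d) e) (entry e (ℕ.<-cmp e d))
      where
      r : Poly
      r = proj₁ Q-monic
      Q-coefficient : ∀ e → d ℕ.≤ e → coefficient Q e ≡ coefficient (monomial d) e
      Q-coefficient e d≤e = trans (ℚ[s].≈⇒coefficients (proj₂ (proj₂ Q-monic)) e) (trans (coefficient-⊞ (monomial d) r e)
        (trans (cong (coefficient (monomial d) e ℚ.+_) (Below.vanishes (proj₁ (proj₂ Q-monic)) e d≤e)) (ℚ.+-identityʳ _)))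
      upper : ∀ e → d ℕ.≤ e → coefficient (polynomial f) e ℚ.+ coefficient (monomial d) e ≡ coefficient Q e
      upper e d≤e = trans (cong (ℚ._+ coefficient (monomial d) e)
          (coefficient-beyond (polynomial f) (ℕ.≤-trans (ℕ.≤-reflexive (length-polynomial f)) d≤e)))
        (trans (ℚ.+-identityˡ _) (sym (Q-coefficient e d≤e)))
      entry : ∀ e → _ → coefficient (polynomial f) e ℚ.+ coefficient (monomial d) e ≡ coefficient Q e
      entry e (tri< e<d _ _) = trans (cong₂ ℚ._+_
          (trans (cong (coefficient (polynomial f)) (sym (Fin.toℕ-fromℕ< e<d))) (trans (coefficient-polynomial f (fromℕ< e<d))
            (cong (coefficient Q) (Fin.toℕ-fromℕ< e<d))))
          (coefficient-monomial-< e<d)) (ℚ.+-identityʳ _)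
      entry e (tri≈ _ e≡d _) = upper e (ℕ.≤-reflexive (sym e≡d))
      entry e (tri> _ _ d<e) = upper e (ℕ.<⇒≤ d<e)

    private
      module R = Companion f

    Q-irreducible : ∀ p t → length p ℕ.≤ d → length t ℕ.≤ d → ¬ p ⊠ t ℚ[s].≈ R.monic f
    Q-irreducible = irreducible h⊥d (R.monic f) (polyWeight≥-≈ {p = Q} {R.monic f} (ℚ[s].≈-sym monic-f≈Q) Q-weight)
      (trans (ℚ[s].≈⇒coefficients monic-f≈Q d) top) (trans (ℚ[s].≈⇒coefficients monic-f≈Q 0) Q-constant)
      where
      top : coefficient Q d ≡ 1ℚ
      top = trans (ℚ[s].≈⇒coefficients (proj₂ (proj₂ Q-monic)) d) (trans (coefficient-⊞ (monomial d) (proj₁ Q-monic) d)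
        (trans (cong₂ ℚ._+_ (coefficient-monomial d) (Below.vanishes (proj₁ (proj₂ Q-monic)) d ℕ.≤-refl)) (ℚ.+-identityʳ 1ℚ)))

    numberField : NumberField
    numberField = R.numberField Q-irreducible

    private
      -- Nothing of degree below d is reduced modulo f, so a single non-zero coefficient suffices.
      nonzero : ∀ p {e} → length p ℕ.≤ d → e ℕ.< d → coefficient p e ≢ 0ℚ → ¬ p R.≈ []
      nonzero p {e} len e<d coefficient≢0 p≈0 = coefficient≢0 (trans (cong (coefficient p) (sym (Fin.toℕ-fromℕ< e<d)))
        (trans (sym (R.act-e₀ p len (fromℕ< e<d))) (R.act-≡ p≈0 R.e₀ (fromℕ< e<d))))

      open DoublingTower numberField t τ using (tower⇒torsion)
      open Iteration (NumberField.commutativeRing numberField) constant t τ using (iterate; q)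

      -- ℚ[s] and ℚ[s]/(f) have the same carrier and operations and differ only in their equality,
      -- so both iterations compute the same lists.
      iterate≡ : ∀ k N D → iterate k N D ≡ iterateₚ k N D
      iterate≡ zero    N D = refl
      iterate≡ (suc k) N D = iterate≡ k _ _

      q≈0 : q (proj₁ (iterate K N₀ D₀)) (proj₂ (iterate K N₀ D₀)) R.≈ []
      q≈0 = subst (λ p → q (proj₁ p) (proj₂ p) R.≈ []) (sym (iterate≡ K N₀ D₀))
        (trans≈ (R.ℚ[s]-≈⇒≈ (ℚ[s].≈-sym monic-f≈Q)) R.f≈0)
        where trans≈ = NumberField.trans numberField

      1≤d : 1 ℕ.≤ d
      1≤d = ℕ.s≤s ℕ.z≤n

      length-t : length t ℕ.≤ d
      length-t = ℕ.≤-trans (ℕ.≤-reflexive (length-monomial j)) j<d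

      coefficient-constant-j : ∀ x → coefficient (constant x) j ≡ 0ℚ
      coefficient-constant-j x = coefficient-beyond (constant x) 1≤j

      1≢0 : 1ℚ ≢ 0ℚ
      1≢0 ()

    torsion : ∀ {l} → l ℕ.≤ suc (suc K) → Σ[ E ∈ EllipticCurve numberField ] AtLeast l (torsionPoints E)
    torsion = tower⇒torsion
      (nonzero t length-t j<d (1≢0 ∘ trans (sym (coefficient-monomial j))))
      -- The coefficient is taken at j, where the constant τ contributes nothing because j ≥ 1; the
      -- same holds for τ + 8 t below.
      (nonzero (t ⊞ ⊟ τ) (R.length-⊞ t (⊟ τ) length-t 1≤d) j<d
        (1≢0 ∘ trans (sym (trans (coefficient-⊞ t (⊟ τ) j) (cong₂ ℚ._+_ (coefficient-monomial j)
          (coefficient-constant-j (ℚ.- 2^ℚ b)))))))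
      (nonzero τ 1≤d 1≤d (2^ℚ≢0 b))
      (nonzero (τ ⊞ constant 8ℚ ⊠ t) (R.length-⊞ τ (constant 8ℚ ⊠ t) 1≤d
          (R.length-⊞ (scale 8ℚ t) (0ℚ ∷ []) (ℕ.≤-trans (ℕ.≤-reflexive (length-map (8ℚ ℚ.*_) t)) length-t) 1≤d)) j<d
        (8≢0 ∘ trans (sym (trans (coefficient-⊞ τ (constant 8ℚ ⊠ t) j) (cong₂ ℚ._+_ (coefficient-constant-j (2^ℚ b))
          (trans (coefficient-constant-⊠ 8ℚ t j) (cong (8ℚ ℚ.*_) (coefficient-monomial j))))))))
      K (nonzero D₀ 1≤d 1≤d (2^ℚ≢0 a)) q≈0
      where
      8≢0 : 8ℚ ≢ 0ℚ
      8≢0 ()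

  𝒮-large : ∀ B d → threshold B ℕ.≤ d → 1 ℕ.≤ d → 𝒮 𝒜⟨1⟩ B d
  𝒮-large B (suc d) large _ = numberField , refl , proj₁ E , tt , proj₂ E
    where
    open TowerField (parameters B (suc d) large)
    E : Σ[ E ∈ EllipticCurve numberField ] AtLeast B (torsionPoints E)
    -- K = B doublings already yield B + 2 torsion points.
    E = torsion (ℕ.m≤n⇒m≤1+n (ℕ.n≤1+n B))

  -- With η = 1/4 the proportion would be at most 3/4 from some X on. For x = X + 4 (T + 1) + 1 the
  -- x - (T + 1) integers from T + 1 to x - 1 all lie in S, and they exceed 3/4 of x because x > 4
  -- (T + 1).
  ¬upperDensity≤½ : ∀ {a} (S : Pred ℕ a) T → (∀ d → T ℕ.≤ d → 1 ℕ.≤ d → S d) → ¬ UpperDensityAtMost ℚ.½ S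
  ¬upperDensity≤½ S T large bounded = by (bounded (+ 1 ℚ./ 4) (ℚ.*<* (ℤ.+<+ (ℕ.s≤s ℕ.z≤n))))
    where
    by : ∃[ X ] (∀ x .{{_ : ℕ.NonZero x}} → X ℕ.≤ x → ∀ n → AtLeast n (S ∩[1, x ]) → + n ℚ./ x ℚ.≤ ℚ.½ ℚ.+ + 1 ℚ./ 4) → _
    by (X , bound) = ℕ.<⇒≱ (ℕ.s≤s (ℕ.m≤n+m (4 ℕ.* T′) X)) x≤4T
      where
      T′ x′ x n : ℕ
      T′ = suc T
      x′ = X ℕ.+ 4 ℕ.* T′
      x = suc x′
      n = x ℕ.∸ T′
      T+n≡x : T′ ℕ.+ n ≡ x
      T+n≡x = ℕ.m+[n∸m]≡n (ℕ.≤-trans (ℕ.m≤n*m T′ 4) (ℕ.≤-trans (ℕ.m≤n+m (4 ℕ.* T′) X) (ℕ.n≤1+n x′)))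
      many : AtLeast n (S ∩[1, x ])
      many = record
        { to = λ k → T′ ℕ.+ toℕ k , large _ (ℕ.≤-trans (ℕ.n≤1+n T) (ℕ.m≤m+n T′ (toℕ k))) (ℕ.s≤s ℕ.z≤n) , ℕ.s≤s ℕ.z≤n ,
                     ℕ.<⇒≤ (subst (T′ ℕ.+ toℕ k ℕ.<_) T+n≡x (ℕ.+-monoʳ-< T′ (Fin.toℕ<n k)))
        ; cong = cong (λ k → T′ ℕ.+ toℕ k)
        ; injective = λ e → Fin.toℕ-injective (ℕ.+-cancelˡ-≡ T′ _ _ e) }
      4n≤3x : n ℕ.* 4 ℕ.≤ 3 ℕ.* x
      4n≤3x = ℤ.drop‿+≤+ (subst (ℤ._≤ + (3 ℕ.* x)) (sym (ℤ.pos-* n 4)) (ℚᵘ.drop-*≤* (ℚᵘ.≤-trans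
        (ℚᵘ.≤-reflexive (ℚᵘ.≃-sym (ℚ.toℚᵘ-fromℚᵘ (ℚᵘ.mkℚᵘ (+ n) x′))))
        (ℚ.toℚᵘ-mono-≤ (bound x (ℕ.≤-trans (ℕ.m≤m+n X (4 ℕ.* T′)) (ℕ.n≤1+n x′)) n many)))))
      x≤4T : x ℕ.≤ 4 ℕ.* T′
      x≤4T = ℕ.+-cancelˡ-≤ (3 ℕ.* x) _ _ (ℕ.≤-trans (ℕ.≤-reflexive (trans (ℕ.+-comm (3 ℕ.* x) x)
          (trans (cong (4 ℕ.*_) (sym T+n≡x)) (solve 2 (λ T n → con 4 :* (T :+ n) := n :* con 4 :+ con 4 :* T) refl T′ n))))
        (ℕ.+-monoˡ-≤ (4 ℕ.* T′) 4n≤3x))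
        where open ℕ.+-*-Solver

open Exponents using (threshold)
open TorsionFields using (𝒮-large; ¬upperDensity≤½)
open import Data.Integer.Base using (+<+)
open import Data.List.Base using (upTo)
open import Data.List.Membership.Propositional.Properties using (∈-upTo⁺)
open import Data.Nat.Base using (s≤s; z≤n)
open import Data.Nat.Properties using (≮⇒≥)
open import Data.Product.Base using (_,_)
open import Data.Rational.Base using (½; *<*)
open import Function.Base using (_∘_)

theorem1p6 : (∀ (B : ℕ) → 1 ≤ B → ContainsAllButFinitelyMany⁺ (𝒮 𝒜⟨1⟩ B))
    × ¬ TypicallyBounded 𝒜⟨1⟩
    × (∃[ ε ] 0ℚ < ε × (∀ (B : ℕ) → 1 ≤ B → ¬ UpperDensityAtMost ε (𝒮 𝒜⟨1⟩ B)))
theorem1p6 = (λ B _ → upTo (threshold B) , λ d 1≤d d∉ → 𝒮-large B d (≮⇒≥ (d∉ ∘ ∈-upTo⁺)) 1≤d)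
  , (λ bounded → let (B , _ , density≤½) = bounded ½ 0<½ in not-dense B density≤½)
  , ½ , 0<½ , λ B _ → not-dense B
  where
  0<½ : 0ℚ < ½
  0<½ = *<* (+<+ (s≤s z≤n))
  not-dense : ∀ B → ¬ UpperDensityAtMost ½ (𝒮 𝒜⟨1⟩ B)
  not-dense B = ¬upperDensity≤½ (𝒮 𝒜⟨1⟩ B) (threshold B) (𝒮-large B)
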